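{- Let $q$ be a power of $2$. The Penttila–Williford $3$-class association schemes and the Hollmann–Xiang $3$-class (fusion) association scheme are isomorphic: for each of the two relative hemisystems $\mathcal H$ described below, there is a bijection $\varphi$ from the set $\mathcal E$ of elliptic lines to $\mathcal H$ such that for every $i\in\{0,1,2,3\}$, $(\bar\ell,\bar\ell')\in R_i$ if and only if $(\varphi(\bar\ell),\varphi(\bar\ell'))\in \widetilde R_i$.
   Context: Throughout $q=2^h$. An isomorphism of association schemes $(X,\{R_i\}_{i=0}^d)$ and $(X',\{R'_i\}_{i=0}^d)$ is a bijection $\varphi:X\to X'$ such that for each $i$ there is $j$ with $\{(\varphi(x),\varphi(y)):(x,y)\in R_i\}=R'_j$. Hollmann–Xiang scheme. Embed $\mathrm{PG}(2,q^2)$ in $\mathrm{PG}(2,q^4)$ by extension of scalars and let $\overline{\mathcal C}=\{\langle(1,t,t^2)\rangle: t\in\mathbb F_{q^4}\}\cup\{\langle(0,0,1)\rangle\}$ be the conic $y^2=xz$ of $\mathrm{PG}(2,q^4)$. An elliptic line is the extension to $\mathrm{PG}(2,q^4)$ of a line of $\mathrm{PG}(2,q^2)$ disjoint from $\mathcal C=\overline{\mathcal C}\cap \mathrm{PG}(2,q^2)$; each such line meets $\overline{\mathcal C}$ in $\{\langle(1,t,t^2)\rangle,\langle(1,t^{q^2},t^{2q^2})\rangle\}$ for some $t\in\mathbb F_{q^4}\setminus\mathbb F_{q^2}$, and we denote it $\bar\ell_{\mathbf t}$ with $\mathbf t=\{t,t^{q^2}\}$. Let $\mathcal E$ be the set of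 elliptic lines. For distinct $\bar\ell_{\mathbf s},\bar\ell_{\mathbf t}$ put $\rho(s,t)=\frac{(s+t)(s^{q^2}+t^{q^2})}{(s+t^{q^2})(s^{q^2}+t)}$ and $\widehat\rho(\mathbf s,\mathbf t)=1/(\rho(s,t)+\rho(s,t)^{ -1})\in\mathbb F_{q^2}$. Let $\mathbf T_0$ be the set of elements of $\mathbb F_{q^2}$ of absolute trace $0$ (i.e. $\sum_{i=0}^{2h-1}x^{2^i}=0$), $\mathbf S_0$ the set of elements of $\mathbb F_q$ of absolute trace $0$ ($\sum_{i=0}^{h-1}x^{2^i}=0$), $\mathbf S_0^*=\mathbf S_0\setminus\{0\}$, $\mathbf S_1=\mathbb F_q\setminus\mathbf S_0$. Relations on $\mathcal E$: $R_0$ is the identity; $(\bar\ell_{\mathbf s},\bar\ell_{\mathbf t})\in R_1$ iff $\widehat\rho(\mathbf s,\mathbf t)\in\mathbf S_0^*$; $\in R_2$ iff $\widehat\rho(\mathbf s,\mathbf t)\in\mathbf S_1$; $\in R_3$ iff $\widehat\rho(\mathbf s,\mathbf t)\in\mathbf T_0\setminus\mathbb F_q$. This is a $3$-class association scheme. Penttila–Williford schemes. On $V(4,q^2)$ let $h(\mathbf X,\mathbf Y)=X_1Y_4^q+X_2Y_2^q+X_3Y_3^q+X_4Y_1^q$, with unitary polar space $H(3,q^2)$ (its lines are the totally isotropic $2$-dimensional subspaces). Let $\widehat V=\{(\alpha,x^q,x,\beta):\alpha,\beta\in\mathbb F_q,x\in\mathbb F_{q^2}\}$, a $4$-dimensional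 $\mathbb F_q$-space; $h$ restricts on it to the non-degenerate alternating form $\widehat b(v,v')=\alpha\beta'+\beta\alpha'+xx'^q+x^qx'$, defining a symplectic polar space $W(3,q)$, and $\widehat b$ is the polar form of the quadratic form $\widehat Q(v)=\alpha\beta+x^{q+1}$ (of Witt index $1$). Let $\widehat{\mathcal W}$ be the set of $\mathbb F_{q^2}$-spans of totally isotropic subspaces of $(\widehat V,\widehat b)$; its points are the points $\langle v\rangle$, $v\in\widehat V\setminus\{0\}$. Let $\mathrm{PO}^-(\widehat V)$ be the stabilizer in $\mathrm{PGU}(4,q^2)$ (the group preserving $h$) of the set of $\mathbb F_{q^2}$-extensions of the singular subspaces of $\widehat Q$, and $\mathrm{P}\Omega^-(\widehat V)$ its commutator subgroup. This group has exactly two orbits on the lines of $H(3,q^2)$ containing no point of $\widehat{\mathcal W}$; let $\mathcal H$ be either orbit. For a line $l$ of $H(3,q^2)$ disjoint from $\widehat{\mathcal W}$ let $\mathcal S_l$ be the set of lines of $\widehat{\mathcal W}$ meeting $l$. Relations on $\mathcal H$: $\widetilde R_0$ the identity; $(l,m)\in\widetilde R_1$ iff $|l\cap m|=1$ (as point sets); $(l,m)\in\widetilde R_2$ iff $l\cap m=\emptyset$ and $|\mathcal S_l\cap\mathcal S_m|=1$; $(l,m)\in\widetilde R_3$ iff $l\cap m=\emptyset$ and $|\mathcal S_l\cap\mathcal S_m|=q+1$. This is a $3$-class association scheme. -}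

module Defs where

open import Level using (0ℓ)
open import Data.Nat as ℕ using (ℕ; zero; suc)
open import Data.Fin using (Fin; zero; suc)
open import Data.Vec using (Vec; []; _∷_; lookup; map; zipWith; foldr)
open import Data.List using (List)
import Data.List as List
open import Data.Product using (Σ; ∃; ∃-syntax; _×_; _,_; proj₁; proj₂)
open import Data.Sum using (_⊎_)
open import Data.Empty using (⊥)
open import Relation.Nullary using (¬_)
open import Relation.Binary.PropositionalEquality using (_≡_)
open import Function.Bundles using (_↔_)
open import Algebra.Structures using (IsCommutativeRing)

-- A finite field of order 2^(4h) = q^4 with q = 2^h, i.e. a model of
-- F_{q^4}.  Equality is propositional; x ⁻¹ is a total operation that is
-- a genuine inverse for x ≠ 0 (its value at 0 is irrelevant/unspecified).

record FiniteFieldQ4 (h : ℕ) : Set₁ where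
  infixl 6 _+_
  infixl 7 _*_
  field
    Carrier : Set
    _+_ _*_ : Carrier → Carrier → Carrier
    -_ : Carrier → Carrier
    0# 1# : Carrier
    _⁻¹ : Carrier → Carrier
    isCommutativeRing : IsCommutativeRing _≡_ _+_ _*_ -_ 0# 1#
    1≢0 : ¬ (1# ≡ 0#)
    ⁻¹-inverse : ∀ x → ¬ (x ≡ 0#) → x * (x ⁻¹) ≡ 1#
    enumeration : Fin (2 ℕ.^ (4 ℕ.* h)) ↔ Carrier

module Geometry {h : ℕ} (F : FiniteFieldQ4 h) where
  open FiniteFieldQ4 F public

  q : ℕ
  q = 2 ℕ.^ h

  pow : Carrier → ℕ → Carrier
  pow x zero = 1#
  pow x (suc n) = x * pow x n

  sumF : ℕ → (ℕ → Carrier) → Carrier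
  sumF zero f = 0#
  sumF (suc n) f = sumF n f + f n

  inK : Carrier → Set
  inK x = pow x (q ℕ.* q) ≡ x

  inFq : Carrier → Set
  inFq x = pow x q ≡ x

  conj : Carrier → Carrier
  conj x = pow x q

  Tr₂ : Carrier → Carrier
  Tr₂ x = sumF (2 ℕ.* h) (λ i → pow x (2 ℕ.^ i))

  Tr₁ : Carrier → Carrier
  Tr₁ x = sumF h (λ i → pow x (2 ℕ.^ i))

  T₀ : Carrier → Set
  T₀ x = inK x × Tr₂ x ≡ 0#

  S₀ : Carrier → Set
  S₀ x = inFq x × Tr₁ x ≡ 0#

  S₀* : Carrier → Set
  S₀* x = S₀ x × ¬ (x ≡ 0#)

  S₁ : Carrier → Set
  S₁ x = inFq x × ¬ (Tr₁ x ≡ 0#)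

  -- Hollmann–Xiang side.  An elliptic line ℓ̄_{t} is given by a
  -- representative t ∈ F_{q^4} ∖ F_{q^2}; t and t^{q^2} give the same line.

  Ell : Set
  Ell = Σ Carrier (λ t → ¬ inK t)

  sameE : Ell → Ell → Set
  sameE (s , _) (t , _) = (s ≡ t) ⊎ (s ≡ pow t (q ℕ.* q))

  bar : Carrier → Carrier
  bar x = pow x (q ℕ.* q)

  ρ : Carrier → Carrier → Carrier
  ρ s t = ((s + t) * (bar s + bar t)) * (((s + bar t) * (bar s + t)) ⁻¹)

  ρ̂ : Ell → Ell → Carrier
  ρ̂ (s , _) (t , _) = (ρ s t + (ρ s t) ⁻¹) ⁻¹

  RE : Fin 4 → Ell → Ell → Set
  RE zero s t = sameE s t
  RE (suc zero) s t = ¬ sameE s t × S₀* (ρ̂ s t)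
  RE (suc (suc zero)) s t = ¬ sameE s t × S₁ (ρ̂ s t)
  RE (suc (suc (suc zero))) s t = ¬ sameE s t × (T₀ (ρ̂ s t) × ¬ inFq (ρ̂ s t))

  -- Penttila–Williford side.  Vectors of V(4,q^2) are vectors in F^4
  -- with all coordinates in F_{q^2}.

  V : Set
  V = Vec Carrier 4

  Kvec : V → Set
  Kvec v = ∀ i → inK (lookup v i)

  zeroV : V
  zeroV = 0# ∷ 0# ∷ 0# ∷ 0# ∷ []

  _+V_ : V → V → V
  u +V v = zipWith _+_ u v

  _·_ : Carrier → V → V
  c · v = map (c *_) v

  lincomb : ∀ {n} → Vec Carrier n → Vec V n → V
  lincomb [] [] = zeroV
  lincomb (c ∷ cs) (g ∷ gs) = (c · g) +V lincomb cs gs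

  AllVec : ∀ {A : Set} {n} → (A → Set) → Vec A n → Set
  AllVec P xs = ∀ i → P (lookup xs i)

  herm : V → V → Carrier
  herm (x1 ∷ x2 ∷ x3 ∷ x4 ∷ []) (y1 ∷ y2 ∷ y3 ∷ y4 ∷ []) =
    x1 * conj y4 + x2 * conj y2 + x3 * conj y3 + x4 * conj y1

  -- points: nonzero vectors of V(4,q^2) up to F_{q^2}^* scalars
  samePoint : V → V → Set
  samePoint u v = ∃[ c ] (inK c × ¬ (c ≡ 0#) × u ≡ c · v)

  -- lines of H(3,q^2): pairs of F_{q^2}-independent vectors spanning a
  -- totally isotropic 2-space
  IsHLine : V × V → Set
  IsHLine (u , v) = Kvec u × Kvec v
    × (∀ a b → inK a → inK b → (a · u) +V (b · v) ≡ zeroV → (a ≡ 0#) × (b ≡ 0#))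
    × herm u u ≡ 0# × herm u v ≡ 0# × herm v v ≡ 0#

  HLine : Set
  HLine = Σ (V × V) IsHLine

  OnSpan : V × V → V → Set
  OnSpan (u , v) w = ∃[ a ] ∃[ b ] (inK a × inK b × w ≡ (a · u) +V (b · v))

  _≅_ : HLine → HLine → Set
  l ≅ m = ∀ w → (OnSpan (proj₁ l) w → OnSpan (proj₁ m) w)
                × (OnSpan (proj₁ m) w → OnSpan (proj₁ l) w)

  Vhat : V → Set
  Vhat v = ∃[ α ] ∃[ x ] ∃[ β ] (inFq α × inK x × inFq β
             × v ≡ α ∷ conj x ∷ x ∷ β ∷ [])

  Qhat : V → Carrier
  Qhat (a ∷ y ∷ x ∷ b ∷ []) = a * b + x * conj x

  -- lines of Ŵ: F_{q^2}-spans of totally isotropic F_q-2-spaces of V̂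
  IsWLine : V × V → Set
  IsWLine (a , b) = Vhat a × Vhat b
    × (∀ c d → inFq c → inFq d → (c · a) +V (d · b) ≡ zeroV → (c ≡ 0#) × (d ≡ 0#))
    × herm a b ≡ 0#

  WLine : Set
  WLine = Σ (V × V) IsWLine

  _≅W_ : WLine → WLine → Set
  l ≅W m = ∀ w → (OnSpan (proj₁ l) w → OnSpan (proj₁ m) w)
                 × (OnSpan (proj₁ m) w → OnSpan (proj₁ l) w)

  DisjW : HLine → Set
  DisjW l = ∀ w → Vhat w → ¬ (w ≡ zeroV) → ¬ OnSpan (proj₁ l) w

  HasCard : {A : Set} → (A → A → Set) → (A → Set) → ℕ → Set
  HasCard {A} _≈_ P n = Σ (Fin n → A) λ xs → ((∀ (i : Fin n) → P (xs i))
    × (∀ i j → xs i ≈ xs j → i ≡ j)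
    × (∀ a → P a → ∃[ i ] (a ≈ xs i)))

  Meet : V × V → V × V → Set
  Meet l m = ∃[ w ] (¬ (w ≡ zeroV) × OnSpan l w × OnSpan m w)

  MeetInOnePoint : HLine → HLine → Set
  MeetInOnePoint l m = ∃[ w ] (¬ (w ≡ zeroV) × OnSpan (proj₁ l) w × OnSpan (proj₁ m) w
    × (∀ w' → ¬ (w' ≡ zeroV) → OnSpan (proj₁ l) w' → OnSpan (proj₁ m) w' → samePoint w' w))

  Disjoint : HLine → HLine → Set
  Disjoint l m = ¬ Meet (proj₁ l) (proj₁ m)

  InSS : HLine → HLine → WLine → Set
  InSS l m n = Meet (proj₁ l) (proj₁ n) × Meet (proj₁ m) (proj₁ n)

  RH : Fin 4 → HLine → HLine → Set
  RH zero l m = l ≅ m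
  RH (suc zero) l m = MeetInOnePoint l m
  RH (suc (suc zero)) l m = Disjoint l m × HasCard _≅W_ (InSS l m) 1
  RH (suc (suc (suc zero))) l m = Disjoint l m × HasCard _≅W_ (InSS l m) (q ℕ.+ 1)

  -- The group PΩ^-(V̂).  Matrices are lists of rows; elements of
  -- PGU(4,q^2) are represented by unitary matrices (scalars act trivially
  -- on subspaces, so orbits on lines are the same).

  Mat : Set
  Mat = Vec V 4

  dot : V → V → Carrier
  dot u v = foldr (λ _ → Carrier) _+_ 0# (zipWith _*_ u v)

  act : Mat → V → V
  act A x = map (λ r → dot r x) A

  -- F_q-subspaces of V̂, given by spanning families
  SubV : Set
  SubV = Σ ℕ (λ n → Vec V n)

  Singular : SubV → Set
  Singular (n , gs) = AllVec Vhat gs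
    × (∀ cs → AllVec inFq cs → Qhat (lincomb cs gs) ≡ 0#)

  Ext : SubV → V → Set
  Ext (n , gs) w = ∃[ cs ] (AllVec inK cs × w ≡ lincomb cs gs)

  MapsOnto : Mat → (V → Set) → (V → Set) → Set
  MapsOnto A P P' = ∀ w → (P' w → ∃[ u ] (P u × w ≡ act A u))
                          × (∃[ u ] (P u × w ≡ act A u) → P' w)

  record StabElt : Set where
    field
      mat inv : Mat
      entriesK : ∀ i → Kvec (lookup mat i)
      invEntriesK : ∀ i → Kvec (lookup inv i)
      leftInv : ∀ x → act inv (act mat x) ≡ x
      rightInv : ∀ x → act mat (act inv x) ≡ x
      unitary : ∀ x y → Kvec x → Kvec y → herm (act mat x) (act mat y) ≡ herm x y
      stabFwd : ∀ S → Singular S → ∃[ S' ] (Singular S' × MapsOnto mat (Ext S) (Ext S'))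
      stabBwd : ∀ S' → Singular S' → ∃[ S ] (Singular S × MapsOnto mat (Ext S) (Ext S'))

  actComm : StabElt × StabElt → V → V
  actComm (a , b) x = act (StabElt.inv a) (act (StabElt.inv b)
                        (act (StabElt.mat a) (act (StabElt.mat b) x)))

  -- elements of the commutator subgroup: finite products of commutators
  actΩ : List (StabElt × StabElt) → V → V
  actΩ gs x = List.foldr actComm x gs

  InOrbit : HLine → HLine → Set
  InOrbit l m = ∃[ gs ] (∀ w → (OnSpan (actΩ gs (proj₁ (proj₁ l)) , actΩ gs (proj₂ (proj₁ l))) w
                                  → OnSpan (proj₁ m) w)
                              × (OnSpan (proj₁ m) w
                                  → OnSpan (actΩ gs (proj₁ (proj₁ l)) , actΩ gs (proj₂ (proj₁ l))) w))

{-# OPTIONS --safe #-}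
module Submission where

-- Let K = F_{q²}, read vectors of V(4,q²) as 2 × 2 matrices over K, so that V̂ consists of the Hermitian ones and Q̂ is
-- the determinant, and put e_t = (1, t).  For t ∈ F_{q⁴} ∖ K the plane spanned over F_{q⁴} by e_t ⊗ e_{t^q} and its
-- conjugate under x ↦ x̄ = x^{q²} is defined over K, and gives a totally isotropic line disjoint from Ŵ.  Conversely a line
-- of H(3,q²) disjoint from Ŵ contains exactly two singular points of the determinant over F_{q⁴}, and they have this form
-- or the one with t^{q³} in place of t^q.  Unimodular matrices act by Möbius transformations on t, and all t are
-- reached by commutators of these.  Conversely, the stabilizer consists of the maps c g X g* and c g Xᵀ g*, of which only
-- the latter exchange the two families; so commutators preserve each family, and the families are the two orbits.
--
-- Put z = (s + t)(s̄ + t̄) / ((s + s̄)(t + t̄)), so that ρ̂ = z² + z.  The lines of s and t meet iff z^q = z.  The lines of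
-- Ŵ meeting the line of t correspond to its points, and those that also meet the line of s are the zeros of a Hermitian
-- form in two variables over K whose discriminant is a nonzero multiple of ρ̂^q + ρ̂ = (z^q + z)(z^q + z + 1).  If the
-- lines are disjoint, there are therefore 1 or q + 1 of them, according to whether z^q = z + 1.

open import Defs
open import Level using (0ℓ)
open import Algebra using (CommutativeMonoid; CommutativeRing; RawRing)
open import Algebra.Solver.Ring.AlmostCommutativeRing using (fromCommutativeRing; _-Raw-AlmostCommutative⟶_)
import Algebra.Solver.Ring as RingSolver
import Algebra.Properties.Semiring.Mult as SemiringMult
open import Data.Bool using (Bool; true; false; _xor_; _∧_)
import Data.Bool.Properties as Boolₚ
open import Data.Maybe using (Maybe; just; nothing)
open import Data.Nat as ℕ using (ℕ; zero; suc; _≤_)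
import Data.Nat.Properties as ℕₚ
open import Data.Fin as Fin using (Fin; zero; suc)
import Data.Fin.Properties as Finₚ
open import Data.Vec as Vec using (Vec; []; _∷_; lookup)
import Data.Vec.Properties as Vecₚ
open import Data.List using ([]; _∷_)
open import Data.Product using (Σ; ∃-syntax; _×_; _,_; proj₁; proj₂; swap)
open import Data.Sum using (_⊎_; inj₁; inj₂)
open import Function using (_∘_; case_of_)
open import Function.Bundles using (_↔_; Inverse; mk↔ₛ′)
open import Function.Definitions using (Injective)
open import Function.Construct.Composition using (_↔-∘_)
open import Function.Construct.Symmetry using (↔-sym)
open import Relation.Nullary using (¬_; Dec; yes; no; contradiction)
open import Relation.Nullary.Decidable using (map′; ¬?; decidable-stable)
open import Relation.Binary.Definitions using (tri<; tri≈; tri>)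
open import Relation.Binary.PropositionalEquality using (_≡_; _≢_; refl; sym; trans; cong; cong₂; subst; module ≡-Reasoning)

-- Two identities make every incidence computable. The polar form B of the determinant satisfies
-- B(e_a ⊗ e_b, e_c ⊗ e_d) = (a + c)(b + d), and h(X, Y) = B(X, Y*) with Y* the conjugate transpose.
-- Isotropy and incidence thus turn into products of differences of parameters; the quantities N and
-- D built from s + t and s + t̄ come from there. The equivalences are not proved relation by
-- relation: every pair of lines has an index at which the relations on both sides hold, and since
-- the relations on each side exclude each other, both directions follow. The field is only an
-- enumerated commutative ring with inverses, so characteristic 2, x^{q⁴} = x, |F_q| = q, an element
-- outside K and the solvability of y² + y = d for d in K are obtained by counting or by summing
-- over all elements. An element of K outside F_q is supplied by the given line, which would
-- otherwise meet V̂. Both families are treated at once by means of an automorphism f whose square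
-- is x ↦ x̄ and which is x ↦ x^q on K.

-- Finite sets

injective⇒surjective : ∀ {n} {f : Fin n → Fin n} → Injective _≡_ _≡_ f → ∀ j → ∃[ i ] (f i ≡ j)
injective⇒surjective {suc n} {f} inj j with Finₚ.any? (λ i → f i Fin.≟ j)
... | yes p = p
-- If j were missed, punching it out would inject `Fin (suc n)` into `Fin n`.
... | no ¬p = contradiction (Finₚ.injective⇒≤ (λ {x} {y} e → inj (Finₚ.punchOut-injective (j≢f x) (j≢f y) e))) ℕₚ.1+n≰n
  where
  j≢f : ∀ i → j ≢ f i
  j≢f i e = ¬p (i , sym e)

record DecSubset {n : ℕ} (P : Fin n → Set) : Set where
  field
    size     : ℕ
    elt      : Fin size → Fin n
    elt∈     : ∀ i → P (elt i)
    elt-inj  : ∀ i j → elt i ≡ elt j → i ≡ j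
    elt-surj : ∀ j → P j → ∃[ i ] (j ≡ elt i)

decSubset : ∀ {n} (P : Fin n → Set) → (∀ i → Dec (P i)) → DecSubset P
decSubset {zero} P P? = record { size = 0 ; elt = λ () ; elt∈ = λ () ; elt-inj = λ () ; elt-surj = λ () }
decSubset {suc n} P P? with decSubset (P ∘ suc) (P? ∘ suc) | P? zero
... | S | no ¬p = record
  { size = size ; elt = suc ∘ elt ; elt∈ = elt∈
  ; elt-inj = λ i j e → elt-inj i j (Finₚ.suc-injective e)
  ; elt-surj = λ { zero p → contradiction p ¬p ; (suc j) p → let i , e = elt-surj j p in i , cong suc e } }
  where open DecSubset S
... | S | yes p = record
  { size = suc size
  ; elt = λ { zero → zero ; (suc i) → suc (elt i) }
  ; elt∈ = λ { zero → p ; (suc i) → elt∈ i }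
  ; elt-inj = λ { zero zero _ → refl ; (suc i) (suc j) e → cong suc (elt-inj i j (Finₚ.suc-injective e)) }
  ; elt-surj = λ { zero _ → zero , refl ; (suc j) q → let i , e = elt-surj j q in suc i , cong suc e } }
  where open DecSubset S

-- Sums and products over an enumerated type

module Total (M : CommutativeMonoid 0ℓ 0ℓ) {A : Set} {n : ℕ} (enum : Fin n ↔ A) where
  open CommutativeMonoid M using (Carrier; _≈_; _∙_; ε; ∙-cong; identityʳ; setoid; reflexive)
    renaming (trans to ≈-trans; sym to ≈-sym)
  open import Algebra.Properties.CommutativeMonoid.Sum M public
  open Inverse enum renaming (to to el; from to idx)

  -- The monoid is left arbitrary because it is instantiated twice: additively to find the
  -- characteristic, and multiplicatively to prove that x^|F| = x.
  total : (A → Carrier) → Carrier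
  total φ = sum (φ ∘ el)

  total-reindex : (σ : A ↔ A) (φ : A → Carrier) → total φ ≈ total (φ ∘ Inverse.to σ)
  total-reindex σ φ = ≈-trans (sum-permute (φ ∘ el) (↔-sym enum ↔-∘ (σ ↔-∘ enum)))
    (reflexive (sum-cong-≗ λ i → cong φ (strictlyInverseˡ (Inverse.to σ (el i)))))

  sum-supported : ∀ {m} (t : Fin m → Carrier) i → (∀ j → j ≢ i → t j ≈ ε) → sum t ≈ t i
  sum-supported {suc m} t i t≈ε = ≈-trans (sum-remove {i = i} t)
    (≈-trans (∙-cong (reflexive refl)
      (≈-trans (sum-cong-≋ (λ j → t≈ε (Fin.punchIn i j) (Finₚ.punchInᵢ≢i i j))) (sum-replicate-zero m)))
      (identityʳ (t i)))

  total-supported : (φ : A → Carrier) (a : A) → (∀ b → b ≢ a → φ b ≈ ε) → total φ ≈ φ a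
  total-supported φ a φ≈ε = ≈-trans
    (sum-supported (φ ∘ el) (idx a)
      (λ j j≢ → φ≈ε (el j) (λ e → j≢ (trans (sym (strictlyInverseʳ j)) (cong idx e)))))
    (reflexive (cong φ (strictlyInverseˡ a)))

-- Finite fields: characteristic, Frobenius maps, quadratic equations, orders of subfields

module FieldTheory {h : ℕ} (F : FiniteFieldQ4 h) where
  open Geometry F

  commutativeRing : CommutativeRing 0ℓ 0ℓ
  commutativeRing = record { isCommutativeRing = isCommutativeRing }

  open CommutativeRing commutativeRing public
    using (+-identityˡ; +-identityʳ; +-assoc; +-comm; -‿inverseˡ; -‿inverseʳ; *-identityˡ; *-identityʳ; *-assoc; *-comm; zeroˡ; zeroʳ; distribˡ; distribʳ)
  open CommutativeRing commutativeRing using (semiring; +-commutativeMonoid; *-commutativeMonoid)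

  card : ℕ
  card = 2 ℕ.^ (4 ℕ.* h)

  open Inverse enumeration renaming (to to el; from to idx; strictlyInverseˡ to el-idx; strictlyInverseʳ to idx-el)

  idx-injective : ∀ {x y} → idx x ≡ idx y → x ≡ y
  idx-injective {x} {y} e = trans (sym (el-idx x)) (trans (cong el e) (el-idx y))

  infix 4 _≟_
  _≟_ : (x y : Carrier) → Dec (x ≡ y)
  x ≟ y = map′ idx-injective (cong idx) (idx x Fin.≟ idx y)

  *-cancelˡ : ∀ {c x y} → c ≢ 0# → c * x ≡ c * y → x ≡ y
  *-cancelˡ {c} {x} {y} c≢0 e = trans (sym (undo x)) (trans (cong (c ⁻¹ *_) e) (undo y))
    where
    undo : ∀ x → c ⁻¹ * (c * x) ≡ x
    undo x = trans (sym (*-assoc _ _ _)) (trans (cong (_* x) (trans (*-comm _ _) (⁻¹-inverse c c≢0))) (*-identityˡ x))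

  integral : ∀ {x y} → x ≢ 0# → x * y ≡ 0# → y ≡ 0#
  integral x≢0 e = *-cancelˡ x≢0 (trans e (sym (zeroʳ _)))

  *-≢0 : ∀ {x y} → x ≢ 0# → y ≢ 0# → x * y ≢ 0#
  *-≢0 x≢0 y≢0 e = y≢0 (integral x≢0 e)

  *≡0ˡ : ∀ {x y} → x ≡ 0# → x * y ≡ 0#
  *≡0ˡ {y = y} refl = zeroˡ y

  *≡0ʳ : ∀ {x y} → y ≡ 0# → x * y ≡ 0#
  *≡0ʳ {x} refl = zeroʳ x

  zero-product : ∀ {x y} → x * y ≡ 0# → x ≡ 0# ⊎ y ≡ 0#
  zero-product {x} e with x ≟ 0#
  ... | yes x≡0 = inj₁ x≡0
  ... | no x≢0 = inj₂ (integral x≢0 e)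

  pow-≢0 : ∀ {x} n → x ≢ 0# → pow x n ≢ 0#
  pow-≢0 zero x≢0 = 1≢0
  pow-≢0 (suc n) x≢0 = *-≢0 x≢0 (pow-≢0 n x≢0)

  -- Summing x + 1 over all x gives the sum of all x, so |F|·1 = 0.

  char2 : 1# + 1# ≡ 0#
  char2 with (1# + 1#) ≟ 0#
  ... | yes e = e
  -- As |F| is a power of 2, |F|·1 is a power of 1 + 1, which is nonzero if 1 + 1 is.
  ... | no 2≢0 = contradiction 2^k≡0 (pow-≢0 (4 ℕ.* h) 2≢0)
    where
    open Total +-commutativeMonoid enumeration
    open SemiringMult semiring using (×1-homo-*) renaming (_×_ to _·ℕ_)
    shift : Carrier ↔ Carrier
    shift = mk↔ₛ′ (_+ 1#) (_+ - 1#)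
      (λ x → trans (+-assoc _ _ _) (trans (cong (x +_) (-‿inverseˡ 1#)) (+-identityʳ x)))
      (λ x → trans (+-assoc _ _ _) (trans (cong (x +_) (-‿inverseʳ 1#)) (+-identityʳ x)))
    S : Carrier
    S = total (λ x → x)
    S≡S+n1 : S ≡ S + card ·ℕ 1#
    S≡S+n1 = trans (total-reindex shift (λ x → x))
      (trans (∑-distrib-+ el (λ _ → 1#)) (cong (S +_) (sum-replicate card)))
    n1≡0 : card ·ℕ 1# ≡ 0#
    n1≡0 = begin
      card ·ℕ 1#                ≡⟨ +-identityˡ _ ⟨
      0# + card ·ℕ 1#           ≡⟨ cong (_+ card ·ℕ 1#) (-‿inverseˡ S) ⟨
      (- S + S) + card ·ℕ 1#    ≡⟨ +-assoc _ _ _ ⟩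
      - S + (S + card ·ℕ 1#)    ≡⟨ cong (- S +_) S≡S+n1 ⟨
      - S + S                   ≡⟨ -‿inverseˡ S ⟩
      0#                        ∎
      where open ≡-Reasoning
    2^-·ℕ : ∀ k → (2 ℕ.^ k) ·ℕ 1# ≡ pow (1# + 1#) k
    2^-·ℕ zero = +-identityʳ 1#
    2^-·ℕ (suc k) = trans (×1-homo-* 2 (2 ℕ.^ k)) (cong₂ _*_ (cong (1# +_) (+-identityʳ 1#)) (2^-·ℕ k))
    2^k≡0 : pow (1# + 1#) (4 ℕ.* h) ≡ 0#
    2^k≡0 = trans (sym (2^-·ℕ (4 ℕ.* h))) n1≡0

  -- The coefficients of the ring solver lie in F₂, so that it knows that 2 = 0.

  private
    F₂ : RawRing 0ℓ 0ℓ
    F₂ = record { Carrier = Bool ; _≈_ = _≡_ ; _+_ = _xor_ ; _*_ = _∧_ ; -_ = λ b → b ; 0# = false ; 1# = true }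

    fromF₂ : Bool → Carrier
    fromF₂ false = 0#
    fromF₂ true = 1#

    1≡-1 : 1# ≡ - 1#
    1≡-1 = trans (sym (+-identityʳ _)) (trans (cong (1# +_) (sym (-‿inverseʳ 1#)))
      (trans (sym (+-assoc _ _ _)) (trans (cong (_+ - 1#) char2) (+-identityˡ _))))

    fromF₂-homo : F₂ -Raw-AlmostCommutative⟶ fromCommutativeRing commutativeRing
    fromF₂-homo = record
      { ⟦_⟧ = fromF₂
      ; +-homo = λ { false y → sym (+-identityˡ _) ; true false → sym (+-identityʳ _) ; true true → sym char2 }
      ; *-homo = λ { false y → sym (zeroˡ _) ; true y → sym (*-identityˡ _) }
      ; -‿homo = λ { false → trans (sym (-‿inverseʳ 0#)) (+-identityˡ _) ; true → 1≡-1 }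
      ; 0-homo = refl
      ; 1-homo = refl }

    fromF₂≟ : (x y : Bool) → Maybe (fromF₂ x ≡ fromF₂ y)
    fromF₂≟ false false = just refl
    fromF₂≟ true true = just refl
    fromF₂≟ _ _ = nothing

  open RingSolver F₂ (fromCommutativeRing commutativeRing) fromF₂-homo fromF₂≟ public
    using (solve; Polynomial; con; _:+_; _:*_; _:=_)

  :0 :1 : ∀ {n} → Polynomial n
  :0 = con false
  :1 = con true

  private
    x+x = solve 1 (λ x → x :+ x := :0) refl

  -- The hypotheses l ≡ r enter as summands c * (l + r) of an identity that the ring solver proves.

  +-≡0 : ∀ {x y} → x ≡ y → x + y ≡ 0#
  +-≡0 {x} refl = x+x x

  ≡0-+ : ∀ {x y} → x + y ≡ 0# → x ≡ y
  ≡0-+ {x} {y} e = trans (sym (x+y+y x y)) (trans (cong (_+ y) e) (+-identityˡ y))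
    where
    x+y+y = solve 2 (λ x y → (x :+ y) :+ y := x) refl

  +-≢0 : ∀ {x y} → x ≢ y → x + y ≢ 0#
  +-≢0 x≢y e = x≢y (≡0-+ e)

  lc₁ : ∀ {x y c l r} → x ≡ y + c * (l + r) → l ≡ r → x ≡ y
  lc₁ {y = y} {c} e p = trans e (trans (cong (λ z → y + c * z) (+-≡0 p)) (trans (cong (y +_) (zeroʳ c)) (+-identityʳ y)))

  lc₂ : ∀ {x y c l r c′ l′ r′} → x ≡ y + c * (l + r) + c′ * (l′ + r′) → l ≡ r → l′ ≡ r′ → x ≡ y
  lc₂ e p p′ = lc₁ (lc₁ e p′) p

  lc₃ : ∀ {x y c l r c′ l′ r′ c″ l″ r″} → x ≡ y + c * (l + r) + c′ * (l′ + r′) + c″ * (l″ + r″) →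
    l ≡ r → l′ ≡ r′ → l″ ≡ r″ → x ≡ y
  lc₃ e p p′ p″ = lc₂ (lc₁ e p″) p p′

  lc₄ : ∀ {x y c l r c′ l′ r′ c″ l″ r″ c‴ l‴ r‴} →
    x ≡ y + c * (l + r) + c′ * (l′ + r′) + c″ * (l″ + r″) + c‴ * (l‴ + r‴) →
    l ≡ r → l′ ≡ r′ → l″ ≡ r″ → l‴ ≡ r‴ → x ≡ y
  lc₄ e p p′ p″ p‴ = lc₃ (lc₁ e p‴) p p′ p″

  ⁻¹-≢0 : ∀ {x} → x ≢ 0# → x ⁻¹ ≢ 0#
  ⁻¹-≢0 {x} x≢0 e = 1≢0 (trans (sym (⁻¹-inverse x x≢0)) (trans (cong (x *_) e) (zeroʳ x)))

  ⁻¹-unique : ∀ {x y} → x ≢ 0# → x * y ≡ 1# → y ≡ x ⁻¹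
  ⁻¹-unique {x} x≢0 e = *-cancelˡ x≢0 (trans e (sym (⁻¹-inverse x x≢0)))

  -- Powers and the Frobenius automorphisms

  pow-1# : ∀ n → pow 1# n ≡ 1#
  pow-1# zero = refl
  pow-1# (suc n) = trans (*-identityˡ _) (pow-1# n)

  pow-*-base : ∀ x y n → pow (x * y) n ≡ pow x n * pow y n
  pow-*-base x y zero = sym (*-identityˡ 1#)
  pow-*-base x y (suc n) = trans (cong (x * y *_) (pow-*-base x y n)) (interchange x y (pow x n) (pow y n))
    where
    interchange = solve 4 (λ x y u v → x :* y :* (u :* v) := x :* u :* (y :* v)) refl

  pow-+ : ∀ x m n → pow x (m ℕ.+ n) ≡ pow x m * pow x n
  pow-+ x zero n = sym (*-identityˡ _)
  pow-+ x (suc m) n = trans (cong (x *_) (pow-+ x m n)) (sym (*-assoc _ _ _))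

  pow-* : ∀ x m n → pow x (m ℕ.* n) ≡ pow (pow x n) m
  pow-* x zero n = refl
  pow-* x (suc m) n = trans (pow-+ x n (m ℕ.* n)) (cong (pow x n *_) (pow-* x m n))

  pow-swap : ∀ x m n → pow (pow x m) n ≡ pow (pow x n) m
  pow-swap x m n = trans (sym (pow-* x n m)) (trans (cong (pow x) (ℕₚ.*-comm n m)) (pow-* x m n))

  pow-2^-suc : ∀ x k → pow x (2 ℕ.^ suc k) ≡ pow x (2 ℕ.^ k) * pow x (2 ℕ.^ k)
  pow-2^-suc x k = trans (pow-* x 2 (2 ℕ.^ k)) (cong (pow x (2 ℕ.^ k) *_) (*-identityʳ _))

  pow-2^-+ : ∀ x y k → pow (x + y) (2 ℕ.^ k) ≡ pow x (2 ℕ.^ k) + pow y (2 ℕ.^ k)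
  pow-2^-+ x y zero = trans (*-identityʳ _) (sym (cong₂ _+_ (*-identityʳ x) (*-identityʳ y)))
  pow-2^-+ x y (suc k) = begin
    pow (x + y) (2 ℕ.^ suc k)                                 ≡⟨ pow-2^-suc (x + y) k ⟩
    pow (x + y) (2 ℕ.^ k) * pow (x + y) (2 ℕ.^ k)             ≡⟨ cong₂ _*_ (pow-2^-+ x y k) (pow-2^-+ x y k) ⟩
    (pow x (2 ℕ.^ k) + pow y (2 ℕ.^ k)) * (pow x (2 ℕ.^ k) + pow y (2 ℕ.^ k))
                                                              ≡⟨ square (pow x (2 ℕ.^ k)) (pow y (2 ℕ.^ k)) ⟩
    pow x (2 ℕ.^ k) * pow x (2 ℕ.^ k) + pow y (2 ℕ.^ k) * pow y (2 ℕ.^ k)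
                                                              ≡⟨ cong₂ _+_ (pow-2^-suc x k) (pow-2^-suc y k) ⟨
    pow x (2 ℕ.^ suc k) + pow y (2 ℕ.^ suc k)                 ∎
    where
    open ≡-Reasoning
    square = solve 2 (λ u v → (u :+ v) :* (u :+ v) := u :* u :+ v :* v) refl

  -- Multiplication by x permutes F ∖ {0}, so x^(|F|-1) = 1 for x ≠ 0.

  pow-card : ∀ x → pow x card ≡ x
  pow-card x with x ≟ 0#
  ... | yes refl with card | ℕₚ.m^n>0 2 (4 ℕ.* h)
  ...   | suc n | _ = zeroˡ _
  pow-card x | no x≢0 = *-cancelˡ Πunit≢0 (begin
    Πunit * pow x card          ≡⟨ *-comm _ _ ⟩
    pow x card * Πunit          ≡⟨ cong (_* Πunit) (trans (sum-replicate card) (×≡pow card)) ⟨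
    total (λ _ → x) * Πunit     ≡⟨ ∑-distrib-+ (λ _ → x) (unit ∘ el) ⟨
    total (λ y → x * unit y)    ≡⟨ sum-cong-≗ (λ i → unit-scale (el i)) ⟨
    total (λ y → unit (x * y) * at0 y)
                                ≡⟨ ∑-distrib-+ (λ i → unit (x * el i)) (at0 ∘ el) ⟩
    total (λ y → unit (x * y)) * total at0
                                ≡⟨ cong₂ _*_ (sym (total-reindex scale unit)) total-at0 ⟩
    Πunit * x                   ∎)
    where
    open ≡-Reasoning
    open Total *-commutativeMonoid enumeration
    open import Algebra.Definitions.RawMonoid (CommutativeMonoid.rawMonoid *-commutativeMonoid) using () renaming
        (_×_ to _^ℕ_)
    ×≡pow : ∀ n → n ^ℕ x ≡ pow x n
    ×≡pow zero = refl
    ×≡pow (suc n) = cong (x *_) (×≡pow n)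
    ifZero : ∀ {y} → Dec (y ≡ 0#) → Carrier → Carrier → Carrier
    ifZero (yes _) u v = u
    ifZero (no _) u v = v
    -- The product of the nonzero elements is written as a product over all elements with 0 replaced
    -- by 1. Multiplication by x leaves that entry alone, and `at0` supplies the factor x that is
    -- missing there.
    unit at0 : Carrier → Carrier
    unit y = ifZero (y ≟ 0#) 1# y
    at0 y = ifZero (y ≟ 0#) x 1#
    Πunit : Carrier
    Πunit = total unit
    unit≢0 : ∀ y → unit y ≢ 0#
    unit≢0 y with y ≟ 0#
    ... | yes _ = 1≢0
    ... | no y≢0 = y≢0
    sum≢0 : ∀ {n} (t : Fin n → Carrier) → (∀ i → t i ≢ 0#) → sum t ≢ 0#
    sum≢0 {zero} t t≢0 = 1≢0
    sum≢0 {suc n} t t≢0 = *-≢0 (t≢0 zero) (sum≢0 (t ∘ suc) (t≢0 ∘ suc))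
    Πunit≢0 : Πunit ≢ 0#
    Πunit≢0 = sum≢0 (unit ∘ el) (unit≢0 ∘ el)
    unit-scale : ∀ y → unit (x * y) * at0 y ≡ x * unit y
    unit-scale y with y ≟ 0# | (x * y) ≟ 0#
    ... | yes refl | yes _ = *-comm _ _
    ... | yes refl | no xy≢0 = contradiction (zeroʳ x) xy≢0
    ... | no y≢0 | yes xy≡0 = contradiction (integral x≢0 xy≡0) y≢0
    ... | no _ | no _ = *-identityʳ _
    scale : Carrier ↔ Carrier
    scale = mk↔ₛ′ (x *_) (x ⁻¹ *_)
      (λ y → trans (sym (*-assoc _ _ _)) (trans (cong (_* y) (⁻¹-inverse x x≢0)) (*-identityˡ y)))
      (λ y → trans (sym (*-assoc _ _ _)) (trans (cong (_* y) (trans (*-comm _ _) (⁻¹-inverse x x≢0))) (*-identityˡ y)))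
    total-at0 : total at0 ≡ x
    total-at0 = trans (total-supported at0 0# off0) on0
      where
      off0 : ∀ b → b ≢ 0# → at0 b ≡ 1#
      off0 b b≢0 with b ≟ 0#
      ... | yes b≡0 = contradiction b≡0 b≢0
      ... | no _ = refl
      on0 : at0 0# ≡ x
      on0 with 0# ≟ 0#
      ... | yes _ = refl
      ... | no 0≢0 = contradiction refl 0≢0

  record Endo (f : Carrier → Carrier) : Set where
    field
      +-homo : ∀ x y → f (x + y) ≡ f x + f y
      *-homo : ∀ x y → f (x * y) ≡ f x * f y
      1-homo : f 1# ≡ 1#

    0-homo : f 0# ≡ 0#
    0-homo = trans (cong f (sym (x+x 0#))) (trans (+-homo 0# 0#) (x+x (f 0#)))

    ≢0-homo : ∀ {x} → x ≢ 0# → f x ≢ 0#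
    ≢0-homo {x} x≢0 e = 1≢0 (trans (sym 1-homo) (trans (cong f (sym (⁻¹-inverse x x≢0)))
      (trans (*-homo _ _) (trans (cong (_* f (x ⁻¹)) e) (zeroˡ _)))))

    norm≡0 : ∀ {x} → x * f x ≡ 0# → x ≡ 0#
    norm≡0 {x} e with x ≟ 0#
    ... | yes p = p
    ... | no p = contradiction e (*-≢0 p (≢0-homo p))

    ⁻¹-homo : ∀ {x} → x ≢ 0# → f (x ⁻¹) ≡ f x ⁻¹
    ⁻¹-homo {x} x≢0 = ⁻¹-unique (≢0-homo x≢0) (trans (sym (*-homo _ _)) (trans (cong f (⁻¹-inverse x x≢0)) 1-homo))

  ∘-endo : ∀ {f g} → Endo f → Endo g → Endo (f ∘ g)
  ∘-endo {f} {g} φ γ = record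
    { +-homo = λ x y → trans (cong f (G.+-homo x y)) (Φ.+-homo _ _)
    ; *-homo = λ x y → trans (cong f (G.*-homo x y)) (Φ.*-homo _ _)
    ; 1-homo = trans (cong f G.1-homo) Φ.1-homo }
    where
    module Φ = Endo φ
    module G = Endo γ

  conj-endo : Endo conj
  conj-endo = record { +-homo = λ x y → pow-2^-+ x y h ; *-homo = λ x y → pow-*-base x y q ; 1-homo = pow-1# q }

  bar≡conj² : ∀ x → bar x ≡ conj (conj x)
  bar≡conj² x = pow-* x q q

  bar-endo : Endo bar
  bar-endo = record
    { +-homo = λ x y → trans (bar≡conj² _) (trans (C.+-homo x y) (sym (cong₂ _+_ (bar≡conj² x) (bar≡conj² y))))
    ; *-homo = λ x y → pow-*-base x y (q ℕ.* q)
    ; 1-homo = pow-1# (q ℕ.* q) }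
    where module C = Endo (∘-endo conj-endo conj-endo)

  card≡q⁴ : card ≡ (q ℕ.* q) ℕ.* (q ℕ.* q)
  card≡q⁴ = begin
    2 ℕ.^ (4 ℕ.* h)             ≡⟨ cong (2 ℕ.^_) (ℕₚ.*-comm 4 h) ⟩
    2 ℕ.^ (h ℕ.* 4)             ≡⟨ ℕₚ.^-*-assoc 2 h 4 ⟨
    q ℕ.* (q ℕ.* (q ℕ.* (q ℕ.* 1)))   ≡⟨ cong (λ n → q ℕ.* (q ℕ.* (q ℕ.* n))) (ℕₚ.*-identityʳ q) ⟩
    q ℕ.* (q ℕ.* (q ℕ.* q))     ≡⟨ ℕₚ.*-assoc q q (q ℕ.* q) ⟨
    (q ℕ.* q) ℕ.* (q ℕ.* q)     ∎
    where open ≡-Reasoning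

  bar-bar : ∀ x → bar (bar x) ≡ x
  bar-bar x = trans (sym (pow-* x (q ℕ.* q) (q ℕ.* q))) (trans (cong (pow x) (sym card≡q⁴)) (pow-card x))

  inFq⇒inK : ∀ {x} → inFq x → inK x
  inFq⇒inK {x} e = trans (bar≡conj² x) (trans (cong conj e) e)

  bar-conj : ∀ x → bar (conj x) ≡ conj (bar x)
  bar-conj x = pow-swap x q (q ℕ.* q)

  inK-conj : ∀ {x} → inK x → inK (conj x)
  inK-conj {x} e = trans (bar-conj x) (cong conj e)

  inK⇒conj² : ∀ {x} → inK x → conj (conj x) ≡ x
  inK⇒conj² {x} e = trans (sym (bar≡conj² x)) e

  module Fixed {f : Carrier → Carrier} (φ : Endo f) where
    open Endo φ

    fix-+ : ∀ {x y} → f x ≡ x → f y ≡ y → f (x + y) ≡ x + y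
    fix-+ p r = trans (+-homo _ _) (cong₂ _+_ p r)

    fix-* : ∀ {x y} → f x ≡ x → f y ≡ y → f (x * y) ≡ x * y
    fix-* p r = trans (*-homo _ _) (cong₂ _*_ p r)

    fix-⁻¹ : ∀ {x} → x ≢ 0# → f x ≡ x → f (x ⁻¹) ≡ x ⁻¹
    fix-⁻¹ x≢0 p = trans (⁻¹-homo x≢0) (cong _⁻¹ p)

  open Fixed bar-endo public using () renaming (fix-+ to inK-+; fix-* to inK-*; fix-⁻¹ to inK-⁻¹)
  open Fixed conj-endo public using () renaming (fix-+ to inFq-+; fix-* to inFq-*; fix-⁻¹ to inFq-⁻¹)

  inK-0 : inK 0#
  inK-0 = Endo.0-homo bar-endo

  inK-1 : inK 1#
  inK-1 = Endo.1-homo bar-endo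

  -- Squaring is bijective, with inverse x ↦ x^(|F|/2).

  √ : Carrier → Carrier
  √ x = pow x (2 ℕ.^ ℕ.pred (4 ℕ.* h))

  √-square : 1 ℕ.≤ h → ∀ x → √ x * √ x ≡ x
  √-square (ℕ.s≤s _) x = trans (sym (pow-2^-suc x (ℕ.pred (4 ℕ.* h)))) (pow-card x)

  conj-√ : ∀ x → conj (√ x) ≡ √ (conj x)
  conj-√ x = pow-swap x (2 ℕ.^ ℕ.pred (4 ℕ.* h)) q

  private
    y+1+1 = solve 1 (λ y → y :+ :1 :+ :1 := y) refl
    y+y+1 = solve 1 (λ y → y :+ (y :+ :1) := :1) refl

  opaque
    -- b picks one of y and y + 1.
    selector : Σ (Carrier → Bool) λ b → ∀ y → b y ≢ b (y + 1#)
    selector = b , b-suc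
      where
      b′ : ∀ {y} → Dec (idx y Fin.< idx (y + 1#)) → Bool
      b′ (yes _) = false
      b′ (no _) = true
      b : Carrier → Bool
      b y = b′ (idx y Fin.<? idx (y + 1#))
      b-suc : ∀ y → b y ≢ b (y + 1#)
      b-suc y e with idx y Fin.<? idx (y + 1#) | idx (y + 1#) Fin.<? idx (y + 1# + 1#)
      ... | yes p | yes r = Finₚ.<-asym p (subst (λ z → idx (y + 1#) Fin.< idx z) (y+1+1 y) r)
      ... | no p | no r with Finₚ.<-cmp (idx y) (idx (y + 1#))
      ...   | tri< a _ _ = p a
      ...   | tri≈ _ e′ _ = 1≢0 (trans (sym (y+y+1 y)) (+-≡0 (idx-injective e′)))
      ...   | tri> _ _ c = r (subst (λ z → idx (y + 1#) Fin.< idx z) (sym (y+1+1 y)) c)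

  -- On K ∪ (K + η), where η + η̄ = 1, the map y ↦ y² + y becomes injective, hence surjective, once the value of the
  -- selector at y is recorded along with it.

  artin-schreier : ∀ {t} → ¬ inK t → ∀ d → inK d → ∃[ y ] (y * y + y ≡ d)
  artin-schreier {t} t∉K d d∈K = conclude y₀ (inZ? y₀) ψy₀≡d
    where
    open Endo bar-endo
    τ : Carrier → Carrier
    τ y = y + bar y
    τ-+ : ∀ x y → τ (x + y) ≡ τ x + τ y
    τ-+ x y = trans (cong (x + y +_) (+-homo x y)) (interchange x y (bar x) (bar y))
      where
      interchange = solve 4 (λ x y u v → x :+ y :+ (u :+ v) := x :+ u :+ (y :+ v)) refl
    τ≢0 : τ t ≢ 0#
    τ≢0 = +-≢0 (t∉K ∘ sym)
    -- Dividing t by its trace, which lies in `K`, gives an element of trace 1.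
    η : Carrier
    η = t * τ t ⁻¹
    τη : τ η ≡ 1#
    τη = trans (cong (λ z → η + z) (trans (*-homo t _) (cong (bar t *_) (inK-⁻¹ τ≢0 τt∈K))))
      (trans (factor t (bar t) (τ t ⁻¹)) (⁻¹-inverse _ τ≢0))
      where
      τt∈K : inK (τ t)
      τt∈K = trans (+-homo _ _) (trans (cong (bar t +_) (bar-bar t)) (+-comm _ _))
      factor = solve 3 (λ t u i → t :* i :+ u :* i := (t :+ u) :* i) refl
    InZ : Carrier → Set
    InZ y = τ y ≡ 0# ⊎ τ y ≡ 1#
    inZ? : ∀ y → Dec (InZ y)
    inZ? y with τ y ≟ 0# | τ y ≟ 1#
    ... | yes p | _ = yes (inj₁ p)
    ... | no _ | yes p = yes (inj₂ p)
    ... | no p | no r = no λ { (inj₁ e) → p e ; (inj₂ e) → r e }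
    choose : Bool → Carrier
    choose false = 0#
    choose true = η
    bit : Carrier → Carrier
    bit y = choose (proj₁ selector y)
    τ-choose : ∀ b → τ (choose b) ≡ 0# × b ≡ false ⊎ τ (choose b) ≡ 1# × b ≡ true
    τ-choose false = inj₁ (trans (cong (0# +_) 0-homo) (x+x 0#) , refl)
    τ-choose true = inj₂ (τη , refl)
    τ-choose-injective : ∀ b c → τ (choose b) ≡ τ (choose c) → b ≡ c
    τ-choose-injective b c e with τ-choose b | τ-choose c
    ... | inj₁ (_ , p) | inj₁ (_ , r) = trans p (sym r)
    ... | inj₂ (_ , p) | inj₂ (_ , r) = trans p (sym r)
    ... | inj₁ (p , _) | inj₂ (r , _) = contradiction (trans (sym r) (trans (sym e) p)) 1≢0
    ... | inj₂ (p , _) | inj₁ (r , _) = contradiction (trans (sym p) (trans e r)) 1≢0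
    ℘ : Carrier → Carrier
    ℘ y = y * y + y
    τ-℘ : ∀ y → InZ y → τ (℘ y) ≡ 0#
    τ-℘ y y∈Z = trans (trans (cong (℘ y +_) (trans (+-homo _ _) (cong (_+ bar y) (*-homo y y)))) (expand y (bar y)))
        (root y∈Z)
      where
      expand = solve 2 (λ y u → (y :* y :+ y) :+ (u :* u :+ u) := (y :+ u) :* (y :+ u) :+ (y :+ u)) refl
      root : InZ y → τ y * τ y + τ y ≡ 0#
      root (inj₁ e) = trans (cong ℘ e) (0²+0 1#)
        where
        0²+0 = solve 1 (λ x → :0 :* :0 :+ :0 := :0) refl
      root (inj₂ e) = trans (cong ℘ e) (1²+1 1#)
        where
        1²+1 = solve 1 (λ x → :1 :* :1 :+ :1 := :0) refl
    -- Off Z the map is the identity, so that it is a self-map of the whole field and the pigeonhole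
    -- principle applies. On Z the value y² + y lies in `K`, and adding 0 or η records the selector
    -- in the trace.
    ψ′ : ∀ y → Dec (InZ y) → Carrier
    ψ′ y (yes _) = ℘ y + bit y
    ψ′ y (no _) = y
    ψ : Carrier → Carrier
    ψ y = ψ′ y (inZ? y)
    τ-ψ : ∀ y → InZ y → τ (℘ y + bit y) ≡ τ (bit y)
    τ-ψ y y∈Z = trans (τ-+ _ _) (trans (cong (_+ τ (bit y)) (τ-℘ y y∈Z)) (+-identityˡ _))
    ψ∈Z : ∀ y → InZ y → InZ (℘ y + bit y)
    ψ∈Z y y∈Z with τ-choose (proj₁ selector y)
    ... | inj₁ (e , _) = inj₁ (trans (τ-ψ y y∈Z) e)
    ... | inj₂ (e , _) = inj₂ (trans (τ-ψ y y∈Z) e)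
    ψ-inj′ : ∀ x y (p : Dec (InZ x)) (r : Dec (InZ y)) → ψ′ x p ≡ ψ′ y r → x ≡ y
    ψ-inj′ x y (no _) (no _) e = e
    ψ-inj′ x y (yes x∈Z) (no y∉Z) e = contradiction (subst InZ e (ψ∈Z x x∈Z)) y∉Z
    ψ-inj′ x y (no x∉Z) (yes y∈Z) e = contradiction (subst InZ (sym e) (ψ∈Z y y∈Z)) x∉Z
    -- Equal images have equal traces, hence equal bits. So y² + y takes the same value at both
    -- points, which differ by 0 or 1; the selector rules out 1.
    ψ-inj′ x y (yes x∈Z) (yes y∈Z) e = cases (zero-product (trans (factor x y) (+-≡0 ℘-≡)))
      where
      bits : proj₁ selector x ≡ proj₁ selector y
      bits = τ-choose-injective (proj₁ selector x) (proj₁ selector y) (trans (sym (τ-ψ x x∈Z)) (trans (cong τ e)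
          (τ-ψ y y∈Z)))
      cancel = solve 3 (λ u v b → u :+ b :+ (v :+ b) := u :+ v) refl
      ℘-≡ : ℘ x ≡ ℘ y
      ℘-≡ = ≡0-+ (trans (sym (cancel (℘ x) (℘ y) (bit y))) (+-≡0 (trans (cong (λ b → ℘ x + choose b) (sym bits)) e)))
      factor = solve 2 (λ x y → (x :+ y) :* (x :+ y :+ :1) := (x :* x :+ x) :+ (y :* y :+ y)) refl
      assoc = solve 2 (λ x y → y :+ (x :+ :1) := x :+ y :+ :1) refl
      cases : x + y ≡ 0# ⊎ x + y + 1# ≡ 0# → x ≡ y
      cases (inj₁ x+y≡0) = ≡0-+ x+y≡0
      cases (inj₂ x+y+1≡0) = contradiction (trans bits (cong (proj₁ selector) y≡x+1)) (proj₂ selector x)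
        where
        y≡x+1 : y ≡ x + 1#
        y≡x+1 = ≡0-+ (trans (assoc x y) x+y+1≡0)
    surj : ∃[ i ] (idx (ψ (el i)) ≡ idx d)
    surj = injective⇒surjective
      (λ {i} {j} e → trans (sym (idx-el i)) (trans (cong idx (ψ-inj′ (el i) (el j) (inZ? (el i)) (inZ? (el j)) (idx-injective e))) (idx-el j)))
      (idx d)
    y₀ : Carrier
    y₀ = el (proj₁ surj)
    ψy₀≡d : ψ y₀ ≡ d
    ψy₀≡d = idx-injective (proj₂ surj)
    τd≡0 : τ d ≡ 0#
    τd≡0 = +-≡0 (sym d∈K)
    -- As d is in `K`, its trace is 0. A preimage off Z would be d itself, which is in Z; a preimage
    -- in Z has bit 0, and there the map is just y² + y.
    conclude : ∀ y (r : Dec (InZ y)) → ψ′ y r ≡ d → ∃[ y ] (y * y + y ≡ d)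
    conclude y (no y∉Z) e = contradiction (inj₁ (trans (cong τ e) τd≡0)) y∉Z
    conclude y (yes y∈Z) e = cases (τ-choose (proj₁ selector y))
      where
      cases : τ (bit y) ≡ 0# × proj₁ selector y ≡ false ⊎ τ (bit y) ≡ 1# × proj₁ selector y ≡ true → ∃[ y ] (y * y + y ≡ d)
      cases (inj₁ (_ , b≡)) = y , trans (sym (+-identityʳ _)) (trans (cong (λ b → ℘ y + choose b) (sym b≡)) e)
      cases (inj₂ (τb≡1 , _)) = contradiction (trans (sym τb≡1) (trans (sym (τ-ψ y y∈Z)) (trans (cong τ e) τd≡0))) 1≢0

  module Involution {σ : Carrier → Carrier} (ς : Endo σ) {η : Carrier} (σση : σ (σ η) ≡ η) (η≢ση : η ≢ σ η) where
    open Endo ς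

    private
      δ : Carrier
      δ = η + σ η
      δ≢0 : δ ≢ 0#
      δ≢0 = +-≢0 η≢ση
      σδ : σ δ ≡ δ
      σδ = trans (+-homo _ _) (trans (cong (σ η +_) σση) (+-comm _ _))

    -- The hypothesis on z is pointwise because `conj` is an involution on `K` only, while `bar` is
    -- one everywhere. The coefficient of η is the quotient of the traces z + σ z and η + σ η.
    coordinates : ∀ {z} → σ (σ z) ≡ z → ∃[ x ] ∃[ y ] (σ x ≡ x × σ y ≡ y × z ≡ x + y * η)
    coordinates {z} σσz = x , y , σx , σy , split z (y * η)
      where
      y x : Carrier
      y = (z + σ z) * δ ⁻¹
      x = z + y * η
      split = solve 2 (λ z v → z := z :+ v :+ v) refl
      σy : σ y ≡ y
      σy = trans (*-homo _ _) (cong₂ _*_ (trans (+-homo _ _) (trans (cong (σ z +_) σσz) (+-comm _ _))) (trans (⁻¹-homo δ≢0)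
          (cong _⁻¹ σδ)))
      certificate = solve 5 (λ z sz e se i → sz :+ (z :+ sz) :* i :* se := z :+ (z :+ sz) :* i :* e :+ (z :+ sz) :* ((e
          :+ se) :* i :+ :1)) refl
      σx : σ x ≡ x
      σx = trans (+-homo _ _) (trans (cong (σ z +_) (trans (*-homo _ _) (cong (_* σ η) σy)))
        (lc₁ (certificate z (σ z) η (σ η) (δ ⁻¹)) (⁻¹-inverse δ δ≢0)))

    coordinates-unique : ∀ {x y x′ y′} → σ x ≡ x → σ y ≡ y → σ x′ ≡ x′ → σ y′ ≡ y′ →
      x + y * η ≡ x′ + y′ * η → x ≡ x′ × y ≡ y′
    coordinates-unique {x} {y} {x′} {y′} σx σy σx′ σy′ e =
      ≡0-+ (*-cancelˡ δ≢0 (trans (lc₂ (certX x y x′ y′ η (σ η)) e e′) (sym (zeroʳ _)))) ,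
      ≡0-+ (*-cancelˡ δ≢0 (trans (lc₂ (certY x y x′ y′ η (σ η)) e e′) (sym (zeroʳ _))))
      where
      image : ∀ {x y} → σ x ≡ x → σ y ≡ y → σ (x + y * η) ≡ x + y * σ η
      image p r = trans (+-homo _ _) (cong₂ _+_ p (trans (*-homo _ _) (cong (_* σ η) r)))
      e′ : x + y * σ η ≡ x′ + y′ * σ η
      e′ = trans (sym (image σx σy)) (trans (cong σ e) (image σx′ σy′))
      certX = solve 6 (λ x y u v e s →
        (e :+ s) :* (x :+ u) := :0 :+ s :* ((x :+ y :* e) :+ (u :+ v :* e)) :+ e :* ((x :+ y :* s) :+ (u :+ v :* s))) refl
      certY = solve 6 (λ x y u v e s →
        (e :+ s) :* (y :+ v) := :0 :+ :1 :* ((x :+ y :* e) :+ (u :+ v :* e)) :+ :1 :* ((x :+ y :* s) :+ (u :+ v :* s))) refl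

    card-² : ∀ {m} → HasCard _≡_ (λ x → σ x ≡ x) m → HasCard _≡_ (λ z → σ (σ z) ≡ z) (m ℕ.* m)
    card-² {m} (xs , xs∈ , xs-inj , xs-surj) = zs , zs∈ , zs-inj , zs-surj
      where
      zs : Fin (m ℕ.* m) → Carrier
      zs i = xs (proj₁ (Fin.remQuot m i)) + xs (proj₂ (Fin.remQuot {m} m i)) * η
      zs∈ : ∀ i → σ (σ (zs i)) ≡ zs i
      zs∈ i = trans (cong σ (trans (+-homo _ _) (cong₂ _+_ (xs∈ _) (trans (*-homo _ _) (cong (_* σ η) (xs∈ _))))))
        (trans (+-homo _ _) (cong₂ _+_ (xs∈ _) (trans (*-homo _ _) (cong₂ _*_ (xs∈ _) σση))))
      zs-inj : ∀ i j → zs i ≡ zs j → i ≡ j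
      zs-inj i j e = trans (sym (Finₚ.combine-remQuot {m} m i)) (trans (cong₂ Fin.combine (xs-inj _ _ (proj₁ xy))
          (xs-inj _ _ (proj₂ xy))) (Finₚ.combine-remQuot {m} m j))
        where xy = coordinates-unique (xs∈ _) (xs∈ _) (xs∈ _) (xs∈ _) e
      zs-surj : ∀ z → σ (σ z) ≡ z → ∃[ i ] (z ≡ zs i)
      zs-surj z σσz = combined (coordinates σσz)
        where
        combined : ∃[ x ] ∃[ y ] (σ x ≡ x × σ y ≡ y × z ≡ x + y * η) → ∃[ i ] (z ≡ zs i)
        combined (x , y , σx , σy , z≡) = Fin.combine i j , trans z≡ (trans (cong₂ (λ u v → u + v * η) (proj₂
            (xs-surj x σx)) (proj₂ (xs-surj y σy)))
          (sym (cong₂ (λ a b → xs a + xs b * η) (cong proj₁ (Finₚ.remQuot-combine i j)) (cong proj₂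
              (Finₚ.remQuot-combine {m} i j)))))
          where
          i j : Fin m
          i = proj₁ (xs-surj x σx)
          j = proj₁ (xs-surj y σy)

  HasCard-≤ : ∀ {A : Set} {_≈_ : A → A → Set} {P : A → Set} {m n} →
    (∀ {x y} → x ≈ y → y ≈ x) → (∀ {x y z} → x ≈ y → y ≈ z → x ≈ z) →
    HasCard _≈_ P m → HasCard _≈_ P n → m ℕ.≤ n
  HasCard-≤ {_≈_ = _≈_} {m = m} {n = n} ≈-sym ≈-trans (xs , xs∈ , xs-inj , _) (ys , _ , _ , ys-surj) =
    Finₚ.injective⇒≤ {f = f} λ {i} {j} → f-inj i j
    where
    f : Fin m → Fin n
    f i = proj₁ (ys-surj (xs i) (xs∈ i))
    xs≈ys : ∀ i → xs i ≈ ys (f i)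
    xs≈ys i = proj₂ (ys-surj (xs i) (xs∈ i))
    f-inj : ∀ i j → f i ≡ f j → i ≡ j
    f-inj i j e = xs-inj i j (≈-trans (xs≈ys i) (≈-sym (subst (λ k → xs j ≈ ys k) (sym e) (xs≈ys j))))

  HasCard-⇔ : ∀ {A : Set} {_≈_ : A → A → Set} {P Q : A → Set} {n} →
    (∀ {x} → P x → Q x) → (∀ {x} → Q x → P x) → HasCard _≈_ P n → HasCard _≈_ Q n
  HasCard-⇔ P⇒Q Q⇒P (xs , xs∈ , xs-inj , xs-surj) = xs , (λ i → P⇒Q (xs∈ i)) , xs-inj , (λ a a∈Q → xs-surj a (Q⇒P a∈Q))

  card-F : {P : Carrier → Set} → (∀ x → P x) → HasCard _≡_ P card
  card-F P-all = el , (λ i → P-all (el i)) , (λ i j e → trans (sym (idx-el i)) (trans (cong idx e) (idx-el j))) , (λ x _ →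
      idx x , sym (el-idx x))

  opaque
    card-dec : (P : Carrier → Set) → (∀ x → Dec (P x)) → ∃[ m ] HasCard _≡_ P m
    card-dec P P? = size , el ∘ elt , elt∈ , (λ i j e → elt-inj i j (trans (sym (idx-el _)) (trans (cong idx e)
        (idx-el _)))) , covers
      where
      open DecSubset (decSubset (P ∘ el) (λ i → P? (el i)))
      covers : ∀ a → P a → ∃[ i ] (a ≡ el (elt i))
      covers a p with elt-surj (idx a) (subst P (sym (el-idx a)) p)
      ... | i , e = i , trans (sym (el-idx a)) (cong el e)

  square-injective : ∀ m n → m ℕ.* m ≡ n ℕ.* n → m ≡ n
  square-injective m n e with ℕₚ.<-cmp m n
  ... | tri< m<n _ _ = contradiction e (ℕₚ.<⇒≢ (ℕₚ.*-mono-< m<n m<n))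
  ... | tri≈ _ m≡n _ = m≡n
  ... | tri> _ _ n<m = contradiction (sym e) (ℕₚ.<⇒≢ (ℕₚ.*-mono-< n<m n<m))

  opaque
    -- Let m be the order of `F_q`. The elements θ and t witness two successive quadratic
    -- extensions, each of which squares the order, so that |F| = m⁴. Comparison with |F| = q⁴ gives
    -- m = q.
    card-Fq : ∀ {θ t} → inK θ → ¬ inFq θ → ¬ inK t → HasCard _≡_ inFq q
    card-Fq {θ} {t} θ∈K θ∉Fq t∉K = subst (HasCard _≡_ inFq) (square-injective m q (square-injective (m ℕ.* m)
        (q ℕ.* q) m⁴≡q⁴)) cardFq
      where
      m : ℕ
      m = proj₁ (card-dec inFq (λ x → conj x ≟ x))
      cardFq : HasCard _≡_ inFq m
      cardFq = proj₂ (card-dec inFq (λ x → conj x ≟ x))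
      cardK : HasCard _≡_ inK (m ℕ.* m)
      cardK = HasCard-⇔ {_≈_ = _≡_} (λ {x} e → trans (bar≡conj² x) e) (λ {x} e → inK⇒conj² e)
        (Involution.card-² conj-endo (inK⇒conj² θ∈K) (θ∉Fq ∘ sym) cardFq)
      cardF : HasCard _≡_ (λ x → bar (bar x) ≡ x) ((m ℕ.* m) ℕ.* (m ℕ.* m))
      cardF = Involution.card-² bar-endo (bar-bar t) (t∉K ∘ sym) cardK
      m⁴≡q⁴ : (m ℕ.* m) ℕ.* (m ℕ.* m) ≡ (q ℕ.* q) ℕ.* (q ℕ.* q)
      m⁴≡q⁴ = trans (ℕₚ.≤-antisym (HasCard-≤ sym trans cardF (card-F bar-bar)) (HasCard-≤ sym trans
          (card-F bar-bar) cardF)) card≡q⁴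

-- Vectors, spans and conjugate transposition

module Vectors {h : ℕ} (F : FiniteFieldQ4 h) where
  open Geometry F
  open FieldTheory F

  vec≡ : ∀ {x₁ x₂ x₃ x₄ y₁ y₂ y₃ y₄ : Carrier} → x₁ ≡ y₁ → x₂ ≡ y₂ → x₃ ≡ y₃ → x₄ ≡ y₄ →
    _≡_ {A = V} (x₁ ∷ x₂ ∷ x₃ ∷ x₄ ∷ []) (y₁ ∷ y₂ ∷ y₃ ∷ y₄ ∷ [])
  vec≡ refl refl refl refl = refl

  vec≡⁻¹ : ∀ {x₁ x₂ x₃ x₄ y₁ y₂ y₃ y₄ : Carrier} →
    _≡_ {A = V} (x₁ ∷ x₂ ∷ x₃ ∷ x₄ ∷ []) (y₁ ∷ y₂ ∷ y₃ ∷ y₄ ∷ []) → x₁ ≡ y₁ × x₂ ≡ y₂ × x₃ ≡ y₃ × x₄ ≡ y₄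
  vec≡⁻¹ refl = refl , refl , refl , refl

  kvec : ∀ {x₁ x₂ x₃ x₄} → inK x₁ → inK x₂ → inK x₃ → inK x₄ → Kvec (x₁ ∷ x₂ ∷ x₃ ∷ x₄ ∷ [])
  kvec p₁ p₂ p₃ p₄ zero = p₁
  kvec p₁ p₂ p₃ p₄ (suc zero) = p₂
  kvec p₁ p₂ p₃ p₄ (suc (suc zero)) = p₃
  kvec p₁ p₂ p₃ p₄ (suc (suc (suc zero))) = p₄

  kvec⁻¹ : ∀ {x₁ x₂ x₃ x₄} → Kvec (x₁ ∷ x₂ ∷ x₃ ∷ x₄ ∷ []) → inK x₁ × inK x₂ × inK x₃ × inK x₄
  kvec⁻¹ p = p zero , p (suc zero) , p (suc (suc zero)) , p (suc (suc (suc zero)))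

  Kvec-lin : ∀ {x y} → inK x → inK y → ∀ u v → Kvec u → Kvec v → Kvec ((x · u) +V (y · v))
  Kvec-lin x∈K y∈K (_ ∷ _ ∷ _ ∷ _ ∷ []) (_ ∷ _ ∷ _ ∷ _ ∷ []) u∈K v∈K =
    kvec (c p₁ r₁) (c p₂ r₂) (c p₃ r₃) (c p₄ r₄)
    where
    c : ∀ {u v} → inK u → inK v → inK _
    c p r = inK-+ (inK-* x∈K p) (inK-* y∈K r)
    p₁ = proj₁ (kvec⁻¹ u∈K)
    p₂ = proj₁ (proj₂ (kvec⁻¹ u∈K))
    p₃ = proj₁ (proj₂ (proj₂ (kvec⁻¹ u∈K)))
    p₄ = proj₂ (proj₂ (proj₂ (kvec⁻¹ u∈K)))
    r₁ = proj₁ (kvec⁻¹ v∈K)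
    r₂ = proj₁ (proj₂ (kvec⁻¹ v∈K))
    r₃ = proj₁ (proj₂ (proj₂ (kvec⁻¹ v∈K)))
    r₄ = proj₂ (proj₂ (proj₂ (kvec⁻¹ v∈K)))

  -- Conjugate transposition, when (x₁, x₂, x₃, x₄) is read as a 2 × 2 matrix; it fixes V̂ pointwise.
  _† : V → V
  (x₁ ∷ x₂ ∷ x₃ ∷ x₄ ∷ []) † = conj x₁ ∷ conj x₃ ∷ conj x₂ ∷ conj x₄ ∷ []

  private module C = Endo conj-endo

  †-lin : ∀ x y u v → ((x · u) +V (y · v)) † ≡ (conj x · (u †)) +V (conj y · (v †))
  †-lin x y (_ ∷ _ ∷ _ ∷ _ ∷ []) (_ ∷ _ ∷ _ ∷ _ ∷ []) = vec≡ (c _ _) (c _ _) (c _ _) (c _ _)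
    where
    c : ∀ u v → conj (x * u + y * v) ≡ conj x * conj u + conj y * conj v
    c u v = trans (C.+-homo _ _) (cong₂ _+_ (C.*-homo _ _) (C.*-homo _ _))

  †-invol : ∀ u → Kvec u → (u †) † ≡ u
  †-invol (_ ∷ _ ∷ _ ∷ _ ∷ []) p = vec≡ (inK⇒conj² (p zero)) (inK⇒conj² (p (suc zero)))
    (inK⇒conj² (p (suc (suc zero)))) (inK⇒conj² (p (suc (suc (suc zero)))))

  †-K : ∀ u → Kvec u → Kvec (u †)
  †-K (_ ∷ _ ∷ _ ∷ _ ∷ []) p = kvec (inK-conj (p zero)) (inK-conj (p (suc (suc zero))))
    (inK-conj (p (suc zero))) (inK-conj (p (suc (suc (suc zero)))))

  Vhat⇒K : ∀ {v} → Vhat v → Kvec v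
  Vhat⇒K (α , x , β , α∈ , x∈ , β∈ , refl) = kvec (inFq⇒inK α∈) (inK-conj x∈) x∈ (inFq⇒inK β∈)

  Vhat⇒† : ∀ {v} → Vhat v → v † ≡ v
  Vhat⇒† (α , x , β , α∈ , x∈ , β∈ , refl) = vec≡ α∈ refl (inK⇒conj² x∈) β∈

  †⇒Vhat : ∀ {v} → Kvec v → v † ≡ v → Vhat v
  †⇒Vhat {x₁ ∷ x₂ ∷ x₃ ∷ x₄ ∷ []} k e = x₁ , x₃ , x₄ , proj₁ es , k (suc (suc zero)) , proj₂ (proj₂ (proj₂ es)) ,
    vec≡ refl (sym (proj₁ (proj₂ es))) refl refl
    where es = vec≡⁻¹ e

  lin₀ : ∀ u v → zeroV ≡ (0# · u) +V (0# · v)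
  lin₀ (u₁ ∷ u₂ ∷ u₃ ∷ u₄ ∷ []) (v₁ ∷ v₂ ∷ v₃ ∷ v₄ ∷ []) = vec≡ (c u₁ v₁) (c u₂ v₂) (c u₃ v₃) (c u₄ v₄)
    where
    c = solve 2 (λ u v → :0 := :0 :* u :+ :0 :* v) refl

  lin₁ : ∀ u v → u ≡ (1# · u) +V (0# · v)
  lin₁ (u₁ ∷ u₂ ∷ u₃ ∷ u₄ ∷ []) (v₁ ∷ v₂ ∷ v₃ ∷ v₄ ∷ []) = vec≡ (c u₁ v₁) (c u₂ v₂) (c u₃ v₃) (c u₄ v₄)
    where
    c = solve 2 (λ u v → u := :1 :* u :+ :0 :* v) refl

  lin₂ : ∀ u v → v ≡ (0# · u) +V (1# · v)
  lin₂ (u₁ ∷ u₂ ∷ u₃ ∷ u₄ ∷ []) (v₁ ∷ v₂ ∷ v₃ ∷ v₄ ∷ []) = vec≡ (c u₁ v₁) (c u₂ v₂) (c u₃ v₃) (c u₄ v₄)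
    where
    c = solve 2 (λ u v → v := :0 :* u :+ :1 :* v) refl

  ·-lin : ∀ c u v → c · u ≡ (c · u) +V (0# · v)
  ·-lin c (u₁ ∷ u₂ ∷ u₃ ∷ u₄ ∷ []) (v₁ ∷ v₂ ∷ v₃ ∷ v₄ ∷ []) = vec≡ (e c u₁ v₁) (e c u₂ v₂) (e c u₃ v₃) (e c u₄ v₄)
    where
    e = solve 3 (λ c u v → c :* u := c :* u :+ :0 :* v) refl

  lin-lin : ∀ x y a b c d u v →
    (x · ((a · u) +V (b · v))) +V (y · ((c · u) +V (d · v))) ≡ ((x * a + y * c) · u) +V ((x * b + y * d) · v)
  lin-lin x y a b c d (u₁ ∷ u₂ ∷ u₃ ∷ u₄ ∷ []) (v₁ ∷ v₂ ∷ v₃ ∷ v₄ ∷ []) =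
    vec≡ (e x y a b c d u₁ v₁) (e x y a b c d u₂ v₂) (e x y a b c d u₃ v₃) (e x y a b c d u₄ v₄)
    where
    e = solve 8 (λ x y a b c d u v →
      x :* (a :* u :+ b :* v) :+ y :* (c :* u :+ d :* v) := (x :* a :+ y :* c) :* u :+ (x :* b :+ y :* d) :* v) refl

  span-lin : ∀ {l w w′ x y} → inK x → inK y → OnSpan l w → OnSpan l w′ → OnSpan l ((x · w) +V (y · w′))
  span-lin {u , v} {x = x} {y} x∈K y∈K (a , b , a∈ , b∈ , refl) (c , d , c∈ , d∈ , refl) =
    _ , _ , inK-+ (inK-* x∈K a∈) (inK-* y∈K c∈) , inK-+ (inK-* x∈K b∈) (inK-* y∈K d∈) , lin-lin x y a b c d u v

  span-⊆ : ∀ {u v l} → OnSpan l u → OnSpan l v → ∀ w → OnSpan (u , v) w → OnSpan l w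
  span-⊆ u∈ v∈ _ (a , b , a∈ , b∈ , refl) = span-lin a∈ b∈ u∈ v∈

  on₁ : ∀ u v → OnSpan (u , v) u
  on₁ u v = 1# , 0# , inK-1 , inK-0 , lin₁ u v

  on₂ : ∀ u v → OnSpan (u , v) v
  on₂ u v = 0# , 1# , inK-0 , inK-1 , lin₂ u v

  -- Cramer's rule, without signs in characteristic 2.
  span-solve : ∀ u v a b c d → inK a → inK b → inK c → inK d → a * d + b * c ≢ 0# →
    let w = (a · u) +V (b · v) ; w′ = (c · u) +V (d · v) in OnSpan (w , w′) u × OnSpan (w , w′) v
  span-solve u v a b c d a∈ b∈ c∈ d∈ Δ≢0 =
    (d * i , b * i , inK-* d∈ i∈ , inK-* b∈ i∈ ,
      trans (lin₁ u v) (trans (cong₂ (λ x y → (x · u) +V (y · v)) (sym (lc₁ (c₁ a b c d i) inv)) (z₁ a b c d i)) (sym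
          (lin-lin _ _ a b c d u v)))) ,
    (c * i , a * i , inK-* c∈ i∈ , inK-* a∈ i∈ ,
      trans (lin₂ u v) (trans (cong₂ (λ x y → (x · u) +V (y · v)) (z₂ a b c d i) (sym (lc₁ (c₂ a b c d i) inv))) (sym
          (lin-lin _ _ a b c d u v))))
    where
    i = (a * d + b * c) ⁻¹
    inv = ⁻¹-inverse _ Δ≢0
    i∈ : inK i
    i∈ = inK-⁻¹ Δ≢0 (inK-+ (inK-* a∈ d∈) (inK-* b∈ c∈))
    c₁ = solve 5 (λ a b c d i → d :* i :* a :+ b :* i :* c := :1 :+ :1 :* ((a :* d :+ b :* c) :* i :+ :1)) refl
    c₂ = solve 5 (λ a b c d i → c :* i :* b :+ a :* i :* d := :1 :+ :1 :* ((a :* d :+ b :* c) :* i :+ :1)) refl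
    z₁ = solve 5 (λ a b c d i → :0 := d :* i :* b :+ b :* i :* d) refl
    z₂ = solve 5 (λ a b c d i → :0 := c :* i :* a :+ a :* i :* c) refl

  Tr : Carrier → Carrier
  Tr x = x + bar x

  private module B = Endo bar-endo

  Tr-K : ∀ x → inK (Tr x)
  Tr-K x = trans (B.+-homo _ _) (trans (cong (bar x +_) (bar-bar x)) (+-comm _ _))

  Tr-lin : ∀ {x y} → inK x → inK y → ∀ k m → Tr (x * k + y * m) ≡ x * Tr k + y * Tr m
  Tr-lin {x} {y} x∈K y∈K k m =
    trans (cong (x * k + y * m +_) (trans (B.+-homo _ _) (cong₂ _+_ (trans (B.*-homo _ _) (cong (_* bar k) x∈K)) (trans
        (B.*-homo _ _) (cong (_* bar m) y∈K)))))
      (e x y k m (bar k) (bar m))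
    where
    e = solve 6 (λ x y k m k̄ m̄ → x :* k :+ y :* m :+ (x :* k̄ :+ y :* m̄) := x :* (k :+ k̄) :+ y :* (m :+ m̄)) refl

  Tr-bar : ∀ x → Tr (bar x) ≡ Tr x
  Tr-bar x = trans (cong (bar x +_) (bar-bar x)) (+-comm _ _)

  module Conjugates {t : Carrier} (t∉K : ¬ inK t) where
    t≢t̄ : t ≢ bar t
    t≢t̄ = t∉K ∘ sym
    δ≢0 : t + bar t ≢ 0#
    δ≢0 = +-≢0 t≢t̄
    open Involution bar-endo (bar-bar t) t≢t̄ public using (coordinates; coordinates-unique)

  -- The generators of the cyclic Galois group of order 4 over `F_q` are x^q and x^{q³}; these are
  -- the properties that they share.
  record Twist (f : Carrier → Carrier) : Set where
    field
      endo : Endo f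
      f²   : ∀ x → f (f x) ≡ bar x
      f-K  : ∀ {x} → inK x → f x ≡ conj x

  conj-twist : Twist conj
  conj-twist = record { endo = conj-endo ; f² = λ x → sym (bar≡conj² x) ; f-K = λ _ → refl }

  conj³-twist : Twist (λ x → conj (bar x))
  conj³-twist = record
    { endo = ∘-endo conj-endo bar-endo
    ; f² = λ x → trans (cong conj (trans (bar-conj (bar x)) (cong conj (bar-bar x)))) (sym (bar≡conj² x))
    ; f-K = cong conj }

-- The lines attached to elements outside K

-- For a twist f, the f-line of t is the K-form of the line of PG(3,q⁴) spanned by e_t ⊗ e_{f t} and its conjugate.
-- The two twists x^q and x^{q³} give the two relative hemisystems.

module Lines {h : ℕ} (F : FiniteFieldQ4 h) {f : FiniteFieldQ4.Carrier F → FiniteFieldQ4.Carrier F} (tw : Vectors.Twist F f) where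
  open Geometry F
  open FieldTheory F
  open Vectors F
  open Twist tw
  private
    module B = Endo bar-endo
  open Endo endo public renaming (+-homo to f-+; *-homo to f-*; 1-homo to f-1; 0-homo to f-0; ≢0-homo to f-≢0; ⁻¹-homo to f-⁻¹)

  bar-f : ∀ x → bar (f x) ≡ f (bar x)
  bar-f x = trans (sym (f² (f x))) (cong f (f² x))

  f-f-bar : ∀ x → f (f (bar x)) ≡ x
  f-f-bar x = trans (f² (bar x)) (bar-bar x)

  conj-Tr : ∀ x → conj (Tr x) ≡ f x + f (bar x)
  conj-Tr x = trans (sym (f-K (Tr-K x))) (f-+ x (bar x))

  -- Since e_t ⊗ e_{f t} = (1, f t, t, t f(t)), this is the trace to `K` of k times that vector. The
  -- field, as a plane over `K`, thus parametrizes the vectors of the line.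
  T : Carrier → Carrier → V
  T t k = Tr k ∷ Tr (k * f t) ∷ Tr (k * t) ∷ Tr (k * (t * f t)) ∷ []

  Tr₂≡ : ∀ t k → Tr (k * f t) ≡ k * f t + bar k * f (bar t)
  Tr₂≡ t k = cong (k * f t +_) (trans (B.*-homo _ _) (cong (bar k *_) (bar-f t)))

  Tr₃≡ : ∀ t k → Tr (k * t) ≡ k * t + bar k * bar t
  Tr₃≡ t k = cong (k * t +_) (B.*-homo _ _)

  Tr₄≡ : ∀ t k → Tr (k * (t * f t)) ≡ k * (t * f t) + bar k * (bar t * f (bar t))
  Tr₄≡ t k = cong (k * (t * f t) +_) (trans (B.*-homo _ _) (cong (bar k *_) (trans (B.*-homo _ _) (cong (bar t *_)
      (bar-f t)))))

  T≡ : ∀ t k → T t k ≡ (k + bar k) ∷ (k * f t + bar k * f (bar t)) ∷ (k * t + bar k * bar t)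
    ∷ (k * (t * f t) + bar k * (bar t * f (bar t))) ∷ []
  T≡ t k = vec≡ refl (Tr₂≡ t k) (Tr₃≡ t k) (Tr₄≡ t k)

  conj-T₂ : ∀ t k → conj (Tr (k * f t)) ≡ f k * bar t + f (bar k) * t
  conj-T₂ t k = trans (sym (f-K (Tr-K _))) (trans (cong f (Tr₂≡ t k)) (trans (f-+ _ _)
    (cong₂ _+_ (trans (f-* _ _) (cong (f k *_) (f² t))) (trans (f-* _ _) (cong (f (bar k) *_) (f-f-bar t))))))

  conj-T₃ : ∀ t k → conj (Tr (k * t)) ≡ f k * f t + f (bar k) * f (bar t)
  conj-T₃ t k = trans (sym (f-K (Tr-K _))) (trans (cong f (Tr₃≡ t k)) (trans (f-+ _ _) (cong₂ _+_ (f-* _ _) (f-* _ _))))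

  conj-T₄ : ∀ t k → conj (Tr (k * (t * f t))) ≡ f k * (f t * bar t) + f (bar k) * (f (bar t) * t)
  conj-T₄ t k = trans (sym (f-K (Tr-K _))) (trans (cong f (Tr₄≡ t k)) (trans (f-+ _ _)
    (cong₂ _+_ (trans (f-* _ _) (cong (f k *_) (trans (f-* _ _) (cong (f t *_) (f² t)))))
      (trans (f-* _ _) (cong (f (bar k) *_) (trans (f-* _ _) (cong (f (bar t) *_) (f-f-bar t))))))))

  -- The dagger carries the line of t to the one spanned by e_{t̄} ⊗ e_{f t} and its conjugate. This
  -- is the orthogonal complement of the line of t under the polar form of the determinant.
  †T≡ : ∀ t k → (T t k) † ≡ (f k + f (bar k)) ∷ (f k * f t + f (bar k) * f (bar t)) ∷ (f k * bar t + f (bar k) * t)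
    ∷ (f k * (f t * bar t) + f (bar k) * (f (bar t) * t)) ∷ []
  †T≡ t k = vec≡ (conj-Tr k) (conj-T₃ t k) (conj-T₂ t k) (conj-T₄ t k)

  T-K : ∀ t k → Kvec (T t k)
  T-K t k = kvec (Tr-K _) (Tr-K _) (Tr-K _) (Tr-K _)

  T-lin : ∀ t {x y} → inK x → inK y → ∀ k m → (x · T t k) +V (y · T t m) ≡ T t (x * k + y * m)
  T-lin t {x} {y} x∈K y∈K k m = vec≡ (sym (Tr-lin x∈K y∈K k m)) (c (f t)) (c t) (c (t * f t))
    where
    e = solve 5 (λ x y k m u → (x :* k :+ y :* m) :* u := x :* (k :* u) :+ y :* (m :* u)) refl
    c : ∀ u → x * Tr (k * u) + y * Tr (m * u) ≡ Tr ((x * k + y * m) * u)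
    c u = sym (trans (cong Tr (e x y k m u)) (Tr-lin x∈K y∈K (k * u) (m * u)))

  T-scale : ∀ t {c} k → inK c → T t (c * k) ≡ c · T t k
  T-scale t {c} k c∈ = trans (cong (T t) (e c k)) (trans (sym (T-lin t c∈ inK-0 k k)) (sym (·-lin c (T t k) (T t k))))
    where
    e = solve 2 (λ c k → c :* k := c :* k :+ :0 :* k) refl

  T-bar : ∀ t k → T (bar t) k ≡ T t (bar k)
  T-bar t k = vec≡ (sym (Tr-bar k)) (c (trans (B.*-homo _ _) (cong₂ _*_ (bar-bar k) (bar-f t)))) (c (trans (B.*-homo _ _)
      (cong (_* bar t) (bar-bar k))))
    (c (trans (B.*-homo _ _) (cong₂ _*_ (bar-bar k) (trans (B.*-homo _ _) (cong (bar t *_) (bar-f t))))))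
    where
    c : ∀ {x y} → bar x ≡ y → Tr y ≡ Tr x
    c {x} refl = Tr-bar x

  T-0 : ∀ t → T t 0# ≡ zeroV
  T-0 t = vec≡ Tr0 (c _) (c _) (c _)
    where
    Tr0 : Tr 0# ≡ 0#
    Tr0 = trans (cong (0# +_) inK-0) (+-identityˡ 0#)
    c : ∀ x → Tr (0# * x) ≡ 0#
    c x = trans (cong Tr (zeroˡ x)) Tr0

  -- `herm u v` is the polar form of the determinant at u and v †, and the dagger takes the line to
  -- its orthogonal complement.
  herm-T : ∀ t k m → herm (T t k) (T t m) ≡ 0#
  herm-T t k m = trans
    (cong₂ _+_ (cong₂ _+_ (cong₂ _+_ (cong (Tr k *_) (conj-T₄ t m)) (cong₂ _*_ (Tr₂≡ t k) (conj-T₂ t m)))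
      (cong₂ _*_ (Tr₃≡ t k) (conj-T₃ t m))) (cong₂ _*_ (Tr₄≡ t k) (conj-Tr m)))
    (e t (f t) (bar t) (f (bar t)) k (bar k) (f m) (f (bar m)))
    where
    e = solve 8 (λ a b c d k k̄ m m̄ →
      (k :+ k̄) :* (m :* (b :* c) :+ m̄ :* (d :* a)) :+ (k :* b :+ k̄ :* d) :* (m :* c :+ m̄ :* a)
      :+ (k :* a :+ k̄ :* c) :* (m :* b :+ m̄ :* d) :+ (k :* (a :* b) :+ k̄ :* (c :* d)) :* (m :+ m̄) := :0) refl

  -- The polar form of the determinant against e_s ⊗ e_{f s̄}. That vector and its conjugate span
  -- the orthogonal complement of the line of s, so for vectors over `K` the equation `L s w ≡ 0#`
  -- describes the line.
  L : Carrier → V → Carrier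
  L s (x₁ ∷ x₂ ∷ x₃ ∷ x₄ ∷ []) = x₁ * (s * f (bar s)) + x₂ * s + x₃ * f (bar s) + x₄

  L-lin : ∀ s x y u v → L s ((x · u) +V (y · v)) ≡ x * L s u + y * L s v
  L-lin s x y (u₁ ∷ u₂ ∷ u₃ ∷ u₄ ∷ []) (v₁ ∷ v₂ ∷ v₃ ∷ v₄ ∷ []) = e x y s (f (bar s)) u₁ u₂ u₃ u₄ v₁ v₂ v₃ v₄
    where
    e = solve 12 (λ x y s r u₁ u₂ u₃ u₄ v₁ v₂ v₃ v₄ →
      (x :* u₁ :+ y :* v₁) :* (s :* r) :+ (x :* u₂ :+ y :* v₂) :* s :+ (x :* u₃ :+ y :* v₃) :* r :+ (x :* u₄ :+ y :* v₄)
      := x :* (u₁ :* (s :* r) :+ u₂ :* s :+ u₃ :* r :+ u₄) :+ y :* (v₁ :* (s :* r) :+ v₂ :* s :+ v₃ :* r :+ v₄)) refl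

  L-0 : ∀ s → L s zeroV ≡ 0#
  L-0 s = e s (f (bar s))
    where
    e = solve 2 (λ s r → :0 :* (s :* r) :+ :0 :* s :+ :0 :* r :+ :0 := :0) refl

  -- The polar form at two pure tensors is the product of the differences of their parameters.
  L-T : ∀ s t k → L s (T t k) ≡ k * ((s + t) * (f (bar s) + f t)) + bar k * ((s + bar t) * (f (bar s) + f (bar t)))
  L-T s t k = trans (cong (L s) (T≡ t k)) (e s (f (bar s)) t (f t) (bar t) (f (bar t)) k (bar k))
    where
    e = solve 8 (λ s r a b c d k k̄ →
      (k :+ k̄) :* (s :* r) :+ (k :* b :+ k̄ :* d) :* s :+ (k :* a :+ k̄ :* c) :* r :+ (k :* (a :* b) :+ k̄ :* (c :* d))
      := k :* ((s :+ a) :* (r :+ b)) :+ k̄ :* ((s :+ c) :* (r :+ d))) refl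

  L-†T : ∀ s t k → L s ((T t k) †) ≡ f k * ((s + bar t) * (f (bar s) + f t)) + f (bar k) * ((s + t) * (f (bar s) + f
      (bar t)))
  L-†T s t k = trans (cong (L s) (†T≡ t k)) (e s (f (bar s)) t (f t) (bar t) (f (bar t)) (f k) (f (bar k)))
    where
    e = solve 8 (λ s r a b c d k k̄ →
      (k :+ k̄) :* (s :* r) :+ (k :* b :+ k̄ :* d) :* s :+ (k :* c :+ k̄ :* a) :* r :+ (k :* (b :* c) :+ k̄ :* (d :* a))
      := k :* ((s :+ c) :* (r :+ b)) :+ k̄ :* ((s :+ a) :* (r :+ d))) refl

  L-T-self : ∀ t k → L t (T t k) ≡ 0#
  L-T-self t k = trans (L-T t t k) (e t (bar t) (f t) (f (bar t)) k (bar k))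
    where
    e = solve 6 (λ a c b d k k̄ → k :* ((a :+ a) :* (d :+ b)) :+ k̄ :* ((a :+ c) :* (d :+ d)) := :0) refl

  L-†T-self : ∀ t k → L t ((T t k) †) ≡ f k * ((t + bar t) * (f (t + bar t)))
  L-†T-self t k = trans (L-†T t t k) (trans (e t (bar t) (f t) (f (bar t)) (f k) (f (bar k))) (cong (λ z → f k * ((t
      + bar t) * z)) (sym (f-+ _ _))))
    where
    e = solve 6 (λ a c b d k k̄ → k :* ((a :+ c) :* (d :+ b)) :+ k̄ :* ((a :+ a) :* (d :+ d)) := k :* ((a :+ c) :* (b
        :+ d))) refl

  module Line {t : Carrier} (t∉K : ¬ inK t) where
    open Conjugates t∉K public

    T-determined : ∀ {k m} → Tr k ≡ Tr m → Tr (k * t) ≡ Tr (m * t) → k ≡ m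
    T-determined {k} {m} p r = ≡0-+ (*-cancelˡ δ≢0 (trans
      (lc₂ (e t (bar t) k (bar k) m (bar m)) p (trans (sym (Tr₃≡ t k)) (trans r (Tr₃≡ t m)))) (sym (zeroʳ _))))
      where
      e = solve 6 (λ a c k k̄ m m̄ →
        (a :+ c) :* (k :+ m) := :0 :+ c :* ((k :+ k̄) :+ (m :+ m̄)) :+ :1 :* ((k :* a :+ k̄ :* c) :+ (m :* a
            :+ m̄ :* c))) refl

    T-injective : ∀ {k m} → T t k ≡ T t m → k ≡ m
    T-injective e = T-determined (proj₁ (vec≡⁻¹ e)) (proj₁ (proj₂ (proj₂ (vec≡⁻¹ e))))

    T-≢0 : ∀ {k} → k ≢ 0# → T t k ≢ zeroV
    T-≢0 k≢0 e = k≢0 (T-injective (trans e (sym (T-0 t))))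

    points : V × V
    points = T t 1# , T t t

    span⇒T : ∀ {w} → OnSpan points w → ∃[ k ] (w ≡ T t k)
    span⇒T (x , y , x∈ , y∈ , e) = _ , trans e (T-lin t x∈ y∈ 1# t)

    span-T : ∀ k → OnSpan points (T t k)
    span-T k = on (coordinates (bar-bar k))
      where
      on : ∃[ x ] ∃[ y ] (inK x × inK y × k ≡ x + y * t) → OnSpan points (T t k)
      on (x , y , x∈ , y∈ , e) = x , y , x∈ , y∈ ,
        trans (cong (T t) (trans e (cong (_+ y * t) (sym (*-identityʳ x))))) (sym (T-lin t x∈ y∈ 1# t))

    line : HLine
    line = points , T-K t _ , T-K t _ , independent , herm-T t _ _ , herm-T t _ _ , herm-T t _ _
      where
      independent : ∀ x y → inK x → inK y → (x · T t 1#) +V (y · T t t) ≡ zeroV → x ≡ 0# × y ≡ 0#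
      independent x y x∈ y∈ e = coordinates-unique x∈ y∈ inK-0 inK-0
        (trans (cong (_+ y * t) (sym (*-identityʳ x))) (trans (T-injective (trans (sym (T-lin t x∈ y∈ 1# t)) (trans e (sym
            (T-0 t))))) (c t)))
        where
        c = solve 1 (λ t → :0 := :0 :+ :0 :* t) refl

    -- The parameter k solves Tr k = x₁ and Tr(k t) = x₃ by Cramer's rule; `L t w ≡ 0#` and its
    -- conjugate then determine the two other coordinates.
    L≡0⇒T : ∀ w → Kvec w → L t w ≡ 0# → ∃[ k ] (w ≡ T t k)
    L≡0⇒T (x₁ ∷ x₂ ∷ x₃ ∷ x₄ ∷ []) w∈K Lw≡0 = k , sym (vec≡
      (trans (cong (k +_) k̄≡) (lc₁ (c₁ a c x₁ x₃ i) inv))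
      (trans (Tr₂≡ t k) (trans (cong (λ z → k * f t + z * f (bar t)) k̄≡) (lc₃ (c₂ a b c d x₁ x₂ x₃ x₄ i) Lw≡0 L̄w≡0 inv)))
      (trans (Tr₃≡ t k) (trans (cong (λ z → k * t + z * bar t) k̄≡) (lc₁ (c₃ a c x₁ x₃ i) inv)))
      (trans (Tr₄≡ t k) (trans (cong (λ z → k * (t * f t) + z * (bar t * f (bar t))) k̄≡) (lc₃
          (c₄ a b c d x₁ x₂ x₃ x₄ i) Lw≡0 L̄w≡0 inv))))
      where
      a b c d i k : Carrier
      a = t
      b = f t
      c = bar t
      d = f (bar t)
      i = (t + bar t) ⁻¹
      inv : (t + bar t) * i ≡ 1#
      inv = ⁻¹-inverse _ δ≢0
      k = (x₁ * c + x₃) * i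
      k̄≡ : bar k ≡ (x₁ * a + x₃) * i
      k̄≡ = trans (B.*-homo _ _) (cong₂ _*_
        (trans (B.+-homo _ _) (cong₂ _+_ (trans (B.*-homo _ _) (cong₂ _*_ (w∈K zero) (bar-bar t))) (w∈K (suc (suc zero)))))
        (inK-⁻¹ δ≢0 (Tr-K t)))
      L̄w≡0 : x₁ * (c * b) + x₂ * c + x₃ * b + x₄ ≡ 0#
      L̄w≡0 = trans (sym (trans (B.+-homo _ _) (cong₂ _+_ (trans (B.+-homo _ _) (cong₂ _+_ (trans (B.+-homo _ _) (cong₂ _+_
          (trans (B.*-homo _ _) (cong₂ _*_ (w∈K zero) (trans (B.*-homo _ _) (cong (c *_) d̄≡b))))
          (trans (B.*-homo _ _) (cong (_* c) (w∈K (suc zero))))))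
          (trans (B.*-homo _ _) (cong₂ _*_ (w∈K (suc (suc zero))) d̄≡b))))
          (w∈K (suc (suc (suc zero)))))))
        (trans (cong bar Lw≡0) inK-0)
        where
        d̄≡b : bar (f (bar t)) ≡ f t
        d̄≡b = trans (bar-f _) (cong f (bar-bar t))
      c₁ = solve 5 (λ a c x₁ x₃ i → (x₁ :* c :+ x₃) :* i :+ (x₁ :* a :+ x₃) :* i := x₁ :+ x₁ :* ((a :+ c) :* i :+ :1)) refl
      c₃ = solve 5 (λ a c x₁ x₃ i → (x₁ :* c :+ x₃) :* i :* a :+ (x₁ :* a :+ x₃) :* i :* c := x₃ :+ x₃ :* ((a :+ c) :* i
          :+ :1)) refl
      c₂ = solve 9 (λ a b c d x₁ x₂ x₃ x₄ i →
        (x₁ :* c :+ x₃) :* i :* b :+ (x₁ :* a :+ x₃) :* i :* d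
        := x₂ :+ i :* (x₁ :* (a :* d) :+ x₂ :* a :+ x₃ :* d :+ x₄ :+ :0) :+ i :* (x₁ :* (c :* b) :+ x₂ :* c :+ x₃ :* b :+ x₄
            :+ :0) :+ x₂ :* ((a :+ c) :* i :+ :1)) refl
      c₄ = solve 9 (λ a b c d x₁ x₂ x₃ x₄ i →
        (x₁ :* c :+ x₃) :* i :* (a :* b) :+ (x₁ :* a :+ x₃) :* i :* (c :* d)
        := x₄ :+ (i :* c) :* (x₁ :* (a :* d) :+ x₂ :* a :+ x₃ :* d :+ x₄ :+ :0) :+ (i :* a) :* (x₁ :* (c :* b) :+ x₂ :* c
            :+ x₃ :* b :+ x₄ :+ :0) :+ x₄ :* ((a :+ c) :* i :+ :1)) refl

    L≡0⇒span : ∀ w → Kvec w → L t w ≡ 0# → OnSpan points w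
    L≡0⇒span w w∈K e = on (L≡0⇒T w w∈K e)
      where
      on : ∃[ k ] (w ≡ T t k) → OnSpan points w
      on (k , w≡) = subst (OnSpan points) (sym w≡) (span-T k)

    span⇒L≡0 : ∀ {w} → OnSpan points w → L t w ≡ 0#
    span⇒L≡0 o = trans (cong (L t) (proj₂ (span⇒T o))) (L-T-self t _)

    span⇒K : ∀ {w} → OnSpan points w → Kvec w
    span⇒K o = subst Kvec (sym (proj₂ (span⇒T o))) (T-K t _)

    -- T k and its dagger are independent, since L t kills the former but not the latter.

    T,†-independent : ∀ {k x y} → k ≢ 0# → inK x → (x · T t k) +V (y · ((T t k) †)) ≡ zeroV → x ≡ 0# × y ≡ 0#
    T,†-independent {k} {x} {y} k≢0 x∈ e = x≡0 , y≡0
      where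
      y≡0 : y ≡ 0#
      y≡0 = *-cancelˡ (*-≢0 (f-≢0 k≢0) (*-≢0 δ≢0 (f-≢0 δ≢0))) (trans (trans (*-comm _ y) Lx+Ly) (sym (zeroʳ _)))
        where
        Lx+Ly : y * (f k * ((t + bar t) * f (t + bar t))) ≡ 0#
        Lx+Ly = trans (sym (trans (L-lin t x y _ _) (trans (cong₂ _+_ (trans (cong (x *_) (L-T-self t k)) (zeroʳ x)) (cong
            (y *_) (L-†T-self t k))) (+-identityˡ _))))
          (trans (cong (L t) e) (L-0 t))
      x≡0 : x ≡ 0#
      x≡0 = trans (sym (trans (*-comm _ _) (trans (*-assoc x k _) (trans (cong (x *_) (⁻¹-inverse k k≢0))
          (*-identityʳ x)))))
        (trans (cong (k ⁻¹ *_) xk≡0) (zeroʳ _))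
        where
        xk≡0 : x * k ≡ 0#
        xk≡0 = T-injective (trans (T-scale t k x∈) (trans (·-lin x (T t k) ((T t k) †))
          (trans (cong (λ z → (x · T t k) +V (z · ((T t k) †))) (sym y≡0)) (trans e (sym (T-0 t))))))

  open Line using (line; points)


  same-line : ∀ {s t} (s∉K : ¬ inK s) (t∉K : ¬ inK t) → s ≡ t ⊎ s ≡ bar t → line s∉K ≅ line t∉K
  same-line {s} s∉K t∉K (inj₁ refl) w =
    (λ o → Line.L≡0⇒span t∉K w (Line.span⇒K s∉K o) (Line.span⇒L≡0 s∉K o)) , (λ o → Line.L≡0⇒span s∉K w (Line.span⇒K t∉K o)
        (Line.span⇒L≡0 t∉K o))
  same-line {s} {t} s∉K t∉K (inj₂ refl) w = to {u∉K = s∉K} {t∉K} (λ k → T-bar t k) , to {u∉K = t∉K} {s∉K} (λ k → trans (cong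
      (λ z → T z k) (sym (bar-bar t))) (T-bar (bar t) k))
    where
    to : ∀ {u v} {u∉K : ¬ inK u} {v∉K : ¬ inK v} → (∀ k → T u k ≡ T v (bar k)) → OnSpan (points u∉K) w → OnSpan
        (points v∉K) w
    to {u∉K = u∉K} {v∉K} e o = subst (OnSpan (points v∉K)) (sym (trans (proj₂ (Line.span⇒T u∉K o)) (e _)))
        (Line.span-T v∉K _)

  -- Evaluate at k = 1 and at k = t.

  contained⇒same : ∀ {s t} → ¬ inK t → (∀ k → L s (T t k) ≡ 0#) → s ≡ t ⊎ s ≡ bar t
  contained⇒same {s} {t} t∉K L≡0 = conclude (zero-product (*-cancelˡ δ≢0 (trans (lc₂ (c t (bar t) X Y) at1 att) (sym
      (zeroʳ _)))))
    where
    open Conjugates t∉K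
    X Y : Carrier
    X = (s + t) * (f (bar s) + f t)
    Y = (s + bar t) * (f (bar s) + f (bar t))
    at1 : X + Y ≡ 0#
    at1 = trans (sym (trans (L-T s t 1#) (cong₂ _+_ (*-identityˡ X) (trans (cong (_* Y) inK-1) (*-identityˡ Y))))) (L≡0 1#)
    att : t * X + bar t * Y ≡ 0#
    att = trans (sym (L-T s t t)) (L≡0 t)
    c = solve 4 (λ t t̄ X Y → (t :+ t̄) :* X := :0 :+ t̄ :* ((X :+ Y) :+ :0) :+ :1 :* ((t :* X :+ t̄ :* Y) :+ :0)) refl
    conclude : s + t ≡ 0# ⊎ f (bar s) + f t ≡ 0# → s ≡ t ⊎ s ≡ bar t
    conclude (inj₁ e) = inj₁ (≡0-+ e)
    conclude (inj₂ e) = inj₂ (trans (sym (f-f-bar s)) (trans (cong f (≡0-+ e)) (f² t)))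

  ≅⇒same : ∀ {s t} (s∉K : ¬ inK s) (t∉K : ¬ inK t) → line s∉K ≅ line t∉K → s ≡ t ⊎ s ≡ bar t
  ≅⇒same s∉K t∉K e = contained⇒same t∉K (λ k → Line.span⇒L≡0 s∉K (proj₂ (e (T _ k)) (Line.span-T t∉K k)))

-- The relations on elliptic lines

module HollmannXiang {h : ℕ} (F : FiniteFieldQ4 h) where
  open Geometry F
  open FieldTheory F
  open Vectors F
  private
    module B = Endo bar-endo
    module C = Endo conj-endo

  -- The powers of z² + z with exponent 2^i are sums of two consecutive terms z^{2^i}. Hence the
  -- trace of z² + z over `F_q` or `K` vanishes exactly when z lies in that field.
  telescope : ∀ z n → sumF n (λ i → pow (z * z + z) (2 ℕ.^ i)) ≡ pow z (2 ℕ.^ n) + z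
  telescope z zero = trans (sym (+-≡0 refl)) (cong (_+ z) (sym (*-identityʳ z)))
  telescope z (suc n) = trans (cong₂ _+_ (telescope z n) (trans (pow-2^-+ (z * z) z n) (cong (_+ pow z (2 ℕ.^ n)) (trans
      (pow-*-base z z (2 ℕ.^ n)) (sym (pow-2^-suc z n))))))
    (c (pow z (2 ℕ.^ n)) z (pow z (2 ℕ.^ suc n)))
    where
    c = solve 3 (λ u z v → u :+ z :+ (v :+ u) := v :+ z) refl

  Tr₁-℘ : ∀ z → Tr₁ (z * z + z) ≡ conj z + z
  Tr₁-℘ z = telescope z h

  Tr₂-℘ : ∀ z → Tr₂ (z * z + z) ≡ bar z + z
  Tr₂-℘ z = trans (telescope z (2 ℕ.* h)) (cong (λ n → pow z n + z) 2^2h≡q²)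
    where
    2^2h≡q² : 2 ℕ.^ (2 ℕ.* h) ≡ q ℕ.* q
    2^2h≡q² = trans (cong (2 ℕ.^_) (ℕₚ.*-comm 2 h)) (trans (sym (ℕₚ.^-*-assoc 2 h 2)) (cong (q ℕ.*_) (ℕₚ.*-identityʳ q)))

  module Pair {s t : Carrier} (s∉K : ¬ inK s) (t∉K : ¬ inK t) (s≢t : s ≢ t) (s≢t̄ : s ≢ bar t) where

    -- ρ = N / D and ρ̂ = z² + z with z = N / (N + D), so the trace of ρ̂ over F_q is z^q + z and the one over K vanishes.

    P R N D Δ z : Carrier
    P = s + t
    R = s + bar t
    N = P * bar P
    D = R * bar R
    Δ = N + D
    z = N * Δ ⁻¹

    P≢0 : P ≢ 0#
    P≢0 = +-≢0 s≢t
    R≢0 : R ≢ 0#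
    R≢0 = +-≢0 s≢t̄
    N≢0 : N ≢ 0#
    N≢0 = *-≢0 P≢0 (B.≢0-homo P≢0)
    D≢0 : D ≢ 0#
    D≢0 = *-≢0 R≢0 (B.≢0-homo R≢0)

    bar-P : bar P ≡ bar s + bar t
    bar-P = B.+-homo s t
    bar-R : bar R ≡ bar s + t
    bar-R = trans (B.+-homo s (bar t)) (cong (bar s +_) (bar-bar t))

    Δ≢0 : Δ ≢ 0#
    Δ≢0 e = *-≢0 (Conjugates.δ≢0 s∉K) (Conjugates.δ≢0 t∉K) (trans (sym Δ≡) e)
      where
      c = solve 4 (λ s t s̄ t̄ → (s :+ t) :* (s̄ :+ t̄) :+ (s :+ t̄) :* (s̄ :+ t) := (s :+ s̄) :* (t :+ t̄)) refl
      Δ≡ : Δ ≡ (s + bar s) * (t + bar t)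
      Δ≡ = trans (cong₂ (λ u v → P * u + R * v) bar-P bar-R) (c s t (bar s) (bar t))

    norm-K : ∀ x → inK (x * bar x)
    norm-K x = trans (B.*-homo _ _) (trans (cong (bar x *_) (bar-bar x)) (*-comm _ _))

    N∈K : inK N
    N∈K = norm-K P
    D∈K : inK D
    D∈K = norm-K R
    Δ∈K : inK Δ
    Δ∈K = inK-+ N∈K D∈K
    z∈K : inK z
    z∈K = inK-* N∈K (inK-⁻¹ Δ≢0 Δ∈K)

    -- In characteristic 2, N² + D² = (N + D)², so 1 / (N/D + D/N) = N D / Δ². This is z² + z
    -- because z + 1 = D / Δ.
    ρ̂≡ : ρ̂ (t , t∉K) (s , s∉K) ≡ z * z + z
    ρ̂≡ = trans (sym (⁻¹-unique ρ+ρ⁻¹≢0 product)) (c₂ N D (Δ ⁻¹) inv)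
      where
      r : Carrier
      r = ρ t s
      inv : Δ * Δ ⁻¹ ≡ 1#
      inv = ⁻¹-inverse _ Δ≢0
      r≡ : r ≡ N * D ⁻¹
      r≡ = cong₂ (λ u v → u * v ⁻¹) (cong₂ _*_ (+-comm t s) (trans (+-comm _ _) (sym bar-P)))
        (trans (*-comm _ _) (cong₂ _*_ (+-comm _ _) (trans (+-comm _ _) (sym bar-R))))
      r≢0 : r ≢ 0#
      r≢0 e = *-≢0 N≢0 (⁻¹-≢0 D≢0) (trans (sym r≡) e)
      r⁻¹≡ : r ⁻¹ ≡ D * N ⁻¹
      r⁻¹≡ = sym (⁻¹-unique r≢0 (trans (cong (_* (D * N ⁻¹)) r≡) (lc₂ (c N D (N ⁻¹) (D ⁻¹)) (⁻¹-inverse N N≢0)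
          (⁻¹-inverse D D≢0))))
        where
        c = solve 4 (λ N D n d → N :* d :* (D :* n) := :1 :+ (D :* d) :* (N :* n :+ :1) :+ :1 :* (D :* d :+ :1)) refl
      product : (r + r ⁻¹) * (N * D * (Δ ⁻¹ * Δ ⁻¹)) ≡ 1#
      product = trans (cong₂ (λ u v → (u + v) * (N * D * (Δ ⁻¹ * Δ ⁻¹))) r≡ r⁻¹≡)
        (lc₃ (c₁ N D (N ⁻¹) (D ⁻¹) (Δ ⁻¹)) (⁻¹-inverse D D≢0) (⁻¹-inverse N N≢0) inv)
        where
        c₁ = solve 5 (λ N D n d i →
          (N :* d :+ D :* n) :* (N :* D :* (i :* i)) :=
          :1 :+ (N :* N :* i :* i) :* (D :* d :+ :1) :+ (D :* D :* i :* i) :* (N :* n :+ :1) :+ ((N :+ D) :* i :+ :1) :* ((N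
              :+ D) :* i :+ :1)) refl
      ρ+ρ⁻¹≢0 : r + r ⁻¹ ≢ 0#
      ρ+ρ⁻¹≢0 e = 1≢0 (trans (sym product) (*≡0ˡ e))
      c₂ : ∀ N D i → (N + D) * i ≡ 1# → N * D * (i * i) ≡ N * i * (N * i) + N * i
      c₂ N D i e = lc₁ (c N D i) e
        where
        c = solve 3 (λ N D i → N :* D :* (i :* i) := N :* i :* (N :* i) :+ N :* i :+ (N :* i) :* ((N :+ D) :* i :+ :1)) refl

    N′ D′ : Carrier
    N′ = conj N
    D′ = conj D

    private
      i : Carrier
      i = Δ ⁻¹
      inv : Δ * i ≡ 1#
      inv = ⁻¹-inverse Δ Δ≢0
      conj-inv : (N′ + D′) * conj i ≡ 1#
      conj-inv = trans (cong (_* conj i) (sym (C.+-homo N D))) (trans (sym (C.*-homo _ _)) (trans (cong conj inv) C.1-homo))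
      conj-z : conj z ≡ N′ * conj i
      conj-z = C.*-homo _ _
      i≢0 : i * conj i ≢ 0#
      i≢0 = *-≢0 (⁻¹-≢0 Δ≢0) (C.≢0-homo (⁻¹-≢0 Δ≢0))

    sum-z : conj z + z ≡ (i * conj i) * (N * D′ + D * N′)
    sum-z = trans (cong (_+ z) conj-z) (lc₂ (c N D N′ D′ i (conj i)) inv conj-inv)
      where
      c = solve 6 (λ N D N′ D′ i i′ →
        N′ :* i′ :+ N :* i := (i :* i′) :* (N :* D′ :+ D :* N′) :+ (N′ :* i′) :* ((N :+ D) :* i :+ :1) :+ (N :* i) :* ((N′
            :+ D′) :* i′ :+ :1)) refl

    sum-z+1 : conj z + z + 1# ≡ (i * conj i) * (N * N′ + D * D′)
    sum-z+1 = trans (cong (_+ 1#) sum-z) (lc₂ (c N D N′ D′ i (conj i)) inv conj-inv)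
      where
      c = solve 6 (λ N D N′ D′ i i′ →
        (i :* i′) :* (N :* D′ :+ D :* N′) :+ :1 := (i :* i′) :* (N :* N′ :+ D :* D′) :+ ((N′ :+ D′) :* i′) :* ((N :+ D) :* i
            :+ :1) :+ :1 :* ((N′ :+ D′) :* i′ :+ :1)) refl

    -- The three cases are z^q = z, z^q = z + 1 and z^q ∉ {z, z + 1}.

    data Position : Fin 4 → Set where
      meeting  : N * D′ ≡ D * N′ → Position (suc zero)
      tangent  : N * D′ ≢ D * N′ → N * N′ ≡ D * D′ → Position (suc (suc zero))
      generic  : N * D′ ≢ D * N′ → N * N′ ≢ D * D′ → Position (suc (suc (suc zero)))

    position : ∃[ j ] Position j
    position with (N * D′) ≟ (D * N′) | (N * N′) ≟ (D * D′)
    ... | yes p | _ = _ , meeting p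
    ... | no p | yes r = _ , tangent p r
    ... | no p | no r = _ , generic p r

    Position⇒RE : ∀ {j} → Position j → RE j (t , t∉K) (s , s∉K)
    Position⇒RE pos = cases pos
      where
      ¬same : ¬ sameE (t , t∉K) (s , s∉K)
      ¬same (inj₁ e) = s≢t (sym e)
      ¬same (inj₂ e) = s≢t̄ (trans (sym (bar-bar s)) (cong bar (sym e)))
      conj-ρ̂ : conj (z * z + z) ≡ conj z * conj z + conj z
      conj-ρ̂ = trans (C.+-homo _ _) (cong (_+ conj z) (C.*-homo _ _))
      ρ̂+conj : conj (z * z + z) + (z * z + z) ≡ (conj z + z) * (conj z + z + 1#)
      ρ̂+conj = trans (cong (_+ (z * z + z)) conj-ρ̂) (c z (conj z))
        where
        c = solve 2 (λ z z′ → z′ :* z′ :+ z′ :+ (z :* z :+ z) := (z′ :+ z) :* (z′ :+ z :+ :1)) refl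
      zero-scaled : ∀ {x y} → x ≡ (i * conj i) * y → y ≡ 0# → x ≡ 0#
      zero-scaled e refl = trans e (zeroʳ _)
      unscaled : ∀ {x y} → x ≡ (i * conj i) * y → x ≡ 0# → y ≡ 0#
      unscaled e refl = integral i≢0 (sym e)
      cases : ∀ {j} → Position j → RE j (t , t∉K) (s , s∉K)
      cases (meeting p) = ¬same , subst S₀* (sym ρ̂≡) ((≡0-+ (trans ρ̂+conj (*≡0ˡ z′+z≡0)) , trans (Tr₁-℘ z) z′+z≡0) ,
          z²+z≢0)
        where
        z′+z≡0 : conj z + z ≡ 0#
        z′+z≡0 = zero-scaled sum-z (+-≡0 p)
        -- The value is N D / Δ², and neither N nor D vanishes since s is neither t nor t̄.
        z²+z≢0 : z * z + z ≢ 0#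
        z²+z≢0 e = *-≢0 (*-≢0 N≢0 D≢0) (*-≢0 (⁻¹-≢0 Δ≢0) (⁻¹-≢0 Δ≢0)) (trans (lc₁ (c N D i) inv) e)
          where
          c = solve 3 (λ N D i → N :* D :* (i :* i) := N :* i :* (N :* i) :+ N :* i :+ (N :* i) :* ((N :+ D) :* i
              :+ :1)) refl
      cases (tangent p r) = ¬same , subst S₁ (sym ρ̂≡) (≡0-+ (trans ρ̂+conj (*≡0ʳ z′+z+1≡0)) ,
        λ e → p (≡0-+ (unscaled sum-z (trans (sym (Tr₁-℘ z)) e))))
        where
        z′+z+1≡0 : conj z + z + 1# ≡ 0#
        z′+z+1≡0 = zero-scaled sum-z+1 (+-≡0 r)
      cases (generic p r) = ¬same , subst T₀ (sym ρ̂≡) (inK-+ (inK-* z∈K z∈K) z∈K , trans (Tr₂-℘ z) (+-≡0 z∈K)) ,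
        subst (λ x → ¬ inFq x) (sym ρ̂≡) (λ e → impossible (zero-product (trans (sym ρ̂+conj) (+-≡0 e))))
        where
        impossible : ¬ (conj z + z ≡ 0# ⊎ conj z + z + 1# ≡ 0#)
        impossible (inj₁ e) = p (≡0-+ (unscaled sum-z e))
        impossible (inj₂ e) = r (≡0-+ (unscaled sum-z+1 e))

  RE-exclusive : ∀ i j s t → RE i s t → RE j s t → i ≡ j
  RE-exclusive zero zero s t _ _ = refl
  RE-exclusive zero (suc zero) s t p (np , _) = contradiction p np
  RE-exclusive zero (suc (suc zero)) s t p (np , _) = contradiction p np
  RE-exclusive zero (suc (suc (suc zero))) s t p (np , _) = contradiction p np
  RE-exclusive (suc zero) zero s t (np , _) p = contradiction p np
  RE-exclusive (suc (suc zero)) zero s t (np , _) p = contradiction p np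
  RE-exclusive (suc (suc (suc zero))) zero s t (np , _) p = contradiction p np
  RE-exclusive (suc zero) (suc zero) s t _ _ = refl
  RE-exclusive (suc zero) (suc (suc zero)) s t (_ , (_ , p) , _) (_ , _ , np) = contradiction p np
  RE-exclusive (suc zero) (suc (suc (suc zero))) s t (_ , (p , _) , _) (_ , _ , np) = contradiction p np
  RE-exclusive (suc (suc zero)) (suc zero) s t (_ , _ , np) (_ , (_ , p) , _) = contradiction p np
  RE-exclusive (suc (suc (suc zero))) (suc zero) s t (_ , _ , np) (_ , (p , _) , _) = contradiction p np
  RE-exclusive (suc (suc zero)) (suc (suc zero)) s t _ _ = refl
  RE-exclusive (suc (suc zero)) (suc (suc (suc zero))) s t (_ , p , _) (_ , _ , np) = contradiction p np
  RE-exclusive (suc (suc (suc zero))) (suc (suc zero)) s t (_ , _ , np) (_ , p , _) = contradiction p np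
  RE-exclusive (suc (suc (suc zero))) (suc (suc (suc zero))) s t _ _ = refl

-- Hermitian forms in two variables and their zeros

-- The Hermitian form on F over K whose value at k is the trace to F_q of k f(k) E.

module HermitianForm {h : ℕ} (F : FiniteFieldQ4 h) {f : FiniteFieldQ4.Carrier F → FiniteFieldQ4.Carrier F} (tw : Vectors.Twist F f)
  (E : FiniteFieldQ4.Carrier F) where
  open Geometry F
  open FieldTheory F
  open Vectors F
  open Twist tw
  open Lines F tw using (f-+; f-*; f-1; f-0; f-≢0; f-⁻¹; bar-f; f-f-bar)
  open Endo endo using (norm≡0)
  private
    module B = Endo bar-endo

  form : Carrier → Carrier → Carrier
  form k m = k * f m * E + bar k * f m * f E + bar k * f (bar m) * bar E + k * f (bar m) * f (bar E)

  f-form : ∀ k m → f (form k m) ≡ form m k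
  f-form k m = trans (trans (f-+ _ _) (cong₂ _+_ (trans (f-+ _ _) (cong₂ _+_ (trans (f-+ _ _) (cong₂ _+_
      (f-*₃ refl (f² m) refl) (f-*₃ refl (f² m) (f² E)))) (f-*₃ refl (f-f-bar m) refl))) (f-*₃ refl (f-f-bar m)
          (f-f-bar E))))
    (c (f k) (f (bar k)) m (bar m) E (f E) (bar E) (f (bar E)))
    where
    f-*₃ : ∀ {x y z x′ y′ z′} → f x ≡ x′ → f y ≡ y′ → f z ≡ z′ → f (x * y * z) ≡ x′ * y′ * z′
    f-*₃ refl refl refl = trans (f-* _ _) (cong (_* _) (f-* _ _))
    c = solve 8 (λ k₁ k₃ m m₂ E E₁ E₂ E₃ →
      k₁ :* m₂ :* E₁ :+ k₃ :* m₂ :* E₂ :+ k₃ :* m :* E₃ :+ k₁ :* m :* E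
      := m :* k₁ :* E :+ m₂ :* k₁ :* E₁ :+ m₂ :* k₃ :* E₂ :+ m :* k₃ :* E₃) refl

  form-K : ∀ k m → inK (form k m)
  form-K k m = trans (sym (f² _)) (trans (cong f (f-form k m)) (f-form m k))

  form-Fq : ∀ k → inFq (form k k)
  form-Fq k = trans (sym (f-K (form-K k k))) (f-form k k)

  form-lin : ∀ x y k m → inK x → inK y → form (x * k + y * m) (x * k + y * m)
    ≡ x * f x * form k k + x * f y * form k m + y * f x * form m k + y * f y * form m m
  form-lin x y k m x∈ y∈ =
    trans (cong₂ (λ u v → w * f w * E + u * f w * f E + u * v * bar E + w * v * f (bar E)) w̄ (trans (cong f w̄) (fw (bar k)
        (bar m))))
      (trans (cong (λ v → w * v * E + (x * bar k + y * bar m) * v * f E + (x * bar k + y * bar m) * (f x * f (bar k)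
          + f y * f (bar m)) * bar E
          + w * (f x * f (bar k) + f y * f (bar m)) * f (bar E)) (fw k m))
        (c x y (f x) (f y) k (f k) (bar k) (f (bar k)) m (f m) (bar m) (f (bar m)) E (f E) (bar E) (f (bar E))))
    where
    w : Carrier
    w = x * k + y * m
    w̄ : bar w ≡ x * bar k + y * bar m
    w̄ = trans (B.+-homo _ _) (cong₂ _+_ (trans (B.*-homo _ _) (cong (_* bar k) x∈)) (trans (B.*-homo _ _) (cong
        (_* bar m) y∈)))
    fw : ∀ k m → f (x * k + y * m) ≡ f x * f k + f y * f m
    fw k m = trans (f-+ _ _) (cong₂ _+_ (f-* _ _) (f-* _ _))
    c = solve 16 (λ x y x′ y′ k k₁ k₂ k₃ m m₁ m₂ m₃ E E₁ E₂ E₃ →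
      (x :* k :+ y :* m) :* (x′ :* k₁ :+ y′ :* m₁) :* E :+ (x :* k₂ :+ y :* m₂) :* (x′ :* k₁ :+ y′ :* m₁) :* E₁
      :+ (x :* k₂ :+ y :* m₂) :* (x′ :* k₃ :+ y′ :* m₃) :* E₂ :+ (x :* k :+ y :* m) :* (x′ :* k₃ :+ y′ :* m₃) :* E₃
      := x :* x′ :* (k :* k₁ :* E :+ k₂ :* k₁ :* E₁ :+ k₂ :* k₃ :* E₂ :+ k :* k₃ :* E₃)
      :+ x :* y′ :* (k :* m₁ :* E :+ k₂ :* m₁ :* E₁ :+ k₂ :* m₃ :* E₂ :+ k :* m₃ :* E₃)
      :+ y :* x′ :* (m :* k₁ :* E :+ m₂ :* k₁ :* E₁ :+ m₂ :* k₃ :* E₂ :+ m :* k₃ :* E₃)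
      :+ y :* y′ :* (m :* m₁ :* E :+ m₂ :* m₁ :* E₁ :+ m₂ :* m₃ :* E₂ :+ m :* m₃ :* E₃)) refl

  disc : Carrier
  disc = E * bar E + f E * f (bar E)

  area : Carrier → Carrier → Carrier
  area k m = k * bar m + bar k * m

  -- A change of basis multiplies the Gram determinant by the norm of the determinant `area`, so
  -- `disc` alone decides whether the form is degenerate.
  gram-det : ∀ k m → form k k * form m m + form k m * form m k ≡ area k m * f (area k m) * disc
  gram-det k m = trans (c k (f k) (bar k) (f (bar k)) m (f m) (bar m) (f (bar m)) E (f E) (bar E) (f (bar E)))
    (cong (λ z → area k m * z * disc) (sym (trans (f-+ _ _) (cong₂ _+_ (f-* _ _) (f-* _ _)))))
    where
    c = solve 12 (λ k k₁ k₂ k₃ m m₁ m₂ m₃ E E₁ E₂ E₃ →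
      (k :* k₁ :* E :+ k₂ :* k₁ :* E₁ :+ k₂ :* k₃ :* E₂ :+ k :* k₃ :* E₃) :* (m :* m₁ :* E :+ m₂ :* m₁ :* E₁
          :+ m₂ :* m₃ :* E₂ :+ m :* m₃ :* E₃)
      :+ (k :* m₁ :* E :+ k₂ :* m₁ :* E₁ :+ k₂ :* m₃ :* E₂ :+ k :* m₃ :* E₃) :* (m :* k₁ :* E :+ m₂ :* k₁ :* E₁
          :+ m₂ :* k₃ :* E₂ :+ m :* k₃ :* E₃)
      := (k :* m₂ :+ k₂ :* m) :* (k₁ :* m₃ :+ k₃ :* m₁) :* (E :* E₂ :+ E₁ :* E₃)) refl

  -- The four values are linear in E and its conjugates, and the matrix of this system is a
  -- Kronecker product of two invertible 2 × 2 matrices; the multipliers are entries of its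
  -- adjugate. So a nonzero E gives a nonzero form.
  form≡0⇒E≡0 : ∀ k m → area k m ≢ 0# → form k k ≡ 0# → form k m ≡ 0# → form m k ≡ 0# → form m m ≡ 0# → E ≡ 0#
  form≡0⇒E≡0 k m a≢0 p₁ p₂ p₃ p₄ = *-cancelˡ (*-≢0 a≢0 (f-≢0 a≢0)) (trans (trans
      (cong (λ z → area k m * z * E) (trans (f-+ _ _) (cong₂ _+_ (f-* _ _) (f-* _ _))))
      (lc₄ (c k (f k) (bar k) (f (bar k)) m (f m) (bar m) (f (bar m)) E (f E) (bar E) (f (bar E))) p₁ p₂ p₃ p₄)) (sym
          (zeroʳ _)))
    where
    c = solve 12 (λ k k₁ k₂ k₃ m m₁ m₂ m₃ E E₁ E₂ E₃ →
      (k :* m₂ :+ k₂ :* m) :* (k₁ :* m₃ :+ k₃ :* m₁) :* E := :0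
      :+ (m₂ :* m₃) :* (k :* k₁ :* E :+ k₂ :* k₁ :* E₁ :+ k₂ :* k₃ :* E₂ :+ k :* k₃ :* E₃ :+ :0)
      :+ (m₂ :* k₃) :* (k :* m₁ :* E :+ k₂ :* m₁ :* E₁ :+ k₂ :* m₃ :* E₂ :+ k :* m₃ :* E₃ :+ :0)
      :+ (k₂ :* m₃) :* (m :* k₁ :* E :+ m₂ :* k₁ :* E₁ :+ m₂ :* k₃ :* E₂ :+ m :* k₃ :* E₃ :+ :0)
      :+ (k₂ :* k₃) :* (m :* m₁ :* E :+ m₂ :* m₁ :* E₁ :+ m₂ :* m₃ :* E₂ :+ m :* m₃ :* E₃ :+ :0)) refl

  -- n representatives of the points of F*/K* at which the form vanishes.

  record Zeros (n : ℕ) : Set where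
    field
      zs   : Fin n → Carrier
      zs≢0 : ∀ i → zs i ≢ 0#
      zs∈  : ∀ i → form (zs i) (zs i) ≡ 0#
      zs-inj : ∀ i j c → inK c → zs i ≡ c * zs j → i ≡ j
      zs-surj : ∀ k → k ≢ 0# → form k k ≡ 0# → ∃[ i ] ∃[ c ] (inK c × k ≡ c * zs i)

  module Count (1≤h : 1 ℕ.≤ h) (E≢0 : E ≢ 0#) {t : Carrier} (t∉K : ¬ inK t) where
    open Conjugates t∉K

    t≢0 : t ≢ 0#
    t≢0 refl = t∉K inK-0

    x+t≢0 : ∀ {x} → inK x → x + t ≢ 0#
    x+t≢0 x∈ e = t∉K (subst inK (≡0-+ e) x∈)

    -- After multiplication by α the form at x + t becomes (α x + β′)(α x^q + β) + α γ + β β′. It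
    -- vanishes if α x + β′ is an element ε of `F_q` with ε² = α γ + β β′, since the norm of such an
    -- ε is ε²; the square root exists in `F_q` because squaring is bijective.
    isotropic : ∃[ κ ] (κ ≢ 0# × form κ κ ≡ 0#)
    isotropic with form 1# 1# ≟ 0#
    ... | yes e = 1# , 1≢0 , e
    ... | no α≢0 = x + t , x+t≢0 x∈ , *-cancelˡ α≢0 (trans (trans (cong (α *_) value)
            (lc₄ (c x (f x) α β β′ γ ε (α ⁻¹)) αx αx′ (√-square 1≤h _) refl)) (sym (zeroʳ α)))
      where
      α β β′ γ ε x : Carrier
      α = form 1# 1#
      β = form 1# t
      β′ = form t 1#
      γ = form t t
      ε = √ (α * γ + β * β′)
      x = (β′ + ε) * α ⁻¹
      inv : α * α ⁻¹ ≡ 1#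
      inv = ⁻¹-inverse α α≢0
      ε∈ : inFq ε
      ε∈ = trans (conj-√ _) (cong √ (inFq-+ (inFq-* (form-Fq 1#) (form-Fq t)) ββ′∈))
        where
        ββ′∈ : inFq (β * β′)
        ββ′∈ = trans (sym (f-K (inK-* (form-K 1# t) (form-K t 1#)))) (trans (f-* _ _) (trans (cong₂ _*_ (f-form 1# t)
            (f-form t 1#)) (*-comm _ _)))
      x∈ : inK x
      x∈ = inK-* (inK-+ (form-K t 1#) (inFq⇒inK ε∈)) (inK-⁻¹ α≢0 (form-K 1# 1#))
      αx : α * x ≡ β′ + ε
      αx = lc₁ (e α (β′ + ε) (α ⁻¹)) inv
        where
        e = solve 3 (λ α y i → α :* (y :* i) := y :+ y :* (α :* i :+ :1)) refl
      αx′ : α * f x ≡ β + ε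
      αx′ = trans (cong (_* f x) (sym (f-form 1# 1#))) (trans (sym (f-* α x)) (trans (cong f αx)
        (trans (f-+ _ _) (cong₂ _+_ (f-form t 1#) (trans (f-K (inFq⇒inK ε∈)) ε∈)))))
      value : form (x + t) (x + t) ≡ x * f x * α + x * 1# * β + 1# * f x * β′ + 1# * 1# * γ
      value = trans (cong (λ w → form w w) (d x t)) (trans (form-lin x 1# 1# t x∈ inK-1)
        (cong (λ u → x * f x * α + x * u * β + 1# * f x * β′ + 1# * u * γ) f-1))
        where
        d = solve 2 (λ x t → x :+ t := x :* :1 :+ :1 :* t) refl
      c = solve 8 (λ x x′ α β β′ γ ε i →
        α :* (x :* x′ :* α :+ x :* :1 :* β :+ :1 :* x′ :* β′ :+ :1 :* :1 :* γ)
        := :0 :+ (α :* x′ :+ β) :* (α :* x :+ (β′ :+ ε)) :+ ε :* (α :* x′ :+ (β :+ ε)) :+ :1 :* (ε :* ε :+ (α :* γ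
            :+ β :* β′)) :+ :0 :* (i :+ i)) refl

    -- A basis over `K` whose first vector is isotropic, which removes the term x x^q from the form.
    κ m : Carrier
    κ = proj₁ isotropic
    m = κ * t
    κ≢0 : κ ≢ 0#
    κ≢0 = proj₁ (proj₂ isotropic)
    κκ≡0 : form κ κ ≡ 0#
    κκ≡0 = proj₂ (proj₂ isotropic)

    b c : Carrier
    b = form κ m
    c = form m m

    area≢0 : area κ m ≢ 0#
    area≢0 e = *-≢0 (*-≢0 κ≢0 (B.≢0-homo κ≢0)) δ≢0 (trans (sym (trans (cong (λ z → κ * z + bar κ * m) (B.*-homo κ t)) (a κ t
        (bar κ) (bar t)))) e)
      where
      a = solve 4 (λ κ t κ̄ t̄ → κ :* (κ̄ :* t̄) :+ κ̄ :* (κ :* t) := κ :* κ̄ :* (t :+ t̄)) refl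

    b*b′ : b * f b ≡ area κ m * f (area κ m) * disc
    b*b′ = trans (cong (b *_) (f-form κ m)) (trans (sym (+-identityˡ _)) (trans (cong (_+ b * form m κ) (sym (trans (cong
        (_* c) κκ≡0) (zeroˡ c)))) (gram-det κ m)))

    value : ∀ {x y} → inK x → inK y → form (x * κ + y * m) (x * κ + y * m) ≡ x * f y * b + y * f x * f b + y * f y * c
    value {x} {y} x∈ y∈ = trans (form-lin x y κ m x∈ y∈)
      (trans (cong₂ (λ u v → x * f x * u + x * f y * b + y * f x * v + y * f y * c) κκ≡0 (sym (f-form κ m))) (e x y (f x)
          (f y) b (f b) c))
      where
      e = solve 7 (λ x y x′ y′ b b′ c →
        x :* x′ :* :0 :+ x :* y′ :* b :+ y :* x′ :* b′ :+ y :* y′ :* c := x :* y′ :* b :+ y :* x′ :* b′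
            :+ y :* y′ :* c) refl

    resolve : ∀ k → ∃[ x ] ∃[ y ] (inK x × inK y × k ≡ x * κ + y * m)
    resolve k = scale (coordinates (bar-bar (κ ⁻¹ * k)))
      where
      e = solve 4 (λ κ x y t → κ :* (x :+ y :* t) := x :* κ :+ y :* (κ :* t)) refl
      scale : ∃[ x ] ∃[ y ] (inK x × inK y × κ ⁻¹ * k ≡ x + y * t) → ∃[ x ] ∃[ y ] (inK x × inK y × k ≡ x * κ + y * m)
      scale (x , y , x∈ , y∈ , p) = x , y , x∈ , y∈ , trans (sym (trans (sym (*-assoc _ _ _)) (trans (cong (_* k)
          (⁻¹-inverse κ κ≢0)) (*-identityˡ k))))
        (trans (cong (κ *_) p) (e κ x y t))

    unique : ∀ {x y x′ y′} → inK x → inK y → inK x′ → inK y′ → x * κ + y * m ≡ x′ * κ + y′ * m → x ≡ x′ × y ≡ y′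
    unique {x} {y} {x′} {y′} x∈ y∈ x′∈ y′∈ p = coordinates-unique x∈ y∈ x′∈ y′∈ (*-cancelˡ κ≢0 (trans (e κ x y t) (trans p
        (sym (e κ x′ y′ t)))))
      where
      e = solve 4 (λ κ x y t → κ :* (x :+ y :* t) := x :* κ :+ y :* (κ :* t)) refl

    -- By the Gram determinant b vanishes, and then c cannot, the form being nonzero. What remains
    -- is c y y^q, which forces y = 0.
    zeros-degenerate : disc ≡ 0# → Zeros 1
    zeros-degenerate d≡0 = record
      { zs = λ _ → κ ; zs≢0 = λ _ → κ≢0 ; zs∈ = λ _ → κκ≡0
      ; zs-inj = λ { zero zero _ _ _ → refl }
      ; zs-surj = λ k _ kk≡0 → zero , only k kk≡0 (resolve k) }
      where
      bb′≡0 : b * f b ≡ 0#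
      bb′≡0 = trans b*b′ (*≡0ʳ d≡0)
      b≡0 : b ≡ 0#
      b≡0 = norm≡0 bb′≡0
      b′≡0 : f b ≡ 0#
      b′≡0 = trans (cong f b≡0) f-0
      c≢0 : c ≢ 0#
      c≢0 c≡0 = E≢0 (form≡0⇒E≡0 κ m area≢0 κκ≡0 b≡0 (trans (sym (f-form κ m)) b′≡0) c≡0)
      only : ∀ k → form k k ≡ 0# → ∃[ x ] ∃[ y ] (inK x × inK y × k ≡ x * κ + y * m) → ∃[ e ] (inK e × k ≡ e * κ)
      only k kk≡0 (x , y , x∈ , y∈ , k≡) = x , x∈ , trans k≡ (trans (cong (λ z → x * κ + z * m) y≡0) (e x κ m))
        where
        e = solve 3 (λ x κ m → x :* κ :+ :0 :* m := x :* κ) refl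
        d = solve 5 (λ x y x′ y′ c → x :* y′ :* :0 :+ y :* x′ :* :0 :+ y :* y′ :* c := c :* (y :* y′)) refl
        yy′≡0 : y * f y ≡ 0#
        yy′≡0 = integral c≢0 (trans (sym (trans (cong₂ (λ u v → x * f y * u + y * f x * v + y * f y * c) b≡0 b′≡0) (d x y
            (f x) (f y) c)))
          (trans (sym (value x∈ y∈)) (trans (cong (λ z → form z z) (sym k≡)) kk≡0)))
        y≡0 : y ≡ 0#
        y≡0 = norm≡0 yy′≡0

    -- Besides κ, the zeros are the x κ + m with x b + f (x b) = c, that is x b = c η + λ with λ ∈ F_q.

    module NonDegenerate {θ : Carrier} (θ∈K : inK θ) (θ∉Fq : ¬ inFq θ) (disc≢0 : disc ≢ 0#) where

      θ+fθ≢0 : θ + f θ ≢ 0#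
      θ+fθ≢0 e = θ∉Fq (trans (sym (f-K θ∈K)) (sym (≡0-+ e)))

      η : Carrier
      η = θ * (θ + f θ) ⁻¹

      fθ∈K : inK (f θ)
      fθ∈K = trans (bar-f θ) (cong f θ∈K)

      η∈K : inK η
      η∈K = inK-* θ∈K (inK-⁻¹ θ+fθ≢0 (inK-+ θ∈K fθ∈K))

      η+fη : η + f η ≡ 1#
      η+fη = trans (cong (η +_) (trans (f-* _ _) (cong (f θ *_) (trans (f-⁻¹ θ+fθ≢0) (cong _⁻¹ (trans (f-+ _ _) (trans (cong
          (f θ +_) (trans (f² θ) θ∈K)) (+-comm _ _))))))))
        (trans (e θ (f θ) ((θ + f θ) ⁻¹)) (⁻¹-inverse _ θ+fθ≢0))
        where
        e = solve 3 (λ θ θ′ i → θ :* i :+ θ′ :* i := (θ :+ θ′) :* i) refl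

      b≢0 : b ≢ 0#
      b≢0 e = *-≢0 (*-≢0 area≢0 (f-≢0 area≢0)) disc≢0 (trans (sym b*b′) (trans (cong (_* f b) e) (zeroˡ _)))

      fc : f c ≡ c
      fc = f-form m m

      inv : b * b ⁻¹ ≡ 1#
      inv = ⁻¹-inverse b b≢0

      x-of : Carrier → Carrier
      x-of l = (c * η + l) * b ⁻¹

      b*x-of : ∀ l → b * x-of l ≡ c * η + l
      b*x-of l = lc₁ (e b (c * η + l) (b ⁻¹)) inv
        where
        e = solve 3 (λ b y i → b :* (y :* i) := y :+ y :* (b :* i :+ :1)) refl

      x-of-K : ∀ {l} → inFq l → inK (x-of l)
      x-of-K l∈ = inK-* (inK-+ (inK-* (form-K m m) η∈K) (inFq⇒inK l∈)) (inK-⁻¹ b≢0 (form-K κ m))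

      point : Carrier → Carrier
      point x = x * κ + 1# * m

      point-zero : ∀ {l} → inFq l → form (point (x-of l)) (point (x-of l)) ≡ 0#
      point-zero {l} l∈ = trans (value (x-of-K l∈) inK-1) (trans (cong (λ u → x * u * b + 1# * f x * f b + 1# * u * c) f-1)
        (lc₃ (e x (f x) b (f b) c η (f η) l) (b*x-of l) fbx η+fη))
        where
        x : Carrier
        x = x-of l
        fbx : f b * f x ≡ c * f η + l
        fbx = trans (sym (f-* _ _)) (trans (cong f (b*x-of l)) (trans (f-+ _ _) (cong₂ _+_ (trans (f-* _ _) (cong
            (_* f η) fc)) (trans (f-K (inFq⇒inK l∈)) l∈))))
        e = solve 8 (λ x x′ b b′ c η η′ l →
          x :* :1 :* b :+ :1 :* x′ :* b′ :+ :1 :* :1 :* c :=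
          :0 :+ :1 :* (b :* x :+ (c :* η :+ l)) :+ :1 :* (b′ :* x′ :+ (c :* η′ :+ l)) :+ c :* (η :+ η′ :+ :1)) refl

      point≢0 : ∀ {x} → inK x → point x ≢ 0#
      point≢0 {x} x∈ e = 1≢0 (proj₂ (unique x∈ inK-1 inK-0 inK-0 (trans e (d κ m))))
        where
        d = solve 2 (λ κ m → :0 := :0 :* κ :+ :0 :* m) refl

      κ-form : ∀ x → x * κ ≡ x * κ + 0# * m
      κ-form x = d x κ m
        where
        d = solve 3 (λ x κ m → x :* κ := x :* κ :+ :0 :* m) refl

      scaled : ∀ e x → e * point x ≡ (e * x) * κ + e * m
      scaled e x = d e x κ m
        where
        d = solve 4 (λ e x κ m → e :* (x :* κ :+ :1 :* m) := (e :* x) :* κ :+ e :* m) refl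

      zeros-nondegenerate : HasCard _≡_ inFq q → Zeros (q ℕ.+ 1)
      zeros-nondegenerate (ls , ls∈ , ls-inj , ls-surj) = record
        { zs = zs′ ∘ Fin.splitAt q
        ; zs≢0 = λ i → nz (Fin.splitAt q i)
        ; zs∈ = λ i → vanish (Fin.splitAt q i)
        ; zs-inj = λ i j e e∈ p → trans (sym (Finₚ.join-splitAt q 1 i)) (trans (cong (Fin.join q 1) (inj (Fin.splitAt q i)
            (Fin.splitAt q j) e e∈ p)) (Finₚ.join-splitAt q 1 j))
        ; zs-surj = λ k k≢0 kk≡0 → surj k k≢0 kk≡0 (resolve k) }
        where
        zs′ : Fin q ⊎ Fin 1 → Carrier
        zs′ (inj₁ i) = point (x-of (ls i))
        -- The point at infinity of the chart x ↦ x κ + m accounts for the summand 1 in q + 1.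
        zs′ (inj₂ _) = κ
        nz : ∀ i → zs′ i ≢ 0#
        nz (inj₁ i) = point≢0 (x-of-K (ls∈ i))
        nz (inj₂ _) = κ≢0
        vanish : ∀ i → form (zs′ i) (zs′ i) ≡ 0#
        vanish (inj₁ i) = point-zero (ls∈ i)
        vanish (inj₂ _) = κκ≡0
        inj : ∀ i j e → inK e → zs′ i ≡ e * zs′ j → i ≡ j
        inj (inj₁ i) (inj₁ j) e e∈ p = cong inj₁ (ls-inj i j l≡)
          where
          xy : x-of (ls i) ≡ e * x-of (ls j) × 1# ≡ e
          xy = unique (x-of-K (ls∈ i)) inK-1 (inK-* e∈ (x-of-K (ls∈ j))) e∈ (trans p (scaled e _))
          x≡ : x-of (ls i) ≡ x-of (ls j)
          x≡ = trans (proj₁ xy) (trans (cong (_* x-of (ls j)) (sym (proj₂ xy))) (*-identityˡ _))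
          d = solve 3 (λ u l l′ → l :+ l′ := u :+ l :+ (u :+ l′)) refl
          l≡ : ls i ≡ ls j
          l≡ = ≡0-+ (trans (d (c * η) _ _) (+-≡0 (trans (sym (b*x-of (ls i))) (trans (cong (b *_) x≡) (b*x-of (ls j))))))
        inj (inj₁ i) (inj₂ zero) e e∈ p = contradiction (proj₂ (unique (x-of-K (ls∈ i)) inK-1 e∈ inK-0 (trans p
            (κ-form e)))) 1≢0
        inj (inj₂ zero) (inj₁ j) e e∈ p = contradiction
          (trans (trans (proj₁ xy) (cong (_* x-of (ls j)) (sym (proj₂ xy)))) (zeroˡ _)) 1≢0
          where
          xy : 1# ≡ e * x-of (ls j) × 0# ≡ e
          xy = unique inK-1 inK-0 (inK-* e∈ (x-of-K (ls∈ j))) e∈ (trans (sym (κ-form 1#)) (trans (*-identityˡ κ) (trans p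
              (scaled e _))))
        inj (inj₂ zero) (inj₂ zero) _ _ _ = refl
        surj : ∀ k → k ≢ 0# → form k k ≡ 0# → ∃[ x ] ∃[ y ] (inK x × inK y × k ≡ x * κ + y * m) → ∃[ i ] ∃[ e ] (inK e × k
            ≡ e * zs′ (Fin.splitAt q i))
        surj k k≢0 kk≡0 (x , y , x∈ , y∈ , k≡) = cases (y ≟ 0#)
          where
          at : ∀ i → (∃[ e ] (inK e × k ≡ e * zs′ i)) → ∃[ i ] ∃[ e ] (inK e × k ≡ e * zs′ (Fin.splitAt q i))
          at i (e , e∈ , p) = Fin.join q 1 i , e , e∈ , trans p (cong (λ z → e * zs′ z) (sym (Finₚ.splitAt-join q 1 i)))
          cases : Dec (y ≡ 0#) → ∃[ i ] ∃[ e ] (inK e × k ≡ e * zs′ (Fin.splitAt q i))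
          cases (yes y≡0) = at (inj₂ zero) (x , x∈ , trans k≡ (trans (cong (λ z → x * κ + z * m) y≡0) (sym (κ-form x))))
          cases (no y≢0) = at (inj₁ (proj₁ (ls-surj l l∈))) (y , y∈ , trans k≡y*point (cong (λ z → y * point z) u≡))
            where
            u l : Carrier
            u = x * y ⁻¹
            u∈ : inK u
            u∈ = inK-* x∈ (inK-⁻¹ y≢0 y∈)
            l = u * b + c * η
            yu≡x : y * u ≡ x
            yu≡x = lc₁ (d y x (y ⁻¹)) (⁻¹-inverse y y≢0)
              where
              d = solve 3 (λ y x i → y :* (x :* i) := x :+ x :* (y :* i :+ :1)) refl
            k≡y*point : k ≡ y * point u
            k≡y*point = trans k≡ (trans (cong (λ z → z * κ + y * m) (sym yu≡x)) (sym (scaled y u)))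
            eqn : u * b + f u * f b + c ≡ 0#
            eqn = *-cancelˡ (*-≢0 y≢0 (f-≢0 y≢0)) (trans (trans (d y (f y) u (f u) b (f b) c)
              (trans (cong₂ (λ z w → z * f y * b + y * w * f b + y * f y * c) yu≡x (trans (sym (f-* y u)) (cong f yu≡x)))
                (trans (sym (value x∈ y∈)) (trans (cong (λ z → form z z) (sym k≡)) kk≡0)))) (sym (zeroʳ _)))
              where
              d = solve 7 (λ y y′ u u′ b b′ c → y :* y′ :* (u :* b :+ u′ :* b′ :+ c) := y :* u :* y′ :* b :+ y :*
                  (y′ :* u′) :* b′ :+ y :* y′ :* c) refl
            l∈ : inFq l
            l∈ = trans (sym (f-K (inK-+ (inK-* u∈ (form-K κ m)) (inK-* (form-K m m) η∈K)))) (trans fl (lc₂ (d u (f u) b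
                (f b) c η (f η)) eqn η+fη))
              where
              fl : f l ≡ f u * f b + c * f η
              fl = trans (f-+ _ _) (cong₂ _+_ (f-* _ _) (trans (f-* _ _) (cong (_* f η) fc)))
              d = solve 7 (λ u u′ b b′ c η η′ →
                u′ :* b′ :+ c :* η′ := u :* b :+ c :* η :+ :1 :* (u :* b :+ u′ :* b′ :+ c :+ :0) :+ c :* (η :+ η′
                    :+ :1)) refl
            bu≡ : b * u ≡ c * η + l
            bu≡ = d u b c η
              where
              d = solve 4 (λ u b c η → b :* u := c :* η :+ (u :* b :+ c :* η)) refl
            u≡ : u ≡ x-of (ls (proj₁ (ls-surj l l∈)))
            u≡ = *-cancelˡ b≢0 (trans bu≡ (trans (cong (c * η +_) (proj₂ (ls-surj l l∈))) (sym (b*x-of _))))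

-- The relations on lines of the Hermitian surface

module PenttilaWilliford {h : ℕ} (F : FiniteFieldQ4 h) where
  open Geometry F
  open FieldTheory F
  open Vectors F
  private
    module C = Endo conj-endo

  herm-lin : ∀ a b c d u v w x → herm ((a · u) +V (b · v)) ((c · w) +V (d · x))
    ≡ a * conj c * herm u w + a * conj d * herm u x + b * conj c * herm v w + b * conj d * herm v x
  herm-lin a b c d (u₁ ∷ u₂ ∷ u₃ ∷ u₄ ∷ []) (v₁ ∷ v₂ ∷ v₃ ∷ v₄ ∷ []) (w₁ ∷ w₂ ∷ w₃ ∷ w₄ ∷ []) (x₁ ∷ x₂ ∷ x₃ ∷ x₄ ∷ []) =
    trans (cong₂ _+_ (cong₂ _+_ (cong₂ _+_ (r w₄ x₄) (r w₂ x₂)) (r w₃ x₃)) (r w₁ x₁))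
      (e a b (conj c) (conj d) u₁ u₂ u₃ u₄ v₁ v₂ v₃ v₄ (conj w₁) (conj w₂) (conj w₃) (conj w₄) (conj x₁) (conj x₂) (conj x₃)
          (conj x₄))
    where
    r : ∀ {y} w x → y * conj (c * w + d * x) ≡ y * (conj c * conj w + conj d * conj x)
    r w x = cong (_ *_) (trans (C.+-homo _ _) (cong₂ _+_ (C.*-homo _ _) (C.*-homo _ _)))
    e = solve 20 (λ a b c d u₁ u₂ u₃ u₄ v₁ v₂ v₃ v₄ w₁ w₂ w₃ w₄ x₁ x₂ x₃ x₄ →
      (a :* u₁ :+ b :* v₁) :* (c :* w₄ :+ d :* x₄) :+ (a :* u₂ :+ b :* v₂) :* (c :* w₂ :+ d :* x₂)
      :+ (a :* u₃ :+ b :* v₃) :* (c :* w₃ :+ d :* x₃) :+ (a :* u₄ :+ b :* v₄) :* (c :* w₁ :+ d :* x₁)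
      := a :* c :* (u₁ :* w₄ :+ u₂ :* w₂ :+ u₃ :* w₃ :+ u₄ :* w₁) :+ a :* d :* (u₁ :* x₄ :+ u₂ :* x₂ :+ u₃ :* x₃
          :+ u₄ :* x₁)
      :+ b :* c :* (v₁ :* w₄ :+ v₂ :* w₂ :+ v₃ :* w₃ :+ v₄ :* w₁) :+ b :* d :* (v₁ :* x₄ :+ v₂ :* x₂ :+ v₃ :* x₃
          :+ v₄ :* x₁)) refl

  -- An isotropic vector spans with its dagger a totally isotropic subspace, the bilinear form herm u (v †) being
  -- alternating.

  isotropic-† : ∀ u → Kvec u → herm u u ≡ 0# → herm u (u †) ≡ 0# × herm (u †) u ≡ 0# × herm (u †) (u †) ≡ 0#
  isotropic-† (u₁ ∷ u₂ ∷ u₃ ∷ u₄ ∷ []) p e =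
    trans (cong₂ _+_ (cong₂ _+_ (cong₂ _+_ (cong (u₁ *_) i₄) (cong (u₂ *_) i₃)) (cong (u₃ *_) i₂)) (cong (u₄ *_) i₁))
        (c₁ u₁ u₂ u₃ u₄) ,
    c₂ (conj u₁) (conj u₂) (conj u₃) (conj u₄) ,
    trans (cong₂ _+_ (cong₂ _+_ (cong₂ _+_ (cong (conj u₁ *_) i₄) (cong (conj u₃ *_) i₃)) (cong (conj u₂ *_) i₂)) (cong
        (conj u₄ *_) i₁))
      (trans (c₃ u₁ u₂ u₃ u₄ (conj u₁) (conj u₂) (conj u₃) (conj u₄)) e)
    where
    i₁ = inK⇒conj² (p zero)
    i₂ = inK⇒conj² (p (suc zero))
    i₃ = inK⇒conj² (p (suc (suc zero)))
    i₄ = inK⇒conj² (p (suc (suc (suc zero))))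
    c₁ = solve 4 (λ u₁ u₂ u₃ u₄ → u₁ :* u₄ :+ u₂ :* u₃ :+ u₃ :* u₂ :+ u₄ :* u₁ := :0) refl
    c₂ = solve 4 (λ u₁ u₂ u₃ u₄ → u₁ :* u₄ :+ u₃ :* u₂ :+ u₂ :* u₃ :+ u₄ :* u₁ := :0) refl
    c₃ = solve 8 (λ u₁ u₂ u₃ u₄ v₁ v₂ v₃ v₄ → v₁ :* u₄ :+ v₃ :* u₃ :+ v₂ :* u₂ :+ v₄ :* u₁ := u₁ :* v₄ :+ u₂ :* v₂
        :+ u₃ :* v₃ :+ u₄ :* v₁) refl

  HLine-≢0 : (l : HLine) → proj₁ (proj₁ l) ≢ zeroV × proj₂ (proj₁ l) ≢ zeroV
  HLine-≢0 ((u , v) , _ , _ , ind , _) =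
    (λ e → 1≢0 (proj₁ (ind 1# 0# inK-1 inK-0 (trans (sym (lin₁ u v)) e)))) ,
    (λ e → 1≢0 (proj₂ (ind 0# 1# inK-0 inK-1 (trans (sym (lin₂ u v)) e))))

  ≅⇒Meet : ∀ l m → l ≅ m → Meet (proj₁ l) (proj₁ m)
  ≅⇒Meet l@((u , v) , _) m e = u , proj₁ (HLine-≢0 l) , on₁ u v , proj₁ (e u) (on₁ u v)

  ≅⇒¬MeetInOnePoint : ∀ l m → l ≅ m → ¬ MeetInOnePoint l m
  ≅⇒¬MeetInOnePoint l@((u , v) , _ , _ , ind , _) m e (w , w≢0 , _ , _ , unique) =
    contra (unique u (proj₁ (HLine-≢0 l)) (on₁ u v) (proj₁ (e u) (on₁ u v))) (unique v (proj₂ (HLine-≢0 l)) (on₂ u v) (proj₁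
        (e v) (on₂ u v)))
    where
    cancel : ∀ c d w → (d · (c · w)) +V (c · (d · w)) ≡ zeroV
    cancel c d (w₁ ∷ w₂ ∷ w₃ ∷ w₄ ∷ []) = vec≡ (r c d w₁) (r c d w₂) (r c d w₃) (r c d w₄)
      where
      r = solve 3 (λ c d w → d :* (c :* w) :+ c :* (d :* w) := :0) refl
    contra : samePoint u w → samePoint v w → _
    contra (c , c∈ , c≢0 , u≡) (d , d∈ , d≢0 , v≡) =
      d≢0 (proj₁ (ind d c d∈ c∈ (trans (cong₂ (λ x y → (d · x) +V (c · y)) u≡ v≡) (cancel c d w))))

  ≅W-sym : ∀ {a b} → a ≅W b → b ≅W a
  ≅W-sym e w = swap (e w)

  ≅W-trans : ∀ {a b c} → a ≅W b → b ≅W c → a ≅W c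
  ≅W-trans e e′ w = (proj₁ (e′ w) ∘ proj₁ (e w)) , (proj₂ (e w) ∘ proj₂ (e′ w))

  one≢q+1 : ∀ {P : WLine → Set} {A : Set} → HasCard _≅W_ P 1 → HasCard _≅W_ P (q ℕ.+ 1) → A
  one≢q+1 {P} c d = contradiction (subst (ℕ._≤ 1) (ℕₚ.+-comm q 1) (HasCard-≤ {_≈_ = _≅W_} {P = P} (λ {a} {b} → ≅W-sym {a} {b}) (λ {a} {b} {c} → ≅W-trans {a} {b} {c}) d c))
    (ℕₚ.<⇒≱ (ℕ.s≤s (ℕₚ.m^n>0 2 h)))

  RH-exclusive : ∀ i j l m → RH i l m → RH j l m → i ≡ j
  RH-exclusive zero zero l m _ _ = refl
  RH-exclusive zero (suc zero) l m p r = contradiction r (≅⇒¬MeetInOnePoint l m p)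
  RH-exclusive zero (suc (suc zero)) l m p (r , _) = contradiction (≅⇒Meet l m p) r
  RH-exclusive zero (suc (suc (suc zero))) l m p (r , _) = contradiction (≅⇒Meet l m p) r
  RH-exclusive (suc zero) zero l m r p = contradiction r (≅⇒¬MeetInOnePoint l m p)
  RH-exclusive (suc (suc zero)) zero l m (r , _) p = contradiction (≅⇒Meet l m p) r
  RH-exclusive (suc (suc (suc zero))) zero l m (r , _) p = contradiction (≅⇒Meet l m p) r
  RH-exclusive (suc zero) (suc zero) l m _ _ = refl
  RH-exclusive (suc zero) (suc (suc zero)) l m (w , w≢0 , p , p′ , _) (r , _) = contradiction (w , w≢0 , p , p′) r
  RH-exclusive (suc zero) (suc (suc (suc zero))) l m (w , w≢0 , p , p′ , _) (r , _) = contradiction (w , w≢0 , p , p′) r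
  RH-exclusive (suc (suc zero)) (suc zero) l m (r , _) (w , w≢0 , p , p′ , _) = contradiction (w , w≢0 , p , p′) r
  RH-exclusive (suc (suc (suc zero))) (suc zero) l m (r , _) (w , w≢0 , p , p′ , _) = contradiction (w , w≢0 , p , p′) r
  RH-exclusive (suc (suc zero)) (suc (suc zero)) l m _ _ = refl
  RH-exclusive (suc (suc (suc zero))) (suc (suc (suc zero))) l m _ _ = refl
  RH-exclusive (suc (suc zero)) (suc (suc (suc zero))) l m (_ , c) (_ , d) = one≢q+1 {InSS l m} c d
  RH-exclusive (suc (suc (suc zero))) (suc (suc zero)) l m (_ , d) (_ , c) = one≢q+1 {InSS l m} c d

-- Incidence of two lines of one family

module Incidence {h : ℕ} (F : FiniteFieldQ4 h) {f : FiniteFieldQ4.Carrier F → FiniteFieldQ4.Carrier F} (tw : Vectors.Twist F f) where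
  open Geometry F
  open FieldTheory F
  open Vectors F
  open PenttilaWilliford F
  open HollmannXiang F
  open Twist tw
  open Lines F tw
  open Line using (line; points; span⇒T; span-T; L≡0⇒span; span⇒L≡0; span⇒K; T-≢0; T-injective; T,†-independent)
  private
    module B = Endo bar-endo
    module C = Endo conj-endo

  †-scale : ∀ c u → (c · u) † ≡ conj c · (u †)
  †-scale c (u₁ ∷ u₂ ∷ u₃ ∷ u₄ ∷ []) = vec≡ (C.*-homo _ _) (C.*-homo _ _) (C.*-homo _ _) (C.*-homo _ _)

  scale-on₁ : ∀ {c} u v → inK c → OnSpan (u , v) (c · u)
  scale-on₁ {c} u v c∈ = c , 0# , c∈ , inK-0 , ·-lin c u v

  scale-on₂ : ∀ {c} u v → inK c → OnSpan (u , v) (c · v)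
  scale-on₂ {c} (u₁ ∷ u₂ ∷ u₃ ∷ u₄ ∷ []) (v₁ ∷ v₂ ∷ v₃ ∷ v₄ ∷ []) c∈ = 0# , c , inK-0 , c∈ , vec≡ (e c u₁ v₁) (e c u₂ v₂)
      (e c u₃ v₃) (e c u₄ v₄)
    where
    e = solve 3 (λ c u v → c :* v := :0 :* u :+ c :* v) refl

  module WLines {t : Carrier} (t∉K : ¬ inK t) where
    open Conjugates t∉K

    plane : Carrier → V × V
    plane k = T t k , (T t k) †

    -- The dagger is semilinear and fixes `V̂` pointwise, so a line of Ŵ through `T t k` also
    -- contains its dagger; being independent, the two vectors span it.
    classify : ∀ (n : WLine) {k} → k ≢ 0# → OnSpan (proj₁ n) (T t k) →
      ∀ w → (OnSpan (proj₁ n) w → OnSpan (plane k) w) × (OnSpan (plane k) w → OnSpan (proj₁ n) w)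
    classify ((g₁ , g₂) , g₁∈ , g₂∈ , _ , _) {k} k≢0 (x , y , x∈ , y∈ , Tk≡) w =
      span-⊆ (proj₁ gs) (proj₂ gs) w ,
      span-⊆ (x , y , x∈ , y∈ , Tk≡) (conj x , conj y , inK-conj x∈ , inK-conj y∈ , †Tk≡) w
      where
      †Tk≡ : (T t k) † ≡ (conj x · g₁) +V (conj y · g₂)
      †Tk≡ = trans (cong _† Tk≡) (trans (†-lin x y g₁ g₂) (cong₂ (λ u v → (conj x · u) +V (conj y · v)) (Vhat⇒† g₁∈)
          (Vhat⇒† g₂∈)))
      combine : ∀ a b → (a · T t k) +V (b · ((T t k) †)) ≡ ((a * x + b * conj x) · g₁) +V ((a * y + b * conj y) · g₂)
      combine a b = trans (cong₂ (λ u v → (a · u) +V (b · v)) Tk≡ †Tk≡) (lin-lin a b x y (conj x) (conj y) g₁ g₂)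
      x+x = solve 2 (λ x y → x :* y :+ y :* x := :0) refl
      Δ≢0 : x * conj y + y * conj x ≢ 0#
      Δ≢0 Δ≡0 = T-≢0 t∉K k≢0 (trans Tk≡ (trans (cong₂ (λ a b → (a · g₁) +V (b · g₂)) x≡0 y≡0) (sym (lin₀ g₁ g₂))))
        where
        y≡0 : y ≡ 0#
        y≡0 = proj₂ (T,†-independent t∉K k≢0 (inK-conj y∈) (trans (combine (conj y) y)
          (trans (cong₂ (λ a b → (a · g₁) +V (b · g₂)) (trans (cong (_+ y * conj x) (*-comm _ _)) Δ≡0) (x+x (conj y) y))
              (sym (lin₀ g₁ g₂)))))
        x≡0 : x ≡ 0#
        x≡0 = proj₂ (T,†-independent t∉K k≢0 (inK-conj x∈) (trans (combine (conj x) x)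
          (trans (cong₂ (λ a b → (a · g₁) +V (b · g₂)) (x+x (conj x) x) (trans (cong (_+ x * conj y) (*-comm _ _)) (trans
              (+-comm _ _) Δ≡0))) (sym (lin₀ g₁ g₂)))))
      gs : OnSpan (plane k) g₁ × OnSpan (plane k) g₂
      gs = subst (λ p → OnSpan p g₁ × OnSpan p g₂) (sym (cong₂ _,_ Tk≡ †Tk≡))
        (span-solve g₁ g₂ x y (conj x) (conj y) x∈ y∈ (inK-conj x∈) (inK-conj y∈) Δ≢0)

    plane-scale : ∀ {c k m} → inK c → k ≡ c * m → ∀ w → OnSpan (plane k) w → OnSpan (plane m) w
    plane-scale {c} {m = m} c∈ refl = span-⊆ (subst (OnSpan (plane m)) (sym (T-scale t m c∈)) (scale-on₁ _ _ c∈))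
      (subst (OnSpan (plane m)) (sym (trans (cong _† (T-scale t m c∈)) (†-scale c (T t m)))) (scale-on₂ _ _ (inK-conj c∈)))

    plane-injective : ∀ {k m} → m ≢ 0# → OnSpan (plane m) (T t k) → ∃[ c ] (inK c × k ≡ c * m)
    plane-injective {k} {m} m≢0 (x , y , x∈ , y∈ , Tk≡) = x , x∈ , T-injective t∉K (trans Tk≡ (trans (cong (λ z →
        (x · T t m) +V (z · ((T t m) †))) y≡0)
        (trans (sym (·-lin x (T t m) ((T t m) †))) (sym (T-scale t m x∈)))))
      where
      y≡0 : y ≡ 0#
      y≡0 = *-cancelˡ (*-≢0 (f-≢0 m≢0) (*-≢0 δ≢0 (f-≢0 δ≢0))) (trans (trans (*-comm _ _) (trans (sym (cong (y *_)
          (L-†T-self t m)))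
        (trans (sym (+-identityˡ _)) (trans (cong (_+ y * L t ((T t m) †)) (sym (*≡0ʳ (L-T-self t m)))) (trans (sym
            (L-lin t x y _ _)) (trans (cong (L t) (sym Tk≡)) (L-T-self t k))))))) (sym (zeroʳ _)))

    module _ {θ : Carrier} (θ∈K : inK θ) (θ∉Fq : ¬ inFq θ) where

      -- For u = `T t k`, the vectors u + u † and θ u + θ^q u † are fixed by the dagger, hence lie
      -- in `V̂`, and they span the same plane because θ is not in `F_q`.
      basis : Carrier → V × V
      basis k = (1# · T t k) +V (1# · ((T t k) †)) , (θ · T t k) +V (conj θ · ((T t k) †))

      plane⊆basis : ∀ k w → OnSpan (plane k) w → OnSpan (basis k) w
      plane⊆basis k = span-⊆ (proj₁ both) (proj₂ both)
        where
        both : OnSpan (basis k) (T t k) × OnSpan (basis k) ((T t k) †)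
        both = span-solve (T t k) ((T t k) †) 1# 1# θ (conj θ) inK-1 inK-1 θ∈K (inK-conj θ∈K)
          (λ e → θ∉Fq (≡0-+ (trans (cong₂ _+_ (sym (*-identityˡ (conj θ))) (sym (*-identityˡ θ))) e)))

      basis⊆plane : ∀ k w → OnSpan (basis k) w → OnSpan (plane k) w
      basis⊆plane k = span-⊆ (1# , 1# , inK-1 , inK-1 , refl) (θ , conj θ , θ∈K , inK-conj θ∈K , refl)

      wline : ∀ k → k ≢ 0# → WLine
      wline k k≢0 = basis k , real inK-1 C.1-homo C.1-homo , real θ∈K refl (inK⇒conj² θ∈K) , independent , isotropic
        where
        u v : V
        u = T t k
        v = (T t k) †
        +V-comm : ∀ u v → u +V v ≡ v +V u
        +V-comm (u₁ ∷ u₂ ∷ u₃ ∷ u₄ ∷ []) (v₁ ∷ v₂ ∷ v₃ ∷ v₄ ∷ []) = vec≡ (+-comm _ _) (+-comm _ _) (+-comm _ _) (+-comm _ _)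
        real : ∀ {x y} → inK x → conj x ≡ y → conj y ≡ x → Vhat ((x · u) +V (y · v))
        real {x} {y} x∈ p r = †⇒Vhat (Kvec-lin x∈ (subst inK p (inK-conj x∈)) u v (T-K t k) (†-K u (T-K t k)))
          (trans (†-lin x y u v) (trans (+V-comm _ _) (cong₂ _+V_ (cong₂ _·_ r (†-invol u (T-K t k))) (cong (_· v) p))))
        independent : ∀ c d → inFq c → inFq d → (c · proj₁ (basis k)) +V (d · proj₂ (basis k)) ≡ zeroV → c ≡ 0# × d ≡ 0#
        independent c d c∈ d∈ e = c≡0 , d≡0
          where
          es : c * 1# + d * θ ≡ 0# × c * 1# + d * conj θ ≡ 0#
          es = T,†-independent t∉K k≢0 (inK-+ (inK-* (inFq⇒inK c∈) inK-1) (inK-* (inFq⇒inK d∈) θ∈K)) (trans (sym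
              (lin-lin c d 1# 1# θ (conj θ) u v)) e)
          r = solve 4 (λ c d θ θ′ → (θ′ :+ θ) :* d := :0 :+ :1 :* ((c :* :1 :+ d :* θ) :+ :0) :+ :1 :* ((c :* :1 :+ d :* θ′)
              :+ :0)) refl
          d≡0 : d ≡ 0#
          d≡0 = *-cancelˡ (+-≢0 θ∉Fq) (trans (lc₂ (r c d θ (conj θ)) (proj₁ es) (proj₂ es)) (sym (zeroʳ _)))
          c≡0 : c ≡ 0#
          c≡0 = trans (sym (trans (cong (λ z → c * 1# + z * θ) d≡0) (r′ c θ))) (proj₁ es)
            where
            r′ = solve 2 (λ c θ → c :* :1 :+ :0 :* θ := c) refl
        isotropic : herm (proj₁ (basis k)) (proj₂ (basis k)) ≡ 0#
        isotropic = trans (herm-lin 1# 1# θ (conj θ) u v u v) (trans (cong₂ _+_ (cong₂ _+_ (cong₂ _+_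
            (*≡0ʳ (herm-T t k k)) (*≡0ʳ (proj₁ iso))) (*≡0ʳ (proj₁ (proj₂ iso)))) (*≡0ʳ (proj₂ (proj₂ iso)))) (r θ))
          where
          iso = isotropic-† u (T-K t k) (herm-T t k k)
          r = solve 1 (λ θ → :0 :+ :0 :+ :0 :+ :0 := :0) refl

    Meet⇒T : ∀ p → Meet (points t∉K) p → ∃[ k ] (k ≢ 0# × OnSpan p (T t k))
    Meet⇒T p (w , w≢0 , w∈ , w∈p) = on (span⇒T t∉K w∈)
      where
      on : ∃[ k ] (w ≡ T t k) → ∃[ k ] (k ≢ 0# × OnSpan p (T t k))
      on (k , w≡) = k , (λ k≡0 → w≢0 (trans w≡ (trans (cong (T t) k≡0) (T-0 t)))) , subst (OnSpan p) w≡ w∈p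

  module Pairs (1≤h : 1 ℕ.≤ h) {θ : Carrier} (θ∈K : inK θ) (θ∉Fq : ¬ inFq θ)
    {s t : Carrier} (s∉K : ¬ inK s) (t∉K : ¬ inK t) (s≢t : s ≢ t) (s≢t̄ : s ≢ bar t) where
    open Pair s∉K t∉K s≢t s≢t̄
    open Conjugates t∉K
    open WLines t∉K

    U U′ : Carrier → Carrier
    U k = L s (T t k)
    U′ k = L s ((T t k) †)

    fP̄ : f (bar P) ≡ f (bar s) + f (bar t)
    fP̄ = trans (cong f bar-P) (f-+ _ _)
    fR̄ : f (bar R) ≡ f (bar s) + f t
    fR̄ = trans (cong f bar-R) (f-+ _ _)

    U≡ : ∀ k → U k ≡ k * (P * f (bar R)) + bar k * (R * f (bar P))
    U≡ k = trans (L-T s t k) (sym (cong₂ (λ u v → k * (P * u) + bar k * (R * v)) fR̄ fP̄))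
    U′≡ : ∀ k → U′ k ≡ f k * (R * f (bar R)) + f (bar k) * (P * f (bar P))
    U′≡ k = trans (L-†T s t k) (sym (cong₂ (λ u v → f k * (R * u) + f (bar k) * (P * v)) fR̄ fP̄))

    bar-lin : ∀ {x y u v u′ v′} → bar u ≡ u′ → bar v ≡ v′ → bar (x * u + y * v) ≡ bar x * u′ + bar y * v′
    bar-lin refl refl = trans (B.+-homo _ _) (cong₂ _+_ (B.*-homo _ _) (B.*-homo _ _))

    bar-f-bar : ∀ x → bar (f (bar x)) ≡ f x
    bar-f-bar x = trans (bar-f (bar x)) (cong f (bar-bar x))

    Ū≡ : ∀ k → bar (U k) ≡ bar k * (bar P * f R) + k * (bar R * f P)
    Ū≡ k = trans (cong bar (U≡ k)) (trans (bar-lin (trans (B.*-homo _ _) (cong (bar P *_) (bar-f-bar R))) (trans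
        (B.*-homo _ _) (cong (bar R *_) (bar-f-bar P))))
      (cong (λ z → bar k * (bar P * f R) + z * (bar R * f P)) (bar-bar k)))
    Ū′≡ : ∀ k → bar (U′ k) ≡ f (bar k) * (bar R * f R) + f k * (bar P * f P)
    Ū′≡ k = trans (cong bar (U′≡ k)) (trans (bar-lin (trans (B.*-homo _ _) (cong (bar R *_) (bar-f-bar R))) (trans
        (B.*-homo _ _) (cong (bar P *_) (bar-f-bar P))))
      (cong₂ (λ y z → y * (bar R * f R) + z * (bar P * f P)) (bar-f k) (bar-f-bar k)))

    N′≡ : N′ ≡ f P * f (bar P)
    N′≡ = trans (sym (f-K N∈K)) (f-* _ _)
    D′≡ : D′ ≡ f R * f (bar R)
    D′≡ = trans (sym (f-K D∈K)) (f-* _ _)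

    -- U k and its conjugate are linear in k and k̄ with determinant N D′ + D N′; this is Cramer's
    -- rule for k.
    meet-cert : ∀ k → k * (N * D′ + D * N′) ≡ (bar P * f R) * U k + (R * f (bar P)) * bar (U k)
    meet-cert k = trans (cong₂ (λ u v → k * (N * u + D * v)) D′≡ N′≡) (trans (e k (bar k) P (bar P) R (bar R) (f P) (f
        (bar P)) (f R) (f (bar R)))
      (sym (cong₂ (λ u v → (bar P * f R) * u + (R * f (bar P)) * v) (U≡ k) (Ū≡ k))))
      where
      e = solve 10 (λ k k̄ P P̄ R R̄ fP fP̄ fR fR̄ →
        k :* (P :* P̄ :* (fR :* fR̄) :+ R :* R̄ :* (fP :* fP̄)) :=
        (P̄ :* fR) :* (k :* (P :* fR̄) :+ k̄ :* (R :* fP̄)) :+ (R :* fP̄) :* (k̄ :* (P̄ :* fR) :+ k :* (R̄ :* fP))) refl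

    Meet⇒U : Meet (points t∉K) (points s∉K) → ∃[ k ] (k ≢ 0# × U k ≡ 0#)
    Meet⇒U mt = on (Meet⇒T (points s∉K) mt)
      where
      on : ∃[ k ] (k ≢ 0# × OnSpan (points s∉K) (T t k)) → ∃[ k ] (k ≢ 0# × U k ≡ 0#)
      on (k , k≢0 , o) = k , k≢0 , span⇒L≡0 s∉K o

    disjoint : N * D′ ≢ D * N′ → Disjoint (line t∉K) (line s∉K)
    disjoint p mt = on (Meet⇒U mt)
      where
      on : ¬ (∃[ k ] (k ≢ 0# × U k ≡ 0#))
      on (k , k≢0 , Uk≡0) = p (≡0-+ (integral k≢0 (trans (meet-cert k)
        (trans (cong₂ _+_ (*≡0ʳ Uk≡0) (*≡0ʳ (trans (cong bar Uk≡0) inK-0))) (+-identityˡ 0#)))))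

    RfP̄≢0 : R * f (bar P) ≢ 0#
    RfP̄≢0 = *-≢0 R≢0 (f-≢0 (B.≢0-homo P≢0))

    -- The equation U k = 0 prescribes k̄ as a fixed multiple of k, so the quotient of two solutions
    -- is fixed by `bar`.
    U-proportional : ∀ {k m} → m ≢ 0# → U k ≡ 0# → U m ≡ 0# → ∃[ c ] (inK c × k ≡ c * m)
    U-proportional {k} {m} m≢0 Uk Um = c , c∈ , k≡
      where
      c : Carrier
      c = k * m ⁻¹
      km̄≡ : k * bar m + bar k * m ≡ 0#
      km̄≡ = integral RfP̄≢0 (lc₂ (e k (bar k) m (bar m) (P * f (bar R)) (R * f (bar P))) (trans (sym (U≡ k)) Uk) (trans
          (sym (U≡ m)) Um))
        where
        e = solve 6 (λ k k̄ m m̄ X Y →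
          Y :* (k :* m̄ :+ k̄ :* m) := :0 :+ m :* ((k :* X :+ k̄ :* Y) :+ :0) :+ k :* ((m :* X :+ m̄ :* Y) :+ :0)) refl
      c∈ : inK c
      c∈ = trans (B.*-homo _ _) (trans (cong (bar k *_) (B.⁻¹-homo m≢0)) (lc₃ (e k (bar k) m (bar m) (m ⁻¹) (bar m ⁻¹))
        km̄≡ (⁻¹-inverse m m≢0) (⁻¹-inverse (bar m) (B.≢0-homo m≢0))))
        where
        e = solve 6 (λ k k̄ m m̄ i j →
          k̄ :* j := k :* i :+ (i :* j) :* ((k :* m̄ :+ k̄ :* m) :+ :0) :+ (k̄ :* j) :* (m :* i :+ :1) :+ (k :* i) :*
              (m̄ :* j :+ :1)) refl
      k≡ : k ≡ c * m
      k≡ = lc₁ (e k m (m ⁻¹)) (⁻¹-inverse m m≢0)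
        where
        e = solve 3 (λ k m i → k := k :* i :* m :+ k :* (m :* i :+ :1)) refl

    meet-one : N * D′ ≡ D * N′ → MeetInOnePoint (line t∉K) (line s∉K)
    meet-one p = from existence
      where
      -- Taken from the adjugate of the system in k and k̄: `U (k-of x)` is x (N D′ + D N′), which
      -- vanishes here.
      k-of : Carrier → Carrier
      k-of x = x * (bar P * f R) + bar x * (R * f (bar P))
      U-k-of : ∀ x → U (k-of x) ≡ 0#
      U-k-of x = trans (U≡ _) (trans (cong (λ z → k-of x * (P * f (bar R)) + z * (R * f (bar P))) bar-k-of)
        (trans (e x (bar x) P (bar P) R (bar R) (f P) (f (bar P)) (f R) (f (bar R))) (*≡0ʳ (trans (sym (cong₂ (λ u v → N * u
            + D * v) D′≡ N′≡)) (+-≡0 p)))))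
        where
        bar-k-of : bar (k-of x) ≡ bar x * (P * f (bar R)) + x * (bar R * f P)
        bar-k-of = trans (bar-lin (trans (B.*-homo _ _) (cong₂ _*_ (bar-bar P) (bar-f R))) (trans (B.*-homo _ _) (cong
            (bar R *_) (bar-f-bar P))))
          (cong (λ z → bar x * (P * f (bar R)) + z * (bar R * f P)) (bar-bar x))
        e = solve 10 (λ x x̄ P P̄ R R̄ fP fP̄ fR fR̄ →
          (x :* (P̄ :* fR) :+ x̄ :* (R :* fP̄)) :* (P :* fR̄) :+ (x̄ :* (P :* fR̄) :+ x :* (R̄ :* fP)) :* (R :* fP̄)
          := x :* (P :* P̄ :* (fR :* fR̄) :+ R :* R̄ :* (fP :* fP̄))) refl
      existence : ∃[ k ] (k ≢ 0# × U k ≡ 0#)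
      existence = cases (k-of 1# ≟ 0#) (k-of t ≟ 0#)
        where
        cases : Dec (k-of 1# ≡ 0#) → Dec (k-of t ≡ 0#) → ∃[ k ] (k ≢ 0# × U k ≡ 0#)
        cases (no p) _ = _ , p , U-k-of 1#
        cases (yes _) (no p) = _ , p , U-k-of t
        -- Vanishing at both 1 and t would give (t + t̄) P̄ f(R) = 0.
        cases (yes p) (yes r) = contradiction (trans (lc₂ (e t (bar t) (bar P * f R) (R * f (bar P)))
          (trans (cong (λ z → 1# * (bar P * f R) + z * (R * f (bar P))) (sym inK-1)) p) r) refl)
            (*-≢0 δ≢0 (*-≢0 (B.≢0-homo P≢0) (f-≢0 R≢0)))
          where
          e = solve 4 (λ t t̄ X Y → (t :+ t̄) :* X := :0 :+ t̄ :* ((:1 :* X :+ :1 :* Y) :+ :0) :+ :1 :* ((t :* X :+ t̄ :* Y)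
              :+ :0)) refl
      from : ∃[ k ] (k ≢ 0# × U k ≡ 0#) → MeetInOnePoint (line t∉K) (line s∉K)
      from (m , m≢0 , Um) = T t m , T-≢0 t∉K m≢0 , span-T t∉K m , L≡0⇒span s∉K _ (T-K t m) Um , unique
        where
        unique : ∀ w → w ≢ zeroV → OnSpan (points t∉K) w → OnSpan (points s∉K) w → samePoint w (T t m)
        unique w w≢0 o o′ = on (span⇒T t∉K o)
          where
          on : ∃[ k ] (w ≡ T t k) → samePoint w (T t m)
          on (k , w≡) = scaled (U-proportional m≢0 (trans (cong (L s) (sym w≡)) (span⇒L≡0 s∉K o′)) Um)
            where
            scaled : ∃[ c ] (inK c × k ≡ c * m) → samePoint w (T t m)
            scaled (c , c∈ , k≡) = c , c∈ ,
              (λ c≡0 → w≢0 (trans w≡ (trans (cong (T t) (trans k≡ (*≡0ˡ c≡0))) (T-0 t)))) ,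
              trans w≡ (trans (cong (T t) k≡) (T-scale t m c∈))

    -- The lines of Ŵ meeting both lines correspond to the zeros of a Hermitian form.

    E : Carrier
    E = Δ * (f P * f (bar R))

    open HermitianForm F tw E

    fE≡ : f E ≡ f Δ * (bar P * R)
    fE≡ = trans (f-* _ _) (cong (f Δ *_) (trans (f-* _ _) (cong₂ _*_ (f² P) (f-f-bar R))))
    Ē≡ : bar E ≡ Δ * (f (bar P) * f R)
    Ē≡ = trans (B.*-homo _ _) (cong₂ _*_ Δ∈K (trans (B.*-homo _ _) (cong₂ _*_ (bar-f P) (bar-f-bar R))))
    fĒ≡ : f (bar E) ≡ f Δ * (P * bar R)
    fĒ≡ = trans (cong f Ē≡) (trans (f-* _ _) (cong (f Δ *_) (trans (f-* _ _) (cong₂ _*_ (f-f-bar P) (f² R)))))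
    fΔ≡ : f Δ ≡ f P * f (bar P) + f R * f (bar R)
    fΔ≡ = trans (f-+ _ _) (cong₂ _+_ (f-* _ _) (f-* _ _))

    E≢0 : E ≢ 0#
    E≢0 = *-≢0 Δ≢0 (*-≢0 (f-≢0 P≢0) (f-≢0 (B.≢0-homo R≢0)))

    -- A vector x T + y T† of the plane of k lies on the line of s exactly when x U + y U′ = 0. A
    -- nonzero solution over `K` exists exactly when U Ū′ = Ū U′, and E is the coefficient of k f(k)
    -- in U Ū′ + Ū U′.
    form≡ : ∀ k → form k k ≡ U k * bar (U′ k) + bar (U k) * U′ k
    form≡ k = trans (trans (cong₂ _+_ (cong₂ _+_ (cong (k * f k * E +_) (cong (bar k * f k *_) (trans fE≡ (cong (_*
        (bar P * R)) fΔ≡)))) (cong (bar k * f (bar k) *_) Ē≡))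
        (cong (k * f (bar k) *_) (trans fĒ≡ (cong (_* (P * bar R)) fΔ≡))))
      (e k (bar k) (f k) (f (bar k)) P (bar P) R (bar R) (f P) (f (bar P)) (f R) (f (bar R))))
      (sym (cong₂ _+_ (cong₂ _*_ (U≡ k) (Ū′≡ k)) (cong₂ _*_ (Ū≡ k) (U′≡ k))))
      where
      e = solve 12 (λ k k̄ fk fk̄ P P̄ R R̄ fP fP̄ fR fR̄ →
        k :* fk :* ((P :* P̄ :+ R :* R̄) :* (fP :* fR̄)) :+ k̄ :* fk :* ((fP :* fP̄ :+ fR :* fR̄) :* (P̄ :* R))
        :+ k̄ :* fk̄ :* ((P :* P̄ :+ R :* R̄) :* (fP̄ :* fR)) :+ k :* fk̄ :* ((fP :* fP̄ :+ fR :* fR̄) :* (P :* R̄))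
        := (k :* (P :* fR̄) :+ k̄ :* (R :* fP̄)) :* (fk̄ :* (R̄ :* fR) :+ fk :* (P̄ :* fP))
        :+ (k̄ :* (P̄ :* fR) :+ k :* (R̄ :* fP)) :* (fk :* (R :* fR̄) :+ fk̄ :* (P :* fP̄))) refl

    -- Both factors are tested in `Position`: for disjoint lines the second is nonzero, and the
    -- first separates `tangent` from `generic`.
    disc≡ : disc ≡ (N * N′ + D * D′) * (N * D′ + D * N′)
    disc≡ = trans (cong₂ (λ u v → E * u + v) Ē≡ (cong₂ _*_ (trans fE≡ (cong (_* (bar P * R)) fΔ≡)) (trans fĒ≡ (cong (_*
        (P * bar R)) fΔ≡))))
      (trans (e P (bar P) R (bar R) (f P) (f (bar P)) (f R) (f (bar R))) (sym (cong₂ (λ n d → (N * n + D * d) * (N * d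
          + D * n)) N′≡ D′≡)))
      where
      e = solve 8 (λ P P̄ R R̄ fP fP̄ fR fR̄ →
        (P :* P̄ :+ R :* R̄) :* (fP :* fR̄) :* ((P :* P̄ :+ R :* R̄) :* (fP̄ :* fR)) :+ (fP :* fP̄ :+ fR :* fR̄) :*
            (P̄ :* R) :* ((fP :* fP̄ :+ fR :* fR̄) :* (P :* R̄))
        := (P :* P̄ :* (fP :* fP̄) :+ R :* R̄ :* (fR :* fR̄)) :* (P :* P̄ :* (fR :* fR̄) :+ R :* R̄ :* (fP :* fP̄))) refl

    form≡0⇒Meet : ∀ {k} → k ≢ 0# → form k k ≡ 0# → ∃[ w ] (w ≢ zeroV × OnSpan (points s∉K) w × OnSpan (plane k) w)
    form≡0⇒Meet {k} k≢0 e = cases (U′ k ≟ 0#)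
      where
      †∈K : Kvec ((T t k) †)
      †∈K = †-K (T t k) (T-K t k)
      UU : U k * bar (U′ k) ≡ bar (U k) * U′ k
      UU = ≡0-+ (trans (sym (form≡ k)) e)
      cases : Dec (U′ k ≡ 0#) → ∃[ w ] (w ≢ zeroV × OnSpan (points s∉K) w × OnSpan (plane k) w)
      cases (yes U′≡0) = (T t k) † ,
        (λ z → 1≢0 (proj₂ (T,†-independent t∉K k≢0 inK-0 (trans (sym (lin₂ (T t k) ((T t k) †))) z)))) ,
        L≡0⇒span s∉K _ †∈K U′≡0 , on₂ _ _
      cases (no U′≢0) = w ,
        (λ z → 1≢0 (proj₁ (T,†-independent t∉K k≢0 inK-1 z))) ,
        L≡0⇒span s∉K w (Kvec-lin inK-1 y∈ (T t k) ((T t k) †) (T-K t k) †∈K)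
          (trans (L-lin s 1# y _ _) (lc₁ (c (U k) (U′ k) (U′ k ⁻¹)) (⁻¹-inverse _ U′≢0))) ,
        (1# , y , inK-1 , y∈ , refl)
        where
        -- Solves U + y U′ = 0; the vanishing of the form says that this quotient lies in `K`.
        y : Carrier
        y = U k * U′ k ⁻¹
        y∈ : inK y
        y∈ = trans (B.*-homo _ _) (trans (cong (bar (U k) *_) (B.⁻¹-homo U′≢0))
          (lc₃ (d (U k) (bar (U k)) (U′ k) (bar (U′ k)) (U′ k ⁻¹) (bar (U′ k) ⁻¹)) UU (⁻¹-inverse _ U′≢0) (⁻¹-inverse _
              (B.≢0-homo U′≢0))))
          where
          d = solve 6 (λ u ū v v̄ i j →
            ū :* j := u :* i :+ (i :* j) :* (u :* v̄ :+ ū :* v) :+ (ū :* j) :* (v :* i :+ :1) :+ (u :* i) :* (v̄ :* j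
                :+ :1)) refl
        w : V
        w = (1# · T t k) +V (y · ((T t k) †))
        c = solve 3 (λ u v i → :1 :* u :+ u :* i :* v := :0 :+ u :* (v :* i :+ :1)) refl

    Meet⇒form≡0 : ∀ {k} w → w ≢ zeroV → OnSpan (points s∉K) w → OnSpan (plane k) w → form k k ≡ 0#
    Meet⇒form≡0 {k} w w≢0 o (x , y , x∈ , y∈ , w≡) = trans (form≡ k) (cases (x ≟ 0#) (y ≟ 0#))
      where
      e₁ : x * U k + y * U′ k ≡ 0#
      e₁ = trans (sym (L-lin s x y _ _)) (trans (cong (L s) (sym w≡)) (span⇒L≡0 s∉K o))
      e₂ : x * bar (U k) + y * bar (U′ k) ≡ 0#
      e₂ = trans (sym (trans (B.+-homo _ _) (cong₂ _+_ (trans (B.*-homo _ _) (cong (_* bar (U k)) x∈)) (trans (B.*-homo _ _)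
          (cong (_* bar (U′ k)) y∈)))))
        (trans (cong bar e₁) inK-0)
      cx = solve 6 (λ x y u ū v v̄ →
        x :* (u :* v̄ :+ ū :* v) := :0 :+ v̄ :* ((x :* u :+ y :* v) :+ :0) :+ v :* ((x :* ū :+ y :* v̄) :+ :0)) refl
      cy = solve 6 (λ x y u ū v v̄ →
        y :* (u :* v̄ :+ ū :* v) := :0 :+ ū :* ((x :* u :+ y :* v) :+ :0) :+ u :* ((x :* ū :+ y :* v̄) :+ :0)) refl
      cases : Dec (x ≡ 0#) → Dec (y ≡ 0#) → U k * bar (U′ k) + bar (U k) * U′ k ≡ 0#
      cases (no x≢0) _ = integral x≢0 (lc₂ (cx x y (U k) (bar (U k)) (U′ k) (bar (U′ k))) e₁ e₂)
      cases (yes _) (no y≢0) = integral y≢0 (lc₂ (cy x y (U k) (bar (U k)) (U′ k) (bar (U′ k))) e₁ e₂)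
      cases (yes x≡0) (yes y≡0) = contradiction (trans w≡ (trans (cong₂ (λ a b → (a · T t k) +V (b · ((T t k) †))) x≡0 y≡0)
          (sym (lin₀ _ _)))) w≢0

    Zeros⇒HasCard : ∀ {n} → Zeros n → HasCard _≅W_ (InSS (line t∉K) (line s∉K)) n
    Zeros⇒HasCard {n} Z = ws , ws∈ , ws-inj , ws-surj
      where
      open Zeros Z
      ws : Fin n → WLine
      ws i = wline θ∈K θ∉Fq (zs i) (zs≢0 i)
      ws∈ : ∀ i → InSS (line t∉K) (line s∉K) (ws i)
      ws∈ i = (T t (zs i) , T-≢0 t∉K (zs≢0 i) , span-T t∉K (zs i) , plane⊆basis θ∈K θ∉Fq (zs i) _ (on₁ _ _)) ,
        on (form≡0⇒Meet (zs≢0 i) (zs∈ i))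
        where
        on : ∃[ w ] (w ≢ zeroV × OnSpan (points s∉K) w × OnSpan (plane (zs i)) w) → Meet (points s∉K) (basis θ∈K θ∉Fq
            (zs i))
        on (w , w≢0 , o , o′) = w , w≢0 , o , plane⊆basis θ∈K θ∉Fq (zs i) w o′
      ws-inj : ∀ i j → ws i ≅W ws j → i ≡ j
      ws-inj i j e = on (plane-injective (zs≢0 j) (basis⊆plane θ∈K θ∉Fq (zs j) _ (proj₁ (e (T t (zs i)))
          (plane⊆basis θ∈K θ∉Fq (zs i) _ (on₁ _ _)))))
        where
        on : ∃[ c ] (inK c × zs i ≡ c * zs j) → i ≡ j
        on (c , c∈ , p) = zs-inj i j c c∈ p
      ws-surj : ∀ n → InSS (line t∉K) (line s∉K) n → ∃[ i ] (n ≅W ws i)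
      ws-surj n (mt , (w , w≢0 , o , o′)) = on (Meet⇒T (proj₁ n) mt)
        where
        on : ∃[ k ] (k ≢ 0# × OnSpan (proj₁ n) (T t k)) → ∃[ i ] (n ≅W ws i)
        on (k , k≢0 , n∋k) = on′ (zs-surj k k≢0 (Meet⇒form≡0 w w≢0 o (proj₁ (classify n k≢0 n∋k w) o′)))
          where
          on′ : ∃[ i ] ∃[ c ] (inK c × k ≡ c * zs i) → ∃[ i ] (n ≅W ws i)
          on′ (i , c , c∈ , k≡) = i , λ x →
            (λ o → plane⊆basis θ∈K θ∉Fq (zs i) x (plane-scale c∈ k≡ x (proj₁ (classify n k≢0 n∋k x) o))) ,
            (λ o → proj₂ (classify n k≢0 n∋k x) (plane-scale (inK-⁻¹ c≢0 c∈) zs≡ x (basis⊆plane θ∈K θ∉Fq (zs i) x o)))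
            where
            c≢0 : c ≢ 0#
            c≢0 c≡0 = k≢0 (trans k≡ (*≡0ˡ c≡0))
            zs≡ : zs i ≡ c ⁻¹ * k
            zs≡ = trans (lc₁ (r c (c ⁻¹) (zs i)) (⁻¹-inverse c c≢0)) (cong (c ⁻¹ *_) (sym k≡))
              where
              r = solve 3 (λ c i z → z := i :* (c :* z) :+ z :* (c :* i :+ :1)) refl

    Position⇒RH : ∀ {j} → Position j → RH j (line t∉K) (line s∉K)
    Position⇒RH (meeting p) = meet-one p
    Position⇒RH (tangent p r) = disjoint p , Zeros⇒HasCard (Count.zeros-degenerate 1≤h E≢0 t∉K (trans disc≡ (*≡0ˡ
        (+-≡0 r))))
    Position⇒RH (generic p r) = disjoint p , Zeros⇒HasCard (Count.NonDegenerate.zeros-nondegenerate 1≤h E≢0 t∉K θ∈K θ∉Fq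
      (λ e → *-≢0 (+-≢0 r) (+-≢0 p) (trans (sym disc≡) e)) (card-Fq θ∈K θ∉Fq t∉K))

  φ : Ell → HLine
  φ (t , t∉K) = line t∉K

  module _ (1≤h : 1 ℕ.≤ h) {θ : Carrier} (θ∈K : inK θ) (θ∉Fq : ¬ inFq θ) where

    position-of : ∀ t s → ∃[ j ] (RE j t s × RH j (φ t) (φ s))
    position-of (t , t∉K) (s , s∉K) = cases (t ≟ s) (t ≟ bar s)
      where
      cases : Dec (t ≡ s) → Dec (t ≡ bar s) → ∃[ j ] (RE j (t , t∉K) (s , s∉K) × RH j (line t∉K) (line s∉K))
      cases (yes p) _ = zero , inj₁ p , same-line t∉K s∉K (inj₁ p)
      cases (no _) (yes p) = zero , inj₂ p , same-line t∉K s∉K (inj₂ p)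
      cases (no p) (no r) = both (Pair.position s∉K t∉K s≢t s≢t̄)
        where
        s≢t : s ≢ t
        s≢t e = p (sym e)
        s≢t̄ : s ≢ bar t
        s≢t̄ e = r (trans (sym (bar-bar t)) (cong bar (sym e)))
        both : ∃[ j ] Pair.Position s∉K t∉K s≢t s≢t̄ j → ∃[ j ] (RE j (t , t∉K) (s , s∉K) × RH j (line t∉K) (line s∉K))
        both (j , pos) = j , Pair.Position⇒RE s∉K t∉K s≢t s≢t̄ pos , Pairs.Position⇒RH 1≤h θ∈K θ∉Fq s∉K t∉K s≢t s≢t̄ pos

    -- A pair in relation i on one side also has an index at which both sides hold. Exclusivity on
    -- the first side identifies that index with i, which gives the relation on the other side.
    RE⇔RH : ∀ i t s → (RE i t s → RH i (φ t) (φ s)) × (RH i (φ t) (φ s) → RE i t s)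
    RE⇔RH i t s = to (position-of t s) , from (position-of t s)
      where
      to : ∃[ j ] (RE j t s × RH j (φ t) (φ s)) → RE i t s → RH i (φ t) (φ s)
      to (j , e , r) p = subst (λ k → RH k (φ t) (φ s)) (sym (RE-exclusive i j t s p e)) r
      from : ∃[ j ] (RE j t s × RH j (φ t) (φ s)) → RH i (φ t) (φ s) → RE i t s
      from (j , e , r) p = subst (λ k → RE k t s) (sym (RH-exclusive i j (φ t) (φ s) p r)) e

-- Roots of polynomials and an element outside K

module Polynomials {h : ℕ} (F : FiniteFieldQ4 h) where
  open Geometry F
  open FieldTheory F
  open Inverse enumeration renaming (to to el; from to idx; strictlyInverseˡ to el-idx; strictlyInverseʳ to idx-el)

  -- Polynomial functions of degree at most n, by iterated divided differences.

  Degree≤ : ℕ → (Carrier → Carrier) → Set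
  Degree≤ zero f = ∀ x y → f x ≡ f y
  Degree≤ (suc n) f = ∀ r → Σ (Carrier → Carrier) λ g → Degree≤ n g × (∀ x → f x ≡ f r + (x + r) * g x)

  degree-suc : ∀ n {f} → Degree≤ n f → Degree≤ (suc n) f
  degree-suc zero {f} d r = (λ _ → 0#) , (λ _ _ → refl) , (λ x → trans (d x r) (c x r (f r)))
    where
    c = solve 3 (λ x r u → u := u :+ (x :+ r) :* :0) refl
  degree-suc (suc n) d r = proj₁ (d r) , degree-suc n (proj₁ (proj₂ (d r))) , proj₂ (proj₂ (d r))

  degree-+ : ∀ n {f g} → Degree≤ n f → Degree≤ n g → Degree≤ n (λ x → f x + g x)
  degree-+ zero d e x y = cong₂ _+_ (d x y) (e x y)
  degree-+ (suc n) {f} {g} d e r = (λ x → proj₁ (d r) x + proj₁ (e r) x) , degree-+ n (proj₁ (proj₂ (d r))) (proj₁ (proj₂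
      (e r))) ,
    λ x → trans (cong₂ _+_ (proj₂ (proj₂ (d r)) x) (proj₂ (proj₂ (e r)) x)) (c (f r) (g r) (x + r) (proj₁ (d r) x) (proj₁
        (e r) x))
    where
    c = solve 5 (λ f g y u v → f :+ y :* u :+ (g :+ y :* v) := f :+ g :+ y :* (u :+ v)) refl

  degree-scale : ∀ n s {f} → Degree≤ n f → Degree≤ n (λ x → s * f x)
  degree-scale zero s d x y = cong (s *_) (d x y)
  degree-scale (suc n) s {f} d r = (λ x → s * proj₁ (d r) x) , degree-scale n s (proj₁ (proj₂ (d r))) ,
    λ x → trans (cong (s *_) (proj₂ (proj₂ (d r)) x)) (c s (f r) (x + r) (proj₁ (d r) x))
    where
    c = solve 4 (λ s f y u → s :* (f :+ y :* u) := s :* f :+ y :* (s :* u)) refl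

  degree-x* : ∀ n {f} → Degree≤ n f → Degree≤ (suc n) (λ x → x * f x)
  degree-x* zero {f} d r = f , d , λ x → lc₁ (c x r (f x) (f r)) (d x r)
    where
    c = solve 4 (λ x r u v → x :* u := r :* v :+ (x :+ r) :* u :+ r :* (u :+ v)) refl
  degree-x* (suc n) {f} d r = (λ x → f x + r * proj₁ (d r) x) , degree-+ (suc n) d (degree-suc n (degree-scale n r (proj₁
      (proj₂ (d r))))) ,
    λ x → lc₁ (c x r (f x) (f r) (proj₁ (d r) x)) (proj₂ (proj₂ (d r)) x)
    where
    c = solve 5 (λ x r u v g → x :* u := r :* v :+ (x :+ r) :* (u :+ r :* g) :+ r :* (u :+ (v :+ (x :+ r) :* g))) refl

  degree-pow : ∀ n → Degree≤ n (λ x → pow x n)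
  degree-pow zero x y = refl
  degree-pow (suc n) = degree-x* n (degree-pow n)

  degree-const : ∀ n c → Degree≤ n (λ _ → c)
  degree-const zero c _ _ = refl
  degree-const (suc n) c = degree-suc n (degree-const n c)

  -- Dividing out the root `xs zero` lowers the degree by one, and the quotient still vanishes at
  -- the other points because they differ from that root.
  vanishing : ∀ n {f} → Degree≤ n f → (xs : Fin (suc n) → Carrier) → (∀ i j → xs i ≡ xs j → i ≡ j) →
    (∀ i → f (xs i) ≡ 0#) → ∀ x → f x ≡ 0#
  vanishing zero d xs _ f≡0 x = trans (d x (xs zero)) (f≡0 zero)
  vanishing (suc n) {f} d xs xs-inj f≡0 x = trans (e x) (trans (cong (_+ (x + r) * g x) (f≡0 zero)) (trans (+-identityˡ _)
      (*≡0ʳ (vanishing n dg (xs ∘ suc) (λ i j p → Finₚ.suc-injective (xs-inj _ _ p)) g≡0 x))))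
    where
    r : Carrier
    r = xs zero
    g : Carrier → Carrier
    g = proj₁ (d r)
    dg : Degree≤ n g
    dg = proj₁ (proj₂ (d r))
    e : ∀ x → f x ≡ f r + (x + r) * g x
    e = proj₂ (proj₂ (d r))
    g≡0 : ∀ i → g (xs (suc i)) ≡ 0#
    g≡0 i = integral (+-≢0 (λ p → Finₚ.0≢1+n (sym (xs-inj (suc i) zero p))))
      (trans (sym (+-identityˡ _)) (trans (cong (_+ (xs (suc i) + r) * g (xs (suc i))) (sym (f≡0 zero))) (trans (sym (e (xs
          (suc i)))) (f≡0 (suc i)))))

  -- x^{q²-1} + 1 has fewer than q⁴ - 1 roots.

  K≢F : 1 ℕ.≤ h → ∃[ t ] (¬ inK t)
  K≢F 1≤h = cases (Finₚ.any? (λ i → ¬? (bar (el i) ≟ el i)))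
    where
    2≤q² : 2 ℕ.≤ q ℕ.* q
    2≤q² = ℕₚ.≤-trans (ℕₚ.≤-trans (ℕₚ.^-monoʳ-≤ 2 1≤h) (ℕₚ.≤-reflexive (sym (ℕₚ.*-identityʳ q)))) (ℕₚ.*-monoʳ-≤ q
        (ℕₚ.m^n>0 2 h))
    impossible : ∀ m → q ℕ.* q ≡ suc (suc m) → ¬ (∀ x → inK x)
    -- The polynomial would vanish everywhere, but its value at 0 is 1.
    impossible m q²≡ all = 1≢0 (trans (sym (trans (cong (_+ 1#) (zeroˡ _)) (+-identityˡ 1#))) (vanishing
        (suc m) {f} degree xs xs-inj xs-root 0#))
      where
      f : Carrier → Carrier
      f x = pow x (suc m) + 1#
      degree : Degree≤ (suc m) f
      degree = degree-+ (suc m) (degree-pow (suc m)) (degree-const (suc m) 1#)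
      n : ℕ
      n = suc m ℕ.+ suc m ℕ.* suc (suc m)
      card≡ : suc n ≡ card
      card≡ = sym (trans card≡q⁴ (cong₂ ℕ._*_ q²≡ q²≡))
      2+m≤n : suc (suc m) ℕ.≤ n
      2+m≤n = subst (ℕ._≤ n) (ℕₚ.+-comm (suc m) 1) (ℕₚ.+-monoʳ-≤ (suc m) (ℕ.s≤s ℕ.z≤n))
      z : Fin (suc n)
      z = Fin.cast (sym card≡) (idx 0#)
      -- These are q² nonzero elements, one more than the degree; the index of 0 is punched out of
      -- the enumeration.
      xs : Fin (suc (suc m)) → Carrier
      xs i = el (Fin.cast card≡ (Fin.punchIn z (Fin.inject≤ i 2+m≤n)))
      xs-inj : ∀ i j → xs i ≡ xs j → i ≡ j
      xs-inj i j p = Finₚ.inject≤-injective 2+m≤n 2+m≤n i j (Finₚ.punchIn-injective z _ _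
        (Finₚ.toℕ-injective (trans (sym (Finₚ.toℕ-cast card≡ _)) (trans (cong Fin.toℕ (trans (sym (idx-el _)) (trans
            (cong idx p) (idx-el _)))) (Finₚ.toℕ-cast card≡ _)))))
      xs≢0 : ∀ i → xs i ≢ 0#
      xs≢0 i p = Finₚ.punchInᵢ≢i z (Fin.inject≤ i 2+m≤n) (Finₚ.toℕ-injective
        (trans (sym (Finₚ.toℕ-cast card≡ _)) (trans (cong Fin.toℕ (trans (sym (idx-el _)) (cong idx p))) (sym (Finₚ.toℕ-cast
            (sym card≡) (idx 0#))))))
      xs-root : ∀ i → f (xs i) ≡ 0#
      xs-root i = +-≡0 (*-cancelˡ (xs≢0 i) (trans (trans (cong (pow (xs i)) (sym q²≡)) (all (xs i))) (sym (*-identityʳ _))))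
    cases : Dec (∃[ i ] (¬ inK (el i))) → ∃[ t ] (¬ inK t)
    cases (yes (i , p)) = el i , p
    cases (no ¬p) = contradiction (λ x → subst inK (el-idx x) (decidable-stable (bar (el (idx x)) ≟ el (idx x)) (λ r → ¬p
        (idx x , r))))
      (impossible (ℕ.pred (ℕ.pred (q ℕ.* q))) (sym (2+pred 2≤q²)))
      where
      2+pred : ∀ {n} → 2 ℕ.≤ n → suc (suc (ℕ.pred (ℕ.pred n))) ≡ n
      2+pred (ℕ.s≤s (ℕ.s≤s _)) = refl

-- Classification of the lines disjoint from Ŵ

module Classification {h : ℕ} (F : FiniteFieldQ4 h) where
  open Geometry F
  open FieldTheory F
  open Vectors F
  open PenttilaWilliford F
  open Polynomials F
  private
    module B = Endo bar-endo
    module C = Endo conj-endo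

  twist : Bool → Carrier → Carrier
  twist false x = conj x
  twist true x = conj (bar x)

  isTwist : ∀ b → Twist (twist b)
  isTwist false = conj-twist
  isTwist true = conj³-twist

  module Twisted (b : Bool) = Lines F (isTwist b)

  herm-swap : ∀ u v → Kvec u → Kvec v → herm v u ≡ conj (herm u v)
  herm-swap (u₁ ∷ u₂ ∷ u₃ ∷ u₄ ∷ []) (v₁ ∷ v₂ ∷ v₃ ∷ v₄ ∷ []) u∈ v∈ = trans (c (conj u₁) (conj u₂) (conj u₃)
      (conj u₄) v₁ v₂ v₃ v₄)
    (sym (trans (C.+-homo _ _) (cong₂ _+_ (trans (C.+-homo _ _) (cong₂ _+_ (trans (C.+-homo _ _) (cong₂ _+_ (m i₄) (m i₂)))
        (m i₃))) (m i₁))))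
    where
    i₁ = inK⇒conj² (v∈ zero)
    i₂ = inK⇒conj² (v∈ (suc zero))
    i₃ = inK⇒conj² (v∈ (suc (suc zero)))
    i₄ = inK⇒conj² (v∈ (suc (suc (suc zero))))
    m : ∀ {x y} → conj (conj y) ≡ y → conj (x * conj y) ≡ conj x * y
    m e = trans (C.*-homo _ _) (cong (_ *_) e)
    c = solve 8 (λ u₁ u₂ u₃ u₄ v₁ v₂ v₃ v₄ → v₁ :* u₄ :+ v₂ :* u₂ :+ v₃ :* u₃ :+ v₄ :* u₁ := u₁ :* v₄ :+ u₂ :* v₂
        :+ u₃ :* v₃ :+ u₄ :* v₁) refl

  module DisjointLine (1≤h : 1 ℕ.≤ h) (l : HLine) (l-disj : DisjW l) where

    u v : V
    u = proj₁ (proj₁ l)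
    v = proj₂ (proj₁ l)

    u∈K : Kvec u
    u∈K = proj₁ (proj₂ l)
    v∈K : Kvec v
    v∈K = proj₁ (proj₂ (proj₂ l))
    ind : ∀ a b → inK a → inK b → (a · u) +V (b · v) ≡ zeroV → (a ≡ 0#) × (b ≡ 0#)
    ind = proj₁ (proj₂ (proj₂ (proj₂ l)))

    On : V → Set
    On = OnSpan (proj₁ l)

    on-K : ∀ {w} → On w → Kvec w
    on-K (a , b , a∈ , b∈ , e) = subst Kvec (sym e) (Kvec-lin a∈ b∈ u v u∈K v∈K)

    on-herm : ∀ {w w′} → On w → On w′ → herm w w′ ≡ 0#
    on-herm (a , b , _ , _ , refl) (c , d , _ , _ , refl) = trans (herm-lin a b c d u v u v)
      (trans (cong₂ _+_ (cong₂ _+_ (cong₂ _+_ (*≡0ʳ uu) (*≡0ʳ uv)) (*≡0ʳ (trans (herm-swap u v u∈K v∈K) (trans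
          (cong conj uv) C.0-homo)))) (*≡0ʳ vv)) (z 0#))
      where
      uu = proj₁ (proj₂ (proj₂ (proj₂ (proj₂ l))))
      uv = proj₁ (proj₂ (proj₂ (proj₂ (proj₂ (proj₂ l)))))
      vv = proj₂ (proj₂ (proj₂ (proj₂ (proj₂ (proj₂ l)))))
      z = solve 1 (λ x → :0 :+ :0 :+ :0 :+ :0 := :0) refl

    -- The points of l are determined by their first and third coordinates, since (0, 0, 0, 1) is not on l.

    on-0*0* : ∀ {x₁ x₂ x₃ x₄} → On (x₁ ∷ x₂ ∷ x₃ ∷ x₄ ∷ []) → x₁ ≡ 0# → x₃ ≡ 0# → _≡_ {A = V} (x₁ ∷ x₂ ∷ x₃ ∷ x₄ ∷ []) zeroV
    on-0*0* {x₂ = x₂} {x₄ = x₄} o refl refl = vec≡ refl x₂≡0 refl (cases (x₄ ≟ 0#))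
      where
      c = solve 4 (λ x x′ y y′ → y :* y′ := :0 :* x′ :+ y :* y′ :+ :0 :* :0 :+ x :* :0) refl
      -- With x₁ and x₃ zero, isotropy of the vector reduces to x₂^{q+1} = 0.
      x₂≡0 : x₂ ≡ 0#
      x₂≡0 = C.norm≡0 (trans (c x₄ (conj x₄) x₂ (conj x₂)) (trans (sym (cong₂ (λ a b → 0# * conj x₄ + x₂ * conj x₂ + 0# * a
          + x₄ * b) C.0-homo C.0-homo)) (on-herm o o)))
      cases : Dec (x₄ ≡ 0#) → x₄ ≡ 0#
      cases (yes p) = p
      cases (no x₄≢0) = contradiction on-∞ (l-disj (0# ∷ 0# ∷ 0# ∷ 1# ∷ []) (0# , 0# , 1# , C.0-homo , inK-0 , C.1-homo ,
          vec≡ refl (sym C.0-homo) refl refl)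
          (λ e → 1≢0 (proj₂ (proj₂ (proj₂ (vec≡⁻¹ e))))))
        where
        c₀ = solve 1 (λ i → i :* :0 :+ :0 :* :0 := :0) refl
        c₄ = solve 2 (λ x i → i :* x :+ :0 :* x := :1 :+ :1 :* (x :* i :+ :1)) refl
        on-∞ : On (0# ∷ 0# ∷ 0# ∷ 1# ∷ [])
        on-∞ = subst On (vec≡ (c₀ (x₄ ⁻¹)) (trans (cong (λ z → x₄ ⁻¹ * z + 0# * z) x₂≡0) (c₀ (x₄ ⁻¹))) (c₀ (x₄ ⁻¹)) (lc₁
            (c₄ x₄ (x₄ ⁻¹)) (⁻¹-inverse x₄ x₄≢0)))
          (span-lin (inK-⁻¹ x₄≢0 (on-K o (suc (suc (suc zero))))) inK-0 o o)

    on-determined : ∀ {x₁ x₂ x₃ x₄ y₂ y₄} → On (x₁ ∷ x₂ ∷ x₃ ∷ x₄ ∷ []) → On (x₁ ∷ y₂ ∷ x₃ ∷ y₄ ∷ []) →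
      _≡_ {A = V} (x₁ ∷ x₂ ∷ x₃ ∷ x₄ ∷ []) (x₁ ∷ y₂ ∷ x₃ ∷ y₄ ∷ [])
    on-determined {x₁} {x₂} {x₃} {x₄} {y₂} {y₄} o o′ = vec≡ refl (e (proj₁ (proj₂ es))) refl (e (proj₂ (proj₂ (proj₂ es))))
      where
      d = solve 1 (λ x → :1 :* x :+ :1 :* x := :0) refl
      es = vec≡⁻¹ (on-0*0* (span-lin inK-1 inK-1 o o′) (d x₁) (d x₃))
      e : ∀ {x y} → 1# * x + 1# * y ≡ 0# → x ≡ y
      e p = ≡0-+ (trans (sym (cong₂ _+_ (*-identityˡ _) (*-identityˡ _))) p)

    graph : ∀ x₁ x₃ → inK x₁ → inK x₃ → ∃[ x₂ ] ∃[ x₄ ] On (x₁ ∷ x₂ ∷ x₃ ∷ x₄ ∷ [])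
    graph x₁ x₃ x₁∈ x₃∈ = solved u v u∈K v∈K ind (on₁ u v) (on₂ u v)
      where
      solved : ∀ u v → Kvec u → Kvec v → (∀ a b → inK a → inK b → (a · u) +V (b · v) ≡ zeroV → (a ≡ 0#) × (b ≡ 0#)) →
        On u → On v → ∃[ x₂ ] ∃[ x₄ ] On (x₁ ∷ x₂ ∷ x₃ ∷ x₄ ∷ [])
      solved u@(u₁ ∷ u₂ ∷ u₃ ∷ u₄ ∷ []) v@(v₁ ∷ v₂ ∷ v₃ ∷ v₄ ∷ []) u∈ v∈ ind ou ov =
        _ , _ , subst On (vec≡ (lc₁ (s₁ u₁ v₁ u₃ v₃ x₁ x₃ i) inv) refl (lc₁ (s₃ u₁ v₁ u₃ v₃ x₁ x₃ i) inv) refl)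
            (span-lin a∈ b∈ ou ov)
        where
        i₁ = u∈ zero
        i₃ = u∈ (suc (suc zero))
        j₁ = v∈ zero
        j₃ = v∈ (suc (suc zero))
        dd = solve 2 (λ x y → x :* y :+ y :* x := :0) refl
        swp = solve 4 (λ x y z w → x :* y :+ z :* w := y :* x :+ w :* z) refl
        -- If this minor vanished, v₁ u + u₁ v and v₃ u + u₃ v would have zero first and third
        -- coordinates, hence be zero. By independence u₁ = u₃ = 0, and then u itself would be zero.
        det≢0 : u₁ * v₃ + u₃ * v₁ ≢ 0#
        det≢0 e = 1≢0 (proj₁ (ind 1# 0# inK-1 inK-0 (trans (sym (lin₁ u v)) (on-0*0* ou (proj₂ z₁) (proj₂ z₃)))))
          where
          z₁ : v₁ ≡ 0# × u₁ ≡ 0#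
          z₁ = ind v₁ u₁ j₁ i₁ (on-0*0* (span-lin j₁ i₁ ou ov) (dd v₁ u₁) (trans (trans (+-comm _ _) (cong (u₁ * v₃ +_)
              (*-comm v₁ u₃))) e))
          z₃ : v₃ ≡ 0# × u₃ ≡ 0#
          z₃ = ind v₃ u₃ j₃ i₃ (on-0*0* (span-lin j₃ i₃ ou ov) (trans (cong (_+ u₃ * v₁) (*-comm v₃ u₁)) e) (dd v₃ u₃))
        i : Carrier
        i = (u₁ * v₃ + u₃ * v₁) ⁻¹
        inv : (u₁ * v₃ + u₃ * v₁) * i ≡ 1#
        inv = ⁻¹-inverse _ det≢0
        i∈ : inK i
        i∈ = inK-⁻¹ det≢0 (inK-+ (inK-* i₁ j₃) (inK-* i₃ j₁))
        a∈ : inK ((x₁ * v₃ + x₃ * v₁) * i)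
        a∈ = inK-* (inK-+ (inK-* x₁∈ j₃) (inK-* x₃∈ j₁)) i∈
        b∈ : inK ((x₁ * u₃ + x₃ * u₁) * i)
        b∈ = inK-* (inK-+ (inK-* x₁∈ i₃) (inK-* x₃∈ i₁)) i∈
        s₁ = solve 7 (λ u₁ v₁ u₃ v₃ x₁ x₃ i →
          (x₁ :* v₃ :+ x₃ :* v₁) :* i :* u₁ :+ (x₁ :* u₃ :+ x₃ :* u₁) :* i :* v₁ := x₁ :+ x₁ :* ((u₁ :* v₃ :+ u₃ :* v₁) :* i
              :+ :1)) refl
        s₃ = solve 7 (λ u₁ v₁ u₃ v₃ x₁ x₃ i →
          (x₁ :* v₃ :+ x₃ :* v₁) :* i :* u₃ :+ (x₁ :* u₃ :+ x₃ :* u₁) :* i :* v₃ := x₃ :+ x₃ :* ((u₁ :* v₃ :+ u₃ :* v₁) :* i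
              :+ :1)) refl

    -- The usual resolvent 1 + ω^q works unless it is zero; in that case ω = 1 and κ = 1 will do.
    hilbert90 : ∀ {ω} → inK ω → ω * conj ω ≡ 1# → ∃[ κ ] (inK κ × κ ≢ 0# × conj κ ≡ ω * κ)
    hilbert90 {ω} ω∈ N≡1 = cases (1# ≟ conj ω)
      where
      cases : Dec (1# ≡ conj ω) → ∃[ κ ] (inK κ × κ ≢ 0# × conj κ ≡ ω * κ)
      cases (yes p) = 1# , inK-1 , 1≢0 , trans C.1-homo (trans (sym N≡1) (cong (ω *_) (sym p)))
      cases (no p) = 1# + conj ω , inK-+ inK-1 (inK-conj ω∈) , +-≢0 p ,
        trans (C.+-homo _ _) (trans (cong₂ _+_ C.1-homo (inK⇒conj² ω∈)) (lc₁ (c ω (conj ω)) N≡1))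
        where
        c = solve 2 (λ ω ω′ → :1 :+ ω := ω :* (:1 :+ ω′) :+ :1 :* (ω :* ω′ :+ :1)) refl

    -- Write l as spanned by (0, ω, 1, s) and (1, p, 0, s′).  With κ^q = ω κ and S = κ p, the singular points of l over F
    -- correspond to the roots Y of Y² + (S + S^q) Y = κ^{q+1} s′, and the two choices for Y^q + Y are S and S^q.

    classification : (∃[ θ ] (inK θ × ¬ inFq θ)) × (∃[ b ] ∃[ t ] Σ (¬ inK t) λ t∉K → l ≅ Twisted.Line.line b t∉K)
    classification = from-graph (graph 0# 1# inK-0 inK-1) (graph 1# 0# inK-1 inK-0)
      where
      from-graph : ∃[ ω ] ∃[ s ] On (0# ∷ ω ∷ 1# ∷ s ∷ []) → ∃[ p ] ∃[ s′ ] On (1# ∷ p ∷ 0# ∷ s′ ∷ []) →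
        (∃[ θ ] (inK θ × ¬ inFq θ)) × (∃[ b ] ∃[ t ] Σ (¬ inK t) λ t∉K → l ≅ Twisted.Line.line b t∉K)
      from-graph (ω , s , oW) (p , s′ , oV) = with-κ (hilbert90 ω∈ N≡1)
        where
        ω∈ = on-K oW (suc zero)
        p∈ = on-K oV (suc zero)
        s′∈ = on-K oV (suc (suc (suc zero)))
        -- The Hermitian products of the two spanning vectors give three relations: ω has norm 1, s
        -- is determined by ω and p, and s′ has trace p^{q+1} over `F_q`.
        N≡1 : ω * conj ω ≡ 1#
        N≡1 = lc₁ (c ω (conj ω) s (conj s)) (trans (sym (cong₂ (λ a b → 0# * conj s + ω * conj ω + 1# * b
            + s * a) C.0-homo C.1-homo)) (on-herm oW oW))
          where
          c = solve 4 (λ ω ω′ s s″ → ω :* ω′ := :1 :+ :1 :* (:0 :* s″ :+ ω :* ω′ :+ :1 :* :1 :+ s :* :0 :+ :0)) refl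
        s≡ : s ≡ ω * conj p
        s≡ = lc₁ (c ω (conj p) s (conj s′)) (trans (sym (cong₂ (λ a b → 0# * conj s′ + ω * conj p + 1# * a
            + s * b) C.0-homo C.1-homo)) (on-herm oW oV))
          where
          c = solve 4 (λ ω p′ s s″ → s := ω :* p′ :+ :1 :* (:0 :* s″ :+ ω :* p′ :+ :1 :* :0 :+ s :* :1 :+ :0)) refl
        s′+ : s′ + conj s′ ≡ p * conj p
        s′+ = lc₁ (c p (conj p) s′ (conj s′)) (trans (sym (cong₂ (λ a b → 1# * conj s′ + p * conj p + 0# * a
            + s′ * b) C.0-homo C.1-homo)) (on-herm oV oV))
          where
          c = solve 4 (λ p p′ s s″ → s :+ s″ := p :* p′ :+ :1 :* (:1 :* s″ :+ p :* p′ :+ :0 :* :0 :+ s :* :1 :+ :0)) refl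
        with-κ : ∃[ κ ] (inK κ × κ ≢ 0# × conj κ ≡ ω * κ) →
          (∃[ θ ] (inK θ × ¬ inFq θ)) × (∃[ b ] ∃[ t ] Σ (¬ inK t) λ t∉K → l ≅ Twisted.Line.line b t∉K)
        with-κ (κ , κ∈ , κ≢0 , κ′≡) = (S , S∈ , S∉Fq) , with-Y (artin-schreier (proj₂ (K≢F 1≤h)) (M * (e ⁻¹ * e ⁻¹))
            (inK-* M∈ (inK-* e⁻¹∈ e⁻¹∈)))
          where
          κ′ S S′ e M : Carrier
          κ′ = conj κ
          S = κ * p
          S′ = conj S
          e = S + S′
          M = κ * κ′ * s′
          κ′≢0 : κ′ ≢ 0#
          κ′≢0 = C.≢0-homo κ≢0
          κ′∈ : inK κ′
          κ′∈ = inK-conj κ∈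
          S∈ : inK S
          S∈ = inK-* κ∈ p∈
          M∈ : inK M
          M∈ = inK-* (inK-* κ∈ κ′∈) s′∈
          S′≡ : S′ ≡ κ′ * conj p
          S′≡ = C.*-homo κ p
          κs≡S′ : κ * s ≡ S′
          κs≡S′ = trans (cong (κ *_) s≡) (trans (c κ ω (conj p)) (trans (cong (_* conj p) (sym κ′≡)) (sym S′≡)))
            where
            c = solve 3 (λ κ ω p → κ :* (ω :* p) := ω :* κ :* p) refl
          -- The multiple by κ of (0, ω, 1, s) is (0, κ^q, κ, S^q), which would lie in `V̂` if S
          -- were in `F_q`.
          S∉Fq : ¬ inFq S
          S∉Fq S∈Fq = l-disj (0# ∷ κ′ ∷ κ ∷ S′ ∷ []) (0# , κ , S′ , C.0-homo , κ∈ , cong conj S∈Fq , refl)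
            (λ z → κ≢0 (proj₁ (proj₂ (proj₂ (vec≡⁻¹ z)))))
            (subst On (vec≡ (c₀ κ) (trans (c₂ κ ω) (sym κ′≡)) (c₁ κ) (trans (c₂′ κ s) κs≡S′)) (span-lin κ∈ inK-0 oW oW))
            where
            c₀ = solve 1 (λ k → k :* :0 :+ :0 :* :0 := :0) refl
            c₁ = solve 1 (λ k → k :* :1 :+ :0 :* :1 := k) refl
            c₂ = solve 2 (λ k x → k :* x :+ :0 :* x := x :* k) refl
            c₂′ = solve 2 (λ k x → k :* x :+ :0 :* x := k :* x) refl
          e≢0 : e ≢ 0#
          e≢0 = +-≢0 (S∉Fq ∘ sym)
          e∈ : inK e
          e∈ = inK-+ S∈ (inK-conj S∈)
          e⁻¹∈ : inK (e ⁻¹)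
          e⁻¹∈ = inK-⁻¹ e≢0 e∈
          e′≡e : conj e ≡ e
          e′≡e = trans (C.+-homo _ _) (trans (cong (S′ +_) (inK⇒conj² S∈)) (+-comm _ _))
          M+M′ : M + conj M ≡ S * S′
          M+M′ = trans (cong (M +_) (trans (C.*-homo _ _) (cong (_* conj s′) (trans (C.*-homo _ _) (cong (κ′ *_)
              (inK⇒conj² κ∈))))))
            (trans (lc₁ (c κ κ′ s′ (conj s′) p (conj p)) s′+) (cong (S *_) (sym S′≡)))
            where
            c = solve 6 (λ κ κ′ s s″ p p′ → κ :* κ′ :* s :+ κ′ :* κ :* s″ := κ :* p :* (κ′ :* p′) :+ (κ :* κ′) :* (s :+ s″
                :+ p :* p′)) refl
          with-Y : ∃[ y ] (y * y + y ≡ M * (e ⁻¹ * e ⁻¹)) → ∃[ b ] ∃[ t ] Σ (¬ inK t) λ t∉K → l ≅ Twisted.Line.line b t∉K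
          with-Y (y , y²+y) = cases (zero-product factored)
            where
            Y Y′ d : Carrier
            Y = e * y
            Y′ = conj Y
            d = Y′ + Y
            quadratic : Y * Y + e * Y ≡ M
            quadratic = lc₂ (c e (e ⁻¹) y M) y²+y (⁻¹-inverse e e≢0)
              where
              c = solve 4 (λ e i y M →
                e :* y :* (e :* y) :+ e :* (e :* y) := M :+ (e :* e) :* (y :* y :+ y :+ M :* (i :* i)) :+ (M :* (e :* i
                    :+ :1)) :* (e :* i :+ :1)) refl
            quadratic′ : Y′ * Y′ + e * Y′ ≡ conj M
            quadratic′ = trans (sym (trans (C.+-homo _ _) (cong₂ _+_ (C.*-homo _ _) (trans (C.*-homo _ _) (cong
                (_* Y′) e′≡e))))) (cong conj quadratic)
            -- The quadratic and its conjugate add up to d² + e d = M + M^q = S S^q, where e = S +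
            -- S^q.
            factored : (d + S) * (d + S′) ≡ 0#
            factored = lc₃ (c Y Y′ S S′ M (conj M)) quadratic quadratic′ M+M′
              where
              c = solve 6 (λ Y Y′ S S′ M M′ →
                (Y′ :+ Y :+ S) :* (Y′ :+ Y :+ S′) := :0 :+ :1 :* (Y :* Y :+ (S :+ S′) :* Y :+ M) :+ :1 :* (Y′ :* Y′ :+ (S
                    :+ S′) :* Y′ :+ M′) :+ :1 :* (M :+ M′ :+ S :* S′)) refl
            barY : ∀ {X} → Y′ ≡ Y + X → X + conj X ≡ e → bar Y ≡ Y + e
            barY {X} p r = trans (bar≡conj² Y) (trans (cong conj p) (trans (C.+-homo _ _) (trans (cong (_+ conj X) p) (trans
                (+-assoc _ _ _) (cong (Y +_) r)))))
            conclude : ∀ b → bar Y ≡ Y + e → twist b (bar Y) ≡ Y + S′ → ∃[ b ] ∃[ t ] Σ (¬ inK t) λ t∉K →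
                l ≅ Twisted.Line.line b t∉K
            conclude b Ȳ≡ fȲ≡ = b , t , t∉K , λ w → to w , from w
              where
              open Twisted b
              open Twist (isTwist b)
              i j t : Carrier
              i = κ ⁻¹
              j = κ′ ⁻¹
              -- Chosen so that, with f(t̄) = (Y + S^q) / κ, the value of `L t` at (1, p, 0, s′) is
              -- Y² + e Y + M divided by κ^{q+1}. At (0, ω, 1, s) it vanishes because κ^q = ω κ and
              -- κ s = S^q.
              t = Y * j
              κi : κ * i ≡ 1#
              κi = ⁻¹-inverse κ κ≢0
              κ′j : κ′ * j ≡ 1#
              κ′j = ⁻¹-inverse κ′ κ′≢0
              t̄≡ : bar t ≡ (Y + e) * j
              t̄≡ = trans (B.*-homo _ _) (cong₂ _*_ Ȳ≡ (inK-⁻¹ κ′≢0 κ′∈))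
              t∉K : ¬ inK t
              t∉K r = e≢0 (*-cancelˡ (⁻¹-≢0 κ′≢0) (trans (lc₁ (c Y e j) (trans (sym t̄≡) r)) (sym (zeroʳ _))))
                where
                c = solve 3 (λ Y e j → j :* e := :0 :+ :1 :* ((Y :+ e) :* j :+ Y :* j)) refl
              ft̄≡ : twist b (bar t) ≡ (Y + S′) * i
              ft̄≡ = trans (cong (twist b) (trans (B.*-homo _ _) (cong (bar Y *_) (inK-⁻¹ κ′≢0 κ′∈)))) (trans (f-* _ _)
                  (cong₂ _*_ fȲ≡
                (trans (f-⁻¹ κ′≢0) (cong _⁻¹ (trans (f-K κ′∈) (inK⇒conj² κ∈))))))
              LW : L t (0# ∷ ω ∷ 1# ∷ s ∷ []) ≡ 0#
              LW = trans (cong (λ z → 0# * (t * z) + ω * t + 1# * z + s) ft̄≡)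
                (lc₄ (c Y S′ i j κ κ′ ω s) κi κ′j κ′≡ κs≡S′)
                where
                c = solve 8 (λ Y S′ i j κ κ′ ω s →
                  :0 :* (Y :* j :* ((Y :+ S′) :* i)) :+ ω :* (Y :* j) :+ :1 :* ((Y :+ S′) :* i) :+ s :=
                  :0 :+ (s :+ ω :* (Y :* j)) :* (κ :* i :+ :1) :+ (Y :* i) :* (κ′ :* j :+ :1) :+ (Y :* i :* j) :* (κ′
                      :+ ω :* κ) :+ i :* (κ :* s :+ S′)) refl
              LV : L t (1# ∷ p ∷ 0# ∷ s′ ∷ []) ≡ 0#
              LV = trans (cong (λ z → 1# * (t * z) + p * t + 0# * z + s′) ft̄≡)
                (lc₃ (c Y S′ i j κ κ′ p s′) κi κ′j quadratic)
                where
                c = solve 8 (λ Y S′ i j κ κ′ p s′ →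
                  :1 :* (Y :* j :* ((Y :+ S′) :* i)) :+ p :* (Y :* j) :+ :0 :* ((Y :+ S′) :* i) :+ s′ :=
                  :0 :+ (p :* (Y :* j) :+ s′) :* (κ :* i :+ :1) :+ (s′ :* (κ :* i)) :* (κ′ :* j :+ :1) :+ (i :* j) :*
                      (Y :* Y :+ (κ :* p :+ S′) :* Y :+ κ :* κ′ :* s′)) refl
              decompose : ∀ w → On w → ∃[ x₁ ] ∃[ x₃ ] (w ≡ (x₁ · (1# ∷ p ∷ 0# ∷ s′ ∷ [])) +V (x₃ · (0# ∷ ω ∷ 1# ∷ s ∷ [])))
              decompose (x₁ ∷ x₂ ∷ x₃ ∷ x₄ ∷ []) o = x₁ , x₃ ,
                trans (on-determined o (subst On (cong₂ vec (c₁ x₁ x₃) (c₃ x₁ x₃)) (span-lin (on-K o zero) (on-K o (suc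
                    (suc zero))) oV oW)))
                  (cong₂ vec (sym (c₁ x₁ x₃)) (sym (c₃ x₁ x₃)))
                where
                vec : Carrier → Carrier → V
                vec y z = y ∷ x₁ * p + x₃ * ω ∷ z ∷ x₁ * s′ + x₃ * s ∷ []
                c₁ = solve 2 (λ x y → x :* :1 :+ y :* :0 := x) refl
                c₃ = solve 2 (λ x y → x :* :0 :+ y :* :1 := y) refl
              to : ∀ w → On w → OnSpan (Line.points t∉K) w
              to w o = on (decompose w o)
                where
                on : ∃[ x₁ ] ∃[ x₃ ] (w ≡ (x₁ · (1# ∷ p ∷ 0# ∷ s′ ∷ [])) +V (x₃ · (0# ∷ ω ∷ 1# ∷ s ∷ []))) → OnSpan
                    (Line.points t∉K) w
                on (x₁ , x₃ , w≡) = Line.L≡0⇒span t∉K w (on-K o) (trans (cong (L t) w≡) (trans (L-lin t x₁ x₃ _ _) (trans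
                    (cong₂ _+_ (*≡0ʳ LV) (*≡0ʳ LW)) (+-identityˡ 0#))))
              -- Both lines are graphs over the first and third coordinates. The point of l that
              -- shares these with `T t k` is on the line of t by the other inclusion, and must then
              -- be `T t k`.
              from : ∀ w → OnSpan (Line.points t∉K) w → On w
              from w o = on (Line.span⇒T t∉K o)
                where
                on : ∃[ k ] (w ≡ T t k) → On w
                on (k , w≡) = subst On (sym w≡) (same (graph (Tr k) (Tr (k * t)) (Tr-K _) (Tr-K _)))
                  where
                  same : ∃[ x₂ ] ∃[ x₄ ] On (Tr k ∷ x₂ ∷ Tr (k * t) ∷ x₄ ∷ []) → On (T t k)
                  same (x₂ , x₄ , o′) = same′ (Line.span⇒T t∉K (to _ o′))
                    where
                    same′ : ∃[ m ] (Tr k ∷ x₂ ∷ Tr (k * t) ∷ x₄ ∷ [] ≡ T t m) → On (T t k)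
                    same′ (m , e) = subst On (trans e (cong (T t) (sym (Line.T-determined t∉K (proj₁ (vec≡⁻¹ e)) (proj₁
                        (proj₂ (proj₂ (vec≡⁻¹ e)))))))) o′
            Y′≡ : ∀ {X} → d + X ≡ 0# → Y′ ≡ Y + X
            Y′≡ {X} r = lc₁ (c Y Y′ X) r
              where
              c = solve 3 (λ Y Y′ X → Y′ := Y :+ X :+ :1 :* (Y′ :+ Y :+ X :+ :0)) refl
            cases : d + S ≡ 0# ⊎ d + S′ ≡ 0# → ∃[ b ] ∃[ t ] Σ (¬ inK t) λ t∉K → l ≅ Twisted.Line.line b t∉K
            cases (inj₁ r) = conclude false Ȳ≡ (trans (cong conj Ȳ≡) (trans (C.+-homo _ _) (trans (cong₂ _+_ (Y′≡ r) e′≡e)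
                (c Y S S′))))
              where
              Ȳ≡ : bar Y ≡ Y + e
              Ȳ≡ = barY (Y′≡ r) refl
              c = solve 3 (λ Y S S′ → Y :+ S :+ (S :+ S′) := Y :+ S′) refl
            cases (inj₂ r) = conclude true (barY (Y′≡ r) (trans (cong (S′ +_) (inK⇒conj² S∈)) (+-comm _ _))) (trans
                (cong conj (bar-bar Y)) (Y′≡ r))

-- Linear maps and the action of 2 × 2 matrices

module Matrices {h : ℕ} (F : FiniteFieldQ4 h) where
  open Geometry F
  open FieldTheory F
  open Vectors F
  private
    module B = Endo bar-endo
    module C = Endo conj-endo

  Linear : (V → V) → Set
  Linear φ = ∀ x y u v → φ ((x · u) +V (y · v)) ≡ (x · φ u) +V (y · φ v)

  one-scale : ∀ v → v ≡ 1# · v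
  one-scale (u₁ ∷ u₂ ∷ u₃ ∷ u₄ ∷ []) = vec≡ (sym (*-identityˡ _)) (sym (*-identityˡ _)) (sym (*-identityˡ _)) (sym
      (*-identityˡ _))

  ·-assoc : ∀ x y u → x · (y · u) ≡ (x * y) · u
  ·-assoc x y (u₁ ∷ u₂ ∷ u₃ ∷ u₄ ∷ []) = vec≡ (sym (*-assoc _ _ _)) (sym (*-assoc _ _ _)) (sym (*-assoc _ _ _)) (sym
      (*-assoc _ _ _))

  linear-+ : ∀ {φ} → Linear φ → ∀ u v → φ (u +V v) ≡ φ u +V φ v
  linear-+ {φ} lin u v = trans (cong φ (cong₂ _+V_ (one-scale u) (one-scale v))) (trans (lin 1# 1# u v) (cong₂ _+V_ (sym
      (one-scale (φ u))) (sym (one-scale (φ v)))))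

  linear-0 : ∀ {φ} → Linear φ → φ zeroV ≡ zeroV
  linear-0 {φ} lin = trans (cong φ (lin₀ zeroV zeroV)) (trans (lin 0# 0# zeroV zeroV) (sym (lin₀ _ _)))

  linear-· : ∀ {φ} → Linear φ → ∀ x u → φ (x · u) ≡ x · φ u
  linear-· {φ} lin x u = trans (cong φ (·-lin x u u)) (trans (lin x 0# u u) (sym (·-lin x (φ u) (φ u))))

  ε₁ ε₂ ε₃ ε₄ : V
  ε₁ = 1# ∷ 0# ∷ 0# ∷ 0# ∷ []
  ε₂ = 0# ∷ 1# ∷ 0# ∷ 0# ∷ []
  ε₃ = 0# ∷ 0# ∷ 1# ∷ 0# ∷ []
  ε₄ = 0# ∷ 0# ∷ 0# ∷ 1# ∷ []

  linear-ε : ∀ {φ} → Linear φ → ∀ {a p q r s b} → φ ε₁ ≡ a ∷ 0# ∷ 0# ∷ 0# ∷ [] → φ ε₂ ≡ 0# ∷ p ∷ r ∷ 0# ∷ [] →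
    φ ε₃ ≡ 0# ∷ q ∷ s ∷ 0# ∷ [] → φ ε₄ ≡ 0# ∷ 0# ∷ 0# ∷ b ∷ [] →
    ∀ x₁ x₂ x₃ x₄ → φ (x₁ ∷ x₂ ∷ x₃ ∷ x₄ ∷ []) ≡ a * x₁ ∷ p * x₂ + q * x₃ ∷ r * x₂ + s * x₃ ∷ b * x₄ ∷ []
  linear-ε {φ} lin {a} {p} {q} {r} {s} {b} e₁ e₂ e₃ e₄ x₁ x₂ x₃ x₄ = trans (cong φ (vec≡ (c₁ x₁ x₂ x₃ x₄) (c₂ x₁ x₂ x₃ x₄)
      (c₃ x₁ x₂ x₃ x₄) (c₄ x₁ x₂ x₃ x₄)))
    (trans (lin 1# 1# _ _) (trans (cong₂ (λ u v → (1# · u) +V (1# · v)) (trans (lin x₁ x₂ ε₁ ε₂) (cong₂ (λ u v → (x₁ · u) +V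
        (x₂ · v)) e₁ e₂))
        (trans (lin x₃ x₄ ε₃ ε₄) (cong₂ (λ u v → (x₃ · u) +V (x₄ · v)) e₃ e₄)))
      (vec≡ (d₁ x₁ x₂ x₃ x₄ a) (d₂ x₁ x₂ x₃ x₄ p q) (d₂ x₁ x₂ x₃ x₄ r s) (d₄ x₁ x₂ x₃ x₄ b))))
    where
    c₁ = solve 4 (λ x y z w → x := :1 :* (x :* :1 :+ y :* :0) :+ :1 :* (z :* :0 :+ w :* :0)) refl
    c₂ = solve 4 (λ x y z w → y := :1 :* (x :* :0 :+ y :* :1) :+ :1 :* (z :* :0 :+ w :* :0)) refl
    c₃ = solve 4 (λ x y z w → z := :1 :* (x :* :0 :+ y :* :0) :+ :1 :* (z :* :1 :+ w :* :0)) refl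
    c₄ = solve 4 (λ x y z w → w := :1 :* (x :* :0 :+ y :* :0) :+ :1 :* (z :* :0 :+ w :* :1)) refl
    d₁ = solve 5 (λ x y z w a → :1 :* (x :* a :+ y :* :0) :+ :1 :* (z :* :0 :+ w :* :0) := a :* x) refl
    d₂ = solve 6 (λ x y z w p q → :1 :* (x :* :0 :+ y :* p) :+ :1 :* (z :* q :+ w :* :0) := p :* y :+ q :* z) refl
    d₄ = solve 5 (λ x y z w b → :1 :* (x :* :0 :+ y :* :0) :+ :1 :* (z :* :0 :+ w :* b) := b :* w) refl

  dot-lin : ∀ r x y u v → dot r ((x · u) +V (y · v)) ≡ x * dot r u + y * dot r v
  dot-lin (r₁ ∷ r₂ ∷ r₃ ∷ r₄ ∷ []) x y (u₁ ∷ u₂ ∷ u₃ ∷ u₄ ∷ [])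
      (v₁ ∷ v₂ ∷ v₃ ∷ v₄ ∷ []) = c r₁ r₂ r₃ r₄ x y u₁ u₂ u₃ u₄ v₁ v₂ v₃ v₄
    where
    c = solve 14 (λ r₁ r₂ r₃ r₄ x y u₁ u₂ u₃ u₄ v₁ v₂ v₃ v₄ →
      r₁ :* (x :* u₁ :+ y :* v₁) :+ (r₂ :* (x :* u₂ :+ y :* v₂) :+ (r₃ :* (x :* u₃ :+ y :* v₃) :+ (r₄ :* (x :* u₄
          :+ y :* v₄) :+ :0)))
      := x :* (r₁ :* u₁ :+ (r₂ :* u₂ :+ (r₃ :* u₃ :+ (r₄ :* u₄ :+ :0)))) :+ y :* (r₁ :* v₁ :+ (r₂ :* v₂ :+ (r₃ :* v₃ :+
          (r₄ :* v₄ :+ :0))))) refl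

  act-linear : ∀ A → Linear (act A)
  act-linear (r₁ ∷ r₂ ∷ r₃ ∷ r₄ ∷ []) x y u v = vec≡ (dot-lin r₁ x y u v) (dot-lin r₂ x y u v) (dot-lin r₃ x y u v)
      (dot-lin r₄ x y u v)

  dot-K : ∀ r u → Kvec r → Kvec u → inK (dot r u)
  dot-K (_ ∷ _ ∷ _ ∷ _ ∷ []) (_ ∷ _ ∷ _ ∷ _ ∷ []) r∈ u∈ = inK-+ (m zero) (inK-+ (m (suc zero)) (inK-+ (m (suc (suc zero)))
      (inK-+ (m (suc (suc (suc zero)))) inK-0)))
    where
    m : ∀ i → _
    m i = inK-* (r∈ i) (u∈ i)

  act-K : ∀ A u → (∀ i → Kvec (lookup A i)) → Kvec u → Kvec (act A u)
  act-K (r₁ ∷ r₂ ∷ r₃ ∷ r₄ ∷ []) u A∈ u∈ = kvec (dot-K r₁ u (A∈ zero) u∈) (dot-K r₂ u (A∈ (suc zero)) u∈)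
    (dot-K r₃ u (A∈ (suc (suc zero))) u∈) (dot-K r₄ u (A∈ (suc (suc (suc zero)))) u∈)

  record M₂ : Set where
    constructor m₂
    field
      {α β γ δ} : Carrier
      α∈ : inK α
      β∈ : inK β
      γ∈ : inK γ
      δ∈ : inK δ

    det : Carrier
    det = α * δ + β * γ

    -- The factor by which the action `ϱ` of the matrix multiplies both the Hermitian form and the
    -- determinant.
    norm : Carrier
    norm = det * conj det

    det∈ : inK det
    det∈ = inK-+ (inK-* α∈ δ∈) (inK-* β∈ γ∈)

    norm∈ : inK norm
    norm∈ = inK-* det∈ (inK-conj det∈)

    norm≡ : norm ≡ (α * δ + β * γ) * (conj α * conj δ + conj β * conj γ)
    norm≡ = cong (det *_) (trans (C.+-homo _ _) (cong₂ _+_ (C.*-homo _ _) (C.*-homo _ _)))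

  -- The adjugate, which has no signs in characteristic 2.
  adj : M₂ → M₂
  adj (m₂ α∈ β∈ γ∈ δ∈) = m₂ δ∈ β∈ γ∈ α∈

  -- X ↦ g X g* on 2 × 2 matrices

  ϱ : M₂ → V → V
  ϱ g (x₁ ∷ x₂ ∷ x₃ ∷ x₄ ∷ []) =
    (α * x₁ + β * x₃) * conj α + (α * x₂ + β * x₄) * conj β ∷
    (α * x₁ + β * x₃) * conj γ + (α * x₂ + β * x₄) * conj δ ∷
    (γ * x₁ + δ * x₃) * conj α + (γ * x₂ + δ * x₄) * conj β ∷
    (γ * x₁ + δ * x₃) * conj γ + (γ * x₂ + δ * x₄) * conj δ ∷ []
    where open M₂ g

  ϱ-linear : ∀ g → Linear (ϱ g)
  ϱ-linear g x y (u₁ ∷ u₂ ∷ u₃ ∷ u₄ ∷ []) (v₁ ∷ v₂ ∷ v₃ ∷ v₄ ∷ []) =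
    vec≡ (c α β (conj α) (conj β) x y u₁ u₂ u₃ u₄ v₁ v₂ v₃ v₄) (c α β (conj γ) (conj δ) x y u₁ u₂ u₃ u₄ v₁ v₂ v₃ v₄)
      (c γ δ (conj α) (conj β) x y u₁ u₂ u₃ u₄ v₁ v₂ v₃ v₄) (c γ δ (conj γ) (conj δ) x y u₁ u₂ u₃ u₄ v₁ v₂ v₃ v₄)
    where
    open M₂ g
    c = solve 14 (λ a b p q x y u₁ u₂ u₃ u₄ v₁ v₂ v₃ v₄ →
      (a :* (x :* u₁ :+ y :* v₁) :+ b :* (x :* u₃ :+ y :* v₃)) :* p :+ (a :* (x :* u₂ :+ y :* v₂) :+ b :* (x :* u₄
          :+ y :* v₄)) :* q
      := x :* ((a :* u₁ :+ b :* u₃) :* p :+ (a :* u₂ :+ b :* u₄) :* q) :+ y :* ((a :* v₁ :+ b :* v₃) :* p :+ (a :* v₂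
          :+ b :* v₄) :* q)) refl

  ϱ-K : ∀ g u → Kvec u → Kvec (ϱ g u)
  ϱ-K g (u₁ ∷ u₂ ∷ u₃ ∷ u₄ ∷ []) u∈ = kvec (c α∈ β∈ α∈ β∈) (c α∈ β∈ γ∈ δ∈) (c γ∈ δ∈ α∈ β∈) (c γ∈ δ∈ γ∈ δ∈)
    where
    open M₂ g
    c : ∀ {a b p q} → inK a → inK b → inK p → inK q → inK ((a * u₁ + b * u₃) * conj p + (a * u₂ + b * u₄) * conj q)
    c a∈ b∈ p∈ q∈ = inK-+ (inK-* (inK-+ (inK-* a∈ (u∈ zero)) (inK-* b∈ (u∈ (suc (suc zero))))) (inK-conj p∈))
      (inK-* (inK-+ (inK-* a∈ (u∈ (suc zero))) (inK-* b∈ (u∈ (suc (suc (suc zero)))))) (inK-conj q∈))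

  ϱ-adj : ∀ g u → ϱ (adj g) (ϱ g u) ≡ M₂.norm g · u
  ϱ-adj g (x₁ ∷ x₂ ∷ x₃ ∷ x₄ ∷ []) = vec≡
    (trans (c₁ α β γ δ (conj α) (conj β) (conj γ) (conj δ) x₁ x₂ x₃ x₄) (cong (_* x₁) (sym norm≡)))
    (trans (c₂ α β γ δ (conj α) (conj β) (conj γ) (conj δ) x₁ x₂ x₃ x₄) (cong (_* x₂) (sym norm≡)))
    (trans (c₃ α β γ δ (conj α) (conj β) (conj γ) (conj δ) x₁ x₂ x₃ x₄) (cong (_* x₃) (sym norm≡)))
    (trans (c₄ α β γ δ (conj α) (conj β) (conj γ) (conj δ) x₁ x₂ x₃ x₄) (cong (_* x₄) (sym norm≡)))
    where
    open M₂ g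
    c₁ = solve 12 (λ α β γ δ α′ β′ γ′ δ′ x₁ x₂ x₃ x₄ →
      (δ :* ((α :* x₁ :+ β :* x₃) :* α′ :+ (α :* x₂ :+ β :* x₄) :* β′) :+ β :* ((γ :* x₁ :+ δ :* x₃) :* α′ :+ (γ :* x₂
          :+ δ :* x₄) :* β′)) :* δ′
      :+ (δ :* ((α :* x₁ :+ β :* x₃) :* γ′ :+ (α :* x₂ :+ β :* x₄) :* δ′) :+ β :* ((γ :* x₁ :+ δ :* x₃) :* γ′ :+ (γ :* x₂
          :+ δ :* x₄) :* δ′)) :* β′
      := (α :* δ :+ β :* γ) :* (α′ :* δ′ :+ β′ :* γ′) :* x₁) refl
    c₂ = solve 12 (λ α β γ δ α′ β′ γ′ δ′ x₁ x₂ x₃ x₄ →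
      (δ :* ((α :* x₁ :+ β :* x₃) :* α′ :+ (α :* x₂ :+ β :* x₄) :* β′) :+ β :* ((γ :* x₁ :+ δ :* x₃) :* α′ :+ (γ :* x₂
          :+ δ :* x₄) :* β′)) :* γ′
      :+ (δ :* ((α :* x₁ :+ β :* x₃) :* γ′ :+ (α :* x₂ :+ β :* x₄) :* δ′) :+ β :* ((γ :* x₁ :+ δ :* x₃) :* γ′ :+ (γ :* x₂
          :+ δ :* x₄) :* δ′)) :* α′
      := (α :* δ :+ β :* γ) :* (α′ :* δ′ :+ β′ :* γ′) :* x₂) refl
    c₃ = solve 12 (λ α β γ δ α′ β′ γ′ δ′ x₁ x₂ x₃ x₄ →
      (γ :* ((α :* x₁ :+ β :* x₃) :* α′ :+ (α :* x₂ :+ β :* x₄) :* β′) :+ α :* ((γ :* x₁ :+ δ :* x₃) :* α′ :+ (γ :* x₂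
          :+ δ :* x₄) :* β′)) :* δ′
      :+ (γ :* ((α :* x₁ :+ β :* x₃) :* γ′ :+ (α :* x₂ :+ β :* x₄) :* δ′) :+ α :* ((γ :* x₁ :+ δ :* x₃) :* γ′ :+ (γ :* x₂
          :+ δ :* x₄) :* δ′)) :* β′
      := (α :* δ :+ β :* γ) :* (α′ :* δ′ :+ β′ :* γ′) :* x₃) refl
    c₄ = solve 12 (λ α β γ δ α′ β′ γ′ δ′ x₁ x₂ x₃ x₄ →
      (γ :* ((α :* x₁ :+ β :* x₃) :* α′ :+ (α :* x₂ :+ β :* x₄) :* β′) :+ α :* ((γ :* x₁ :+ δ :* x₃) :* α′ :+ (γ :* x₂
          :+ δ :* x₄) :* β′)) :* γ′
      :+ (γ :* ((α :* x₁ :+ β :* x₃) :* γ′ :+ (α :* x₂ :+ β :* x₄) :* δ′) :+ α :* ((γ :* x₁ :+ δ :* x₃) :* γ′ :+ (γ :* x₂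
          :+ δ :* x₄) :* δ′)) :* α′
      := (α :* δ :+ β :* γ) :* (α′ :* δ′ :+ β′ :* γ′) :* x₄) refl

  det-adj : ∀ g → M₂.det (adj g) ≡ M₂.det g
  det-adj g = c α β γ δ
    where
    open M₂ g
    c = solve 4 (λ α β γ δ → δ :* α :+ β :* γ := α :* δ :+ β :* γ) refl

  ϱ-adj′ : ∀ g u → ϱ g (ϱ (adj g) u) ≡ M₂.norm g · u
  ϱ-adj′ g u = trans (ϱ-adj (adj g) u) (cong (λ d → (d * conj d) · u) (det-adj g))

  conj-ϱ : ∀ {a b p q} x₁ x₂ x₃ x₄ → inK p → inK q →
    conj ((a * x₁ + b * x₃) * conj p + (a * x₂ + b * x₄) * conj q) ≡
    (conj a * conj x₁ + conj b * conj x₃) * p + (conj a * conj x₂ + conj b * conj x₄) * q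
  conj-ϱ x₁ x₂ x₃ x₄ p∈ q∈ = trans (C.+-homo _ _) (cong₂ _+_ (trans (C.*-homo _ _) (cong₂ _*_ (l _ _) (inK⇒conj² p∈)))
      (trans (C.*-homo _ _) (cong₂ _*_ (l _ _) (inK⇒conj² q∈))))
    where
    l : ∀ {a b} x y → conj (a * x + b * y) ≡ conj a * conj x + conj b * conj y
    l _ _ = trans (C.+-homo _ _) (cong₂ _+_ (C.*-homo _ _) (C.*-homo _ _))

  ϱ-† : ∀ g u → (ϱ g u) † ≡ ϱ g (u †)
  ϱ-† g (x₁ ∷ x₂ ∷ x₃ ∷ x₄ ∷ []) = vec≡ (c α∈ β∈ α∈ β∈) (c γ∈ δ∈ α∈ β∈) (c α∈ β∈ γ∈ δ∈) (c γ∈ δ∈ γ∈ δ∈)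
    where
    open M₂ g
    d = solve 8 (λ a b p q x y z w →
      (a :* x :+ b :* z) :* p :+ (a :* y :+ b :* w) :* q := (p :* x :+ q :* y) :* a :+ (p :* z :+ q :* w) :* b) refl
    c : ∀ {a b p q} → inK a → inK b → inK p → inK q → conj ((a * x₁ + b * x₃) * conj p + (a * x₂ + b * x₄) * conj q)
      ≡ (p * conj x₁ + q * conj x₂) * conj a + (p * conj x₃ + q * conj x₄) * conj b
    c {a} {b} {p} {q} a∈ b∈ p∈ q∈ = trans (conj-ϱ x₁ x₂ x₃ x₄ p∈ q∈) (d (conj a) (conj b) p q (conj x₁) (conj x₂) (conj x₃)
        (conj x₄))

  ϱ-herm : ∀ g u v → herm (ϱ g u) (ϱ g v) ≡ M₂.norm g * herm u v
  ϱ-herm g (x₁ ∷ x₂ ∷ x₃ ∷ x₄ ∷ []) (y₁ ∷ y₂ ∷ y₃ ∷ y₄ ∷ []) =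
    trans (cong₂ _+_ (cong₂ _+_ (cong₂ _+_ (cong (_ *_) (conj-ϱ y₁ y₂ y₃ y₄ γ∈ δ∈)) (cong (_ *_)
        (conj-ϱ y₁ y₂ y₃ y₄ γ∈ δ∈))) (cong (_ *_) (conj-ϱ y₁ y₂ y₃ y₄ α∈ β∈))) (cong (_ *_) (conj-ϱ y₁ y₂ y₃ y₄ α∈ β∈)))
      (trans (c α β γ δ (conj α) (conj β) (conj γ) (conj δ) x₁ x₂ x₃ x₄ (conj y₁) (conj y₂) (conj y₃) (conj y₄)) (cong
          (_* herm (x₁ ∷ x₂ ∷ x₃ ∷ x₄ ∷ []) (y₁ ∷ y₂ ∷ y₃ ∷ y₄ ∷ [])) (sym norm≡)))
    where
    open M₂ g
    c = solve 16 (λ α β γ δ α′ β′ γ′ δ′ x₁ x₂ x₃ x₄ y₁ y₂ y₃ y₄ →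
      ((α :* x₁ :+ β :* x₃) :* α′ :+ (α :* x₂ :+ β :* x₄) :* β′) :* ((γ′ :* y₁ :+ δ′ :* y₃) :* γ :+ (γ′ :* y₂
          :+ δ′ :* y₄) :* δ)
      :+ ((α :* x₁ :+ β :* x₃) :* γ′ :+ (α :* x₂ :+ β :* x₄) :* δ′) :* ((α′ :* y₁ :+ β′ :* y₃) :* γ :+ (α′ :* y₂
          :+ β′ :* y₄) :* δ)
      :+ ((γ :* x₁ :+ δ :* x₃) :* α′ :+ (γ :* x₂ :+ δ :* x₄) :* β′) :* ((γ′ :* y₁ :+ δ′ :* y₃) :* α :+ (γ′ :* y₂
          :+ δ′ :* y₄) :* β)
      :+ ((γ :* x₁ :+ δ :* x₃) :* γ′ :+ (γ :* x₂ :+ δ :* x₄) :* δ′) :* ((α′ :* y₁ :+ β′ :* y₃) :* α :+ (α′ :* y₂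
          :+ β′ :* y₄) :* β)
      := (α :* δ :+ β :* γ) :* (α′ :* δ′ :+ β′ :* γ′) :* (x₁ :* y₄ :+ x₂ :* y₂ :+ x₃ :* y₃ :+ x₄ :* y₁)) refl

  -- The column (a, b) times its conjugate transpose. Up to scalars these are the singular vectors
  -- of `V̂`.
  pure : Carrier → Carrier → V
  pure a b = a * conj a ∷ a * conj b ∷ b * conj a ∷ b * conj b ∷ []

  ϱ-pure : ∀ g a b → ϱ g (pure a b) ≡ pure (M₂.α g * a + M₂.β g * b) (M₂.γ g * a + M₂.δ g * b)
  ϱ-pure g a b = vec≡ (c α β α β) (c α β γ δ) (c γ δ α β) (c γ δ γ δ)
    where
    open M₂ g
    e = solve 8 (λ x y p q a b a′ b′ →
      (x :* (a :* a′) :+ y :* (b :* a′)) :* p :+ (x :* (a :* b′) :+ y :* (b :* b′)) :* q := (x :* a :+ y :* b) :* (p :* a′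
          :+ q :* b′)) refl
    c : ∀ x y p q → (x * (a * conj a) + y * (b * conj a)) * conj p + (x * (a * conj b) + y * (b * conj b)) * conj q ≡ (x * a
        + y * b) * conj (p * a + q * b)
    c x y p q = trans (e x y (conj p) (conj q) a b (conj a) (conj b)) (cong ((x * a + y * b) *_) (sym (trans (C.+-homo _ _)
        (cong₂ _+_ (C.*-homo _ _) (C.*-homo _ _)))))

  transpose : V → V
  transpose (x₁ ∷ x₂ ∷ x₃ ∷ x₄ ∷ []) = x₁ ∷ x₃ ∷ x₂ ∷ x₄ ∷ []

  -- A linear map of the following shape that takes the rank one matrices ν x to rank one matrices is, up to a scalar,
  -- ϱ of a diagonal matrix, possibly after a transposition.  Three values of x suffice.

  ν : Carrier → V
  ν x = 1# ∷ conj x ∷ x ∷ x * conj x ∷ []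

  module Monomial {θ : Carrier} (θ∈K : inK θ) (θ∉Fq : ¬ inFq θ)
    (a₁ p q′ r s a₄ : Carrier) (a₁∈ : inK a₁) (r∈ : inK r) (s∈ : inK s) (a₁≢0 : a₁ ≢ 0#) (a₄≢0 : a₄ ≢ 0#)
    (rank1 : ∀ x → inK x → ∃[ R ] ∃[ m ] ∃[ n ] (inK m × a₁ * 1# ∷ p * conj x + q′ * x ∷ r * conj x + s * x ∷ a₄ * (x * conj x) ∷ [] ≡ R · pure m n)) where

    -- In a multiple R of a Hermitian matrix the off-diagonal entries are conjugate up to the factor
    -- R / R^q, which the first entry reveals. The second equation is the vanishing of the
    -- determinant.
    facts : ∀ {x} → inK x →
      (p * conj x + q′ * x) * conj a₁ ≡ a₁ * (conj r * x + conj s * conj x) ×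
      (p * conj x + q′ * x) * (r * conj x + s * x) ≡ a₁ * a₄ * (x * conj x)
    facts {x} x∈ = at (rank1 x x∈)
      where
      at : ∃[ R ] ∃[ m ] ∃[ n ] (inK m × a₁ * 1# ∷ p * conj x + q′ * x ∷ r * conj x + s * x ∷ a₄ * (x * conj x) ∷ []
          ≡ R · pure m n) →
        (p * conj x + q′ * x) * conj a₁ ≡ a₁ * (conj r * x + conj s * conj x) ×
        (p * conj x + q′ * x) * (r * conj x + s * x) ≡ a₁ * a₄ * (x * conj x)
      at (R , m , n , m∈ , e) = trans (cong₂ _*_ (proj₁ (proj₂ es)) (trans (cong conj a₁≡) (cj m∈))) (trans (c₁ R
          (conj R) m n (conj m) (conj n))
            (sym (cong₂ _*_ a₁≡ (trans (sym third) (trans (cong conj (proj₁ (proj₂ (proj₂ es)))) (cj m∈)))))) ,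
          trans (cong₂ _*_ (proj₁ (proj₂ es)) (proj₁ (proj₂ (proj₂ es)))) (trans (c₂ R m n (conj m) (conj n))
            (trans (sym (cong₂ _*_ a₁≡ (proj₂ (proj₂ (proj₂ es))))) (sym (*-assoc a₁ a₄ (x * conj x)))))
        where
        es = vec≡⁻¹ e
        a₁≡ : a₁ ≡ R * (m * conj m)
        a₁≡ = trans (sym (*-identityʳ a₁)) (proj₁ es)
        cj : ∀ {a b} → inK b → conj (R * (a * conj b)) ≡ conj R * (conj a * b)
        cj b∈ = trans (C.*-homo _ _) (cong (conj R *_) (trans (C.*-homo _ _) (cong (_ *_) (inK⇒conj² b∈))))
        third : conj (r * conj x + s * x) ≡ conj r * x + conj s * conj x
        third = trans (C.+-homo _ _) (cong₂ _+_ (trans (C.*-homo _ _) (cong (conj r *_) (inK⇒conj² x∈))) (C.*-homo _ _))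
        c₁ = solve 6 (λ R R′ m n m′ n′ → R :* (m :* n′) :* (R′ :* (m′ :* m)) := R :* (m :* m′) :* (R′ :* (n′ :* m))) refl
        c₂ = solve 5 (λ R m n m′ n′ → R :* (m :* n′) :* (R :* (n :* m′)) := R :* (m :* m′) :* (R :* (n :* n′))) refl
    θ′ : Carrier
    θ′ = conj θ
    θ+θ′≢0 : θ + θ′ ≢ 0#
    θ+θ′≢0 = +-≢0 (θ∉Fq ∘ sym)
    at1 = facts inK-1
    atθ = facts θ∈K
    atθ+1 = facts (inK-+ θ∈K inK-1)
    normalise₁ : ∀ {x x′} → conj x ≡ x′ → (p * conj x + q′ * x) * conj a₁ ≡ a₁ * (conj r * x + conj s * conj x) → (p * x′
        + q′ * x) * conj a₁ ≡ a₁ * (conj r * x + conj s * x′)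
    normalise₁ refl e = e
    normalise₂ : ∀ {x x′} → conj x ≡ x′ → (p * conj x + q′ * x) * (r * conj x + s * x) ≡ a₁ * a₄ * (x * conj x) → (p * x′
        + q′ * x) * (r * x′ + s * x) ≡ a₁ * a₄ * (x * x′)
    normalise₂ refl e = e
    θ+1′ : conj (θ + 1#) ≡ θ′ + 1#
    θ+1′ = trans (C.+-homo _ _) (cong (θ′ +_) C.1-homo)
    p≡ : p * conj a₁ ≡ a₁ * conj s
    p≡ = ≡0-+ (*-cancelˡ θ+θ′≢0 (trans (lc₂ (c θ θ′ p q′ (conj a₁) a₁ (conj r) (conj s)) (normalise₁ C.1-homo (proj₁ at1))
        (proj₁ atθ)) (sym (zeroʳ _))))
      where
      c = solve 8 (λ θ θ′ p q a′ a r s →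
        (θ :+ θ′) :* (p :* a′ :+ a :* s) := :0 :+ θ :* ((p :* :1 :+ q :* :1) :* a′ :+ a :* (r :* :1 :+ s :* :1)) :+ :1 :*
            ((p :* θ′ :+ q :* θ) :* a′ :+ a :* (r :* θ :+ s :* θ′))) refl
    q≡ : q′ * conj a₁ ≡ a₁ * conj r
    q≡ = ≡0-+ (*-cancelˡ θ+θ′≢0 (trans (lc₂ (c θ θ′ p q′ (conj a₁) a₁ (conj r) (conj s)) (normalise₁ C.1-homo (proj₁ at1))
        (proj₁ atθ)) (sym (zeroʳ _))))
      where
      c = solve 8 (λ θ θ′ p q a′ a r s →
        (θ :+ θ′) :* (q :* a′ :+ a :* r) := :0 :+ θ′ :* ((p :* :1 :+ q :* :1) :* a′ :+ a :* (r :* :1 :+ s :* :1)) :+ :1 :*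
            ((p :* θ′ :+ q :* θ) :* a′ :+ a :* (r :* θ :+ s :* θ′))) refl
    quad₁ : (p * 1# + q′ * 1#) * (r * 1# + s * 1#) ≡ a₁ * a₄ * (1# * 1#)
    quad₁ = normalise₂ C.1-homo (proj₂ at1)
    quad₃ : (p * (θ′ + 1#) + q′ * (θ + 1#)) * (r * (θ′ + 1#) + s * (θ + 1#)) ≡ a₁ * a₄ * ((θ + 1#) * (θ′ + 1#))
    quad₃ = normalise₂ θ+1′ (proj₂ atθ+1)
    -- The sum of the quadratic identity over 1, θ and θ + 1 is its polarization at 1 and θ. The
    -- squares cancel, which leaves the coefficient of x x^q times θ + θ^q.
    middle : p * s + q′ * r ≡ a₁ * a₄
    middle = ≡0-+ (*-cancelˡ θ+θ′≢0 (trans (lc₃ (c θ θ′ p q′ r s (a₁ * a₄)) quad₁ (proj₂ atθ) quad₃) (sym (zeroʳ _))))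
      where
      c = solve 7 (λ θ θ′ p q r s A →
        (θ :+ θ′) :* (p :* s :+ q :* r :+ A) := :0
        :+ :1 :* ((p :* :1 :+ q :* :1) :* (r :* :1 :+ s :* :1) :+ A :* (:1 :* :1))
        :+ :1 :* ((p :* θ′ :+ q :* θ) :* (r :* θ′ :+ s :* θ) :+ A :* (θ :* θ′))
        :+ :1 :* ((p :* (θ′ :+ :1) :+ q :* (θ :+ :1)) :* (r :* (θ′ :+ :1) :+ s :* (θ :+ :1)) :+ A :* ((θ :+ :1) :* (θ′
            :+ :1)))) refl
    pr≡0 : p * r ≡ 0#
    pr≡0 = *-cancelˡ (*-≢0 θ+θ′≢0 θ+θ′≢0) (trans (lc₃ (c θ θ′ p q′ r s (a₁ * a₄)) quad₁ (proj₂ atθ) middle) (sym (zeroʳ _)))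
      where
      c = solve 7 (λ θ θ′ p q r s A →
        (θ :+ θ′) :* (θ :+ θ′) :* (p :* r) := :0
        :+ (θ :* θ) :* ((p :* :1 :+ q :* :1) :* (r :* :1 :+ s :* :1) :+ A :* (:1 :* :1))
        :+ :1 :* ((p :* θ′ :+ q :* θ) :* (r :* θ′ :+ s :* θ) :+ A :* (θ :* θ′))
        :+ (θ :* θ :+ θ :* θ′) :* (p :* s :+ q :* r :+ A)) refl
    i : Carrier
    i = conj a₁ ⁻¹
    a₁′≢0 : conj a₁ ≢ 0#
    a₁′≢0 = C.≢0-homo a₁≢0
    inv : conj a₁ * i ≡ 1#
    inv = ⁻¹-inverse _ a₁′≢0
    i∈ : inK i
    i∈ = inK-⁻¹ a₁′≢0 (inK-conj a₁∈)
    i≢0 : i ≢ 0#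
    i≢0 = ⁻¹-≢0 a₁′≢0
    diagonal : ∀ {n} → inK n → M₂
    diagonal n∈ = m₂ a₁∈ inK-0 inK-0 n∈
    diagonal-det : ∀ {n} (n∈ : inK n) → n ≢ 0# → M₂.det (diagonal n∈) ≢ 0#
    diagonal-det {n} n∈ n≢0 e = *-≢0 a₁≢0 n≢0 (trans (c a₁ n) e)
      where
      c = solve 2 (λ a n → a :* n := a :* n :+ :0 :* :0) refl
    diagonal-ϱ : ∀ {n m} (n∈ : inK n) → m * conj a₁ ≡ a₁ * conj n → m * n ≡ a₁ * a₄ → ∀ x₁ x₂ x₃ x₄ →
      i · ϱ (diagonal n∈) (x₁ ∷ x₂ ∷ x₃ ∷ x₄ ∷ []) ≡ a₁ * x₁ ∷ m * x₂ ∷ n * x₃ ∷ a₄ * x₄ ∷ []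
    diagonal-ϱ {n} {m} n∈ e₁ e₂ x₁ x₂ x₃ x₄ = trans
      (cong (λ z → i · ((a₁ * x₁ + 0# * x₃) * conj a₁ + (a₁ * x₂ + 0# * x₄) * z ∷ (a₁ * x₁ + 0# * x₃) * z + (a₁ * x₂
          + 0# * x₄) * conj n
        ∷ (0# * x₁ + n * x₃) * conj a₁ + (0# * x₂ + n * x₄) * z ∷ (0# * x₁ + n * x₃) * z + (0# * x₂
            + n * x₄) * conj n ∷ [])) C.0-homo)
      (vec≡ (lc₁ (c₁ a₁ (conj a₁) i x₁ x₂ x₃ x₄) inv) (lc₂ (c₂ a₁ (conj a₁) i m (conj n) x₁ x₂ x₃ x₄) inv e₁)
        (lc₁ (c₃ n (conj a₁) i x₁ x₂ x₃ x₄) inv)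
        (*-cancelˡ a₁≢0 (lc₃ (c₄ a₁ (conj a₁) a₄ i m n (conj n) x₁ x₂ x₃ x₄) inv e₁ e₂)))
      where
      c₁ = solve 7 (λ a a′ i x₁ x₂ x₃ x₄ →
        i :* ((a :* x₁ :+ :0 :* x₃) :* a′ :+ (a :* x₂ :+ :0 :* x₄) :* :0) := a :* x₁ :+ (a :* x₁) :* (a′ :* i :+ :1)) refl
      c₂ = solve 9 (λ a a′ i m n′ x₁ x₂ x₃ x₄ →
        i :* ((a :* x₁ :+ :0 :* x₃) :* :0 :+ (a :* x₂ :+ :0 :* x₄) :* n′) := m :* x₂ :+ (m :* x₂) :* (a′ :* i :+ :1) :+
            (i :* x₂) :* (m :* a′ :+ a :* n′)) refl
      c₃ = solve 7 (λ n a′ i x₁ x₂ x₃ x₄ →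
        i :* ((:0 :* x₁ :+ n :* x₃) :* a′ :+ (:0 :* x₂ :+ n :* x₄) :* :0) := n :* x₃ :+ (n :* x₃) :* (a′ :* i :+ :1)) refl
      c₄ = solve 11 (λ a a′ a₄ i m n n′ x₁ x₂ x₃ x₄ →
        a :* (i :* ((:0 :* x₁ :+ n :* x₃) :* :0 :+ (:0 :* x₂ :+ n :* x₄) :* n′)) := a :* (a₄ :* x₄)
        :+ (m :* n :* x₄) :* (a′ :* i :+ :1) :+ (i :* n :* x₄) :* (m :* a′ :+ a :* n′) :+ x₄ :* (m :* n :+ a :* a₄)) refl

    Diagonal Twisted-Diagonal : (V → V) → Set
    Diagonal B = ∃[ n ] Σ (inK n) λ n∈ → n ≢ 0# × (∀ x → B x ≡ i · ϱ (diagonal n∈) x)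
    Twisted-Diagonal B = ∃[ n ] Σ (inK n) λ n∈ → n ≢ 0# × (∀ x → B x ≡ i · ϱ (diagonal n∈) (transpose x))

    shape : (B : V → V) → (∀ x₁ x₂ x₃ x₄ → B (x₁ ∷ x₂ ∷ x₃ ∷ x₄ ∷ []) ≡ a₁ * x₁ ∷ p * x₂ + q′ * x₃ ∷ r * x₂
        + s * x₃ ∷ a₄ * x₄ ∷ []) →
      Diagonal B ⊎ Twisted-Diagonal B
    shape B B≡ = cases (s ≟ 0#)
      where
      keepˡ = solve 3 (λ p x y → p :* x :+ :0 :* y := p :* x) refl
      keepʳ = solve 3 (λ s x y → :0 :* x :+ s :* y := s :* y) refl
      cases : Dec (s ≡ 0#) → Diagonal B ⊎ Twisted-Diagonal B
      -- By `p≡` and `q≡`, p vanishes together with s, and q′ together with r. As p r = 0 and p s +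
      -- q′ r is nonzero, exactly one of the two pairs survives, which decides whether there is a
      -- transposition.
      cases (no s≢0) = inj₁ (s , s∈ , s≢0 , B-diagonal)
        where
        p≢0 : p ≢ 0#
        p≢0 p≡0 = *-≢0 a₁≢0 (C.≢0-homo s≢0) (trans (sym p≡) (*≡0ˡ p≡0))
        r≡0 : r ≡ 0#
        r≡0 = integral p≢0 pr≡0
        q≡0 : q′ ≡ 0#
        q≡0 = integral a₁′≢0 (trans (*-comm _ _) (trans q≡ (*≡0ʳ (trans (cong conj r≡0) C.0-homo))))
        ps≡ : p * s ≡ a₁ * a₄
        ps≡ = trans (sym (+-identityʳ _)) (trans (cong (p * s +_) (sym (*≡0ˡ q≡0))) middle)
        B-diagonal : ∀ x → B x ≡ i · ϱ (diagonal s∈) x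
        B-diagonal (x₁ ∷ x₂ ∷ x₃ ∷ x₄ ∷ []) = trans (B≡ x₁ x₂ x₃ x₄) (trans
          (vec≡ refl (trans (cong (λ z → p * x₂ + z * x₃) q≡0) (keepˡ p x₂ x₃)) (trans (cong (λ z → z * x₂ + s * x₃) r≡0)
              (keepʳ s x₂ x₃)) refl)
          (sym (diagonal-ϱ s∈ p≡ ps≡ x₁ x₂ x₃ x₄)))
      cases (yes s≡0) = inj₂ (r , r∈ , r≢0 , B-diagonal)
        where
        p≡0 : p ≡ 0#
        p≡0 = integral a₁′≢0 (trans (*-comm _ _) (trans p≡ (*≡0ʳ (trans (cong conj s≡0) C.0-homo))))
        qr≡ : q′ * r ≡ a₁ * a₄
        qr≡ = trans (sym (+-identityˡ _)) (trans (cong (_+ q′ * r) (sym (*≡0ˡ p≡0))) middle)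
        r≢0 : r ≢ 0#
        r≢0 r≡0 = *-≢0 a₁≢0 a₄≢0 (trans (sym qr≡) (*≡0ʳ r≡0))
        B-diagonal : ∀ x → B x ≡ i · ϱ (diagonal r∈) (transpose x)
        B-diagonal (x₁ ∷ x₂ ∷ x₃ ∷ x₄ ∷ []) = trans (B≡ x₁ x₂ x₃ x₄) (trans
          (vec≡ refl (trans (cong (λ z → z * x₂ + q′ * x₃) p≡0) (keepʳ q′ x₂ x₃)) (trans (cong (λ z → r * x₂ + z * x₃) s≡0)
              (keepˡ r x₂ x₃)) refl)
          (sym (diagonal-ϱ r∈ q≡ qr≡ x₁ x₃ x₂ x₄)))

-- The action of linear maps on the two families of lines

module LineMaps {h : ℕ} (F : FiniteFieldQ4 h) where
  open Geometry F
  open FieldTheory F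
  open Vectors F
  open Matrices F
  open Classification F using (twist; isTwist; module Twisted)
  private
    module B = Endo bar-endo
    module C = Endo conj-endo

  point : Bool → Carrier → Carrier → V
  point b = Twisted.T b

  record Onto (φ : V → V) (b : Bool) (t : Carrier) (b′ : Bool) (t′ : Carrier) : Set where
    constructor onto
    field
      forth : ∀ k → ∃[ m ] (φ (point b t k) ≡ point b′ t′ m)
      back  : ∀ m → ∃[ k ] (point b′ t′ m ≡ φ (point b t k))
  open Onto public

  -- p tells whether the two families are interchanged.
  record MapsLines (p : Bool) (φ : V → V) : Set where
    constructor maps
    field
      image : ∀ b t → ¬ inK t → ∃[ t′ ] (¬ inK t′ × Onto φ b t (p xor b) t′)
  open MapsLines public

  onto-∘ : ∀ {φ ψ b b′ b″ t t′ t″} → Onto φ b′ t′ b″ t″ → Onto ψ b t b′ t′ → Onto (φ ∘ ψ) b t b″ t″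
  onto-∘ {φ} (onto f g) (onto f′ g′) = onto
    (λ k → proj₁ (f (proj₁ (f′ k))) , trans (cong φ (proj₂ (f′ k))) (proj₂ (f _)))
    (λ m → proj₁ (g′ (proj₁ (g m))) , trans (proj₂ (g m)) (cong φ (proj₂ (g′ _))))

  onto-≗ : ∀ {φ ψ b b′ t t′} → (∀ x → φ x ≡ ψ x) → Onto φ b t b′ t′ → Onto ψ b t b′ t′
  onto-≗ e (onto f g) = onto (λ k → proj₁ (f k) , trans (sym (e _)) (proj₂ (f k))) (λ m → proj₁ (g m) , trans (proj₂ (g m))
      (e _))

  maps-∘ : ∀ {p p′ φ ψ} → MapsLines p φ → MapsLines p′ ψ → MapsLines (p xor p′) (φ ∘ ψ)
  maps-∘ {p} {p′} {φ} {ψ} Φ Ψ = maps λ b t t∉K → step b t (image Ψ b t t∉K)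
    where
    step : ∀ b t → ∃[ t′ ] (¬ inK t′ × Onto ψ b t (p′ xor b) t′) → ∃[ t′ ] (¬ inK t′ × Onto (φ ∘ ψ) b t
        ((p xor p′) xor b) t′)
    step b t (t′ , t′∉K , o) = step′ (image Φ (p′ xor b) t′ t′∉K)
      where
      step′ : ∃[ t″ ] (¬ inK t″ × Onto φ (p′ xor b) t′ (p xor (p′ xor b)) t″) → ∃[ t″ ] (¬ inK t″ × Onto (φ ∘ ψ) b t
          ((p xor p′) xor b) t″)
      step′ (t″ , t″∉K , o′) = t″ , t″∉K , subst (λ b′ → Onto (φ ∘ ψ) b t b′ t″) (sym (Boolₚ.xor-assoc p p′ b))
          (onto-∘ o′ o)

  maps-≗ : ∀ {p φ ψ} → (∀ x → φ x ≡ ψ x) → MapsLines p φ → MapsLines p ψ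
  maps-≗ {p} {φ} {ψ} e Φ = maps λ b t t∉K → step b t (image Φ b t t∉K)
    where
    step : ∀ b t → ∃[ t′ ] (¬ inK t′ × Onto φ b t (p xor b) t′) → ∃[ t′ ] (¬ inK t′ × Onto ψ b t (p xor b) t′)
    step b t (t′ , t′∉K , o) = t′ , t′∉K , onto-≗ e o

  maps-scale : ∀ {c} → inK c → c ≢ 0# → MapsLines false (c ·_)
  maps-scale {c} c∈ c≢0 = maps λ b t t∉K → t , t∉K , onto (λ k → c * k , sym (Twisted.T-scale b t k c∈))
    (λ m → c ⁻¹ * m , trans (cong (point b t) (lc₁ (e c (c ⁻¹) m) (⁻¹-inverse c c≢0))) (Twisted.T-scale b t _ c∈))
    where
    e = solve 3 (λ c i m → m := c :* (i :* m) :+ m :* (c :* i :+ :1)) refl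

  denominator≢0 : ∀ g → M₂.det g ≢ 0# → ∀ {t} → ¬ inK t → M₂.α g + M₂.β g * t ≢ 0#
  denominator≢0 g det≢0 {t} t∉K e = det≢0 (trans (cong₂ _+_ (*≡0ˡ (proj₁ αβ)) (*≡0ˡ (proj₂ αβ))) (+-identityˡ 0#))
    where
    open M₂ g
    d = solve 1 (λ t → :0 := :0 :+ :0 :* t) refl
    αβ : α ≡ 0# × β ≡ 0#
    αβ = Conjugates.coordinates-unique t∉K α∈ β∈ inK-0 inK-0 (trans e (d t))

  -- With J = α + β t, the matrix g takes e_t to J e_{t′}, and its conjugate takes e_{f t} to f(J)
  -- e_{f t′}; so the parameter k becomes k J f(J). The equation for t′ is cross-multiplied so that
  -- t′ can be given in closed form.
  onto-ϱ : ∀ g → M₂.det g ≢ 0# → ∀ b {t t′} → ¬ inK t → t′ * (M₂.α g + M₂.β g * t) ≡ M₂.γ g + M₂.δ g * t →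
    ¬ inK t′ × Onto (ϱ g) b t b t′
  onto-ϱ g det≢0 b {t} {t′} t∉K t′J≡ = t′∉K , onto (λ k → k * (J * f J) , ϱ-T k)
    (λ m → m * (J * f J) ⁻¹ , trans (cong (point b t′) (lc₁ (e m (J * f J) ((J * f J) ⁻¹)) (⁻¹-inverse _ JfJ≢0))) (sym
        (ϱ-T _)))
    where
    open M₂ g
    open Twist (isTwist b)
    open Twisted b using (f-+; f-*; f-≢0; bar-f; Tr₂≡; Tr₃≡; Tr₄≡)
    open Conjugates t∉K
    f : Carrier → Carrier
    f = twist b
    J : Carrier
    J = α + β * t
    J≢0 : J ≢ 0#
    J≢0 = denominator≢0 g det≢0 t∉K
    JfJ≢0 : J * f J ≢ 0#
    JfJ≢0 = *-≢0 J≢0 (f-≢0 J≢0)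
    e = solve 3 (λ m x i → m := m :* i :* x :+ m :* (x :* i :+ :1)) refl
    t′∉K : ¬ inK t′
    t′∉K t′∈ = det≢0 (trans (cong₂ (λ x y → α * x + β * y) (sym (proj₂ γδ)) (sym (proj₁ γδ))) (c t′ α β))
      where
      d = solve 4 (λ t′ α β t → t′ :* α :+ t′ :* β :* t := t′ :* (α :+ β :* t)) refl
      c = solve 3 (λ t′ α β → α :* (t′ :* β) :+ β :* (t′ :* α) := :0) refl
      γδ : t′ * α ≡ γ × t′ * β ≡ δ
      γδ = coordinates-unique (inK-* t′∈ α∈) (inK-* t′∈ β∈) γ∈ δ∈ (trans (d t′ α β t) t′J≡)
    f-affine : ∀ {x y} → inK x → inK y → f (x + y * t) ≡ conj x + conj y * f t
    f-affine x∈ y∈ = trans (f-+ _ _) (cong₂ _+_ (f-K x∈) (trans (f-* _ _) (cong (_* f t) (f-K y∈))))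
    bilinear : ∀ {a b p q} k → inK a → inK b → inK p → inK q →
      (a * Tr k + b * Tr (k * t)) * p + (a * Tr (k * f t) + b * Tr (k * (t * f t))) * q ≡ Tr (k * ((a + b * t) * (p
          + q * f t)))
    bilinear {a} {b} {p} {q} k a∈ b∈ p∈ q∈ = trans (cong₂ (λ x y → (a * Tr k + b * x) * p + y * q) (Tr₃≡ t k) (cong₂
        (λ x y → a * x + b * y) (Tr₂≡ t k) (Tr₄≡ t k)))
      (trans (c a b p q k (bar k) t (f t) (bar t) (f (bar t))) (cong (k * ((a + b * t) * (p + q * f t)) +_) (sym (trans
          (B.*-homo _ _) (cong (bar k *_)
        (trans (B.*-homo _ _) (cong₂ _*_ (affine a∈ b∈ refl) (affine p∈ q∈ (bar-f t)))))))))
      where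
      affine : ∀ {x y z z̄} → inK x → inK y → bar z ≡ z̄ → bar (x + y * z) ≡ x + y * z̄
      affine x∈ y∈ refl = trans (B.+-homo _ _) (cong₂ _+_ x∈ (trans (B.*-homo _ _) (cong (_* _) y∈)))
      c = solve 10 (λ a b p q k k̄ t₀ t₁ t₂ t₃ →
        (a :* (k :+ k̄) :+ b :* (k :* t₀ :+ k̄ :* t₂)) :* p :+ (a :* (k :* t₁ :+ k̄ :* t₃) :+ b :* (k :* (t₀ :* t₁) :+ k̄ :*
            (t₂ :* t₃))) :* q
        := k :* ((a :+ b :* t₀) :* (p :+ q :* t₁)) :+ k̄ :* ((a :+ b :* t₂) :* (p :+ q :* t₃))) refl
    fJ≡ : f J ≡ conj α + conj β * f t
    fJ≡ = f-affine α∈ β∈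
    ft′fJ≡ : f t′ * f J ≡ conj γ + conj δ * f t
    ft′fJ≡ = trans (sym (f-* _ _)) (trans (cong f t′J≡) (f-affine γ∈ δ∈))
    ϱ-T : ∀ k → ϱ g (point b t k) ≡ point b t′ (k * (J * f J))
    ϱ-T k = vec≡
      (trans (bilinear k α∈ β∈ (inK-conj α∈) (inK-conj β∈)) (cong (λ z → Tr (k * (J * z))) (sym fJ≡)))
      (trans (bilinear k α∈ β∈ (inK-conj γ∈) (inK-conj δ∈)) (cong Tr (trans (cong (λ z → k * (J * z)) (sym ft′fJ≡)) (c₂ k J
          (f J) (f t′)))))
      (trans (bilinear k γ∈ δ∈ (inK-conj α∈) (inK-conj β∈)) (cong Tr (trans (cong₂ (λ y z → k * (y * z)) (sym t′J≡)
          (sym fJ≡)) (c₃ k J (f J) t′))))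
      (trans (bilinear k γ∈ δ∈ (inK-conj γ∈) (inK-conj δ∈)) (cong Tr (trans (cong₂ (λ y z → k * (y * z)) (sym t′J≡)
          (sym ft′fJ≡)) (c₄ k J (f J) t′ (f t′)))))
      where
      c₂ = solve 4 (λ k J fJ ft → k :* (J :* (ft :* fJ)) := k :* (J :* fJ) :* ft) refl
      c₃ = solve 4 (λ k J fJ t → k :* (t :* J :* fJ) := k :* (J :* fJ) :* t) refl
      c₄ = solve 5 (λ k J fJ t ft → k :* (t :* J :* (ft :* fJ)) := k :* (J :* fJ) :* (t :* ft)) refl

  maps-ϱ : ∀ g → M₂.det g ≢ 0# → MapsLines false (ϱ g)
  maps-ϱ g det≢0 = maps λ b t t∉K → (γ + δ * t) * (α + β * t) ⁻¹ ,
    onto-ϱ g det≢0 b t∉K (lc₁ (e (γ + δ * t) (α + β * t) ((α + β * t) ⁻¹)) (⁻¹-inverse _ (denominator≢0 g det≢0 t∉K)))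
    where
    open M₂ g
    e = solve 3 (λ y J i → y :* i :* J := y :+ y :* (J :* i :+ :1)) refl

  -- Exchanging the tensor factors turns e_t ⊗ e_{f t} into e_{f t} ⊗ e_t, and t is the image of f t
  -- under the other twist, which is the inverse of f.
  maps-transpose : MapsLines true transpose
  maps-transpose = maps at
    where
    at : ∀ b t → ¬ inK t → ∃[ t′ ] (¬ inK t′ × Onto transpose b t (true xor b) t′)
    at b t t∉K = s , s∉K , onto (λ k → k , transpose-T k) (λ m → m , sym (transpose-T m))
      where
      open Twisted b using (bar-f)
      open Twist (isTwist b)
      s : Carrier
      s = twist b t
      twist-inverse : ∀ b → twist (true xor b) (twist b t) ≡ t
      twist-inverse false = trans (cong conj (bar-conj t)) (trans (sym (bar≡conj² (bar t))) (bar-bar t))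
      twist-inverse true = trans (sym (bar≡conj² (bar t))) (bar-bar t)
      s∉K : ¬ inK s
      s∉K e = t∉K (trans (sym (f² t)) (trans (cong (twist b) (trans (sym e) (bar-f t))) (Twisted.f-f-bar b t)))
      transpose-T : ∀ k → transpose (point b t k) ≡ point (true xor b) s k
      transpose-T k = vec≡ refl (cong (λ z → Tr (k * z)) (sym (twist-inverse b))) refl
        (cong (λ z → Tr (k * z)) (trans (*-comm _ _) (cong (s *_) (sym (twist-inverse b)))))

  -- An element of the stabilizer is, up to a scalar, X ↦ g X g* or X ↦ g Xᵀ g*.

  module Stabilizer (A : StabElt) {θ : Carrier} (θ∈K : inK θ) (θ∉Fq : ¬ inFq θ) where
    open StabElt A renaming (inv to mat⁻¹)

    φ ψ : V → V
    φ = act mat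
    ψ = act mat⁻¹

    φ-≢0 : ∀ {v} → v ≢ zeroV → φ v ≢ zeroV
    φ-≢0 {v} v≢0 e = v≢0 (trans (sym (leftInv v)) (trans (cong ψ e) (linear-0 (act-linear mat⁻¹))))

    some-generator : ∀ {n} (cs : Vec Carrier n) (gs : Vec V n) → lincomb cs gs ≢ zeroV → ∃[ j ] (lookup gs j ≢ zeroV)
    some-generator [] [] e = contradiction refl e
    some-generator (c ∷ cs) (g ∷ gs) e = cases (zero? g)
      where
      zero? : ∀ g → Dec (g ≡ zeroV)
      zero? (g₁ ∷ g₂ ∷ g₃ ∷ g₄ ∷ []) with g₁ ≟ 0# | g₂ ≟ 0# | g₃ ≟ 0# | g₄ ≟ 0#
      ... | yes refl | yes refl | yes refl | yes refl = yes refl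
      ... | no p | _ | _ | _ = no λ { refl → p refl }
      ... | _ | no p | _ | _ = no λ { refl → p refl }
      ... | _ | _ | no p | _ = no λ { refl → p refl }
      ... | _ | _ | _ | no p = no λ { refl → p refl }
      0+V : ∀ u → (c · zeroV) +V u ≡ u
      0+V (u₁ ∷ u₂ ∷ u₃ ∷ u₄ ∷ []) = vec≡ (d c u₁) (d c u₂) (d c u₃) (d c u₄)
        where
        d = solve 2 (λ c u → c :* :0 :+ u := u) refl
      cases : Dec (g ≡ zeroV) → ∃[ j ] (lookup (g ∷ gs) j ≢ zeroV)
      cases (no p) = zero , p
      cases (yes refl) = suc (proj₁ later) , proj₂ later
        where
        later : ∃[ j ] (lookup gs j ≢ zeroV)
        later = some-generator cs gs (λ e′ → e (trans (0+V _) e′))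

    inFq-0 : inFq 0#
    inFq-0 = C.0-homo

    unit : ∀ {n} → Fin n → Vec Carrier n
    unit zero = 1# ∷ Vec.replicate _ 0#
    unit (suc i) = 0# ∷ unit i

    replicate-Fq : ∀ n → AllVec inFq (Vec.replicate n 0#)
    replicate-Fq (suc n) zero = inFq-0
    replicate-Fq (suc n) (suc i) = replicate-Fq n i

    unit-Fq : ∀ {n} (i : Fin n) → AllVec inFq (unit i)
    unit-Fq zero zero = C.1-homo
    unit-Fq zero (suc j) = replicate-Fq _ j
    unit-Fq (suc i) zero = inFq-0
    unit-Fq (suc i) (suc j) = unit-Fq i j

    lincomb-replicate : ∀ {n} (gs : Vec V n) → lincomb (Vec.replicate n 0#) gs ≡ zeroV
    lincomb-replicate [] = refl
    lincomb-replicate (g ∷ gs) = trans (cong ((0# · g) +V_) (lincomb-replicate gs)) (d g)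
      where
      d : ∀ u → (0# · u) +V zeroV ≡ zeroV
      d (u₁ ∷ u₂ ∷ u₃ ∷ u₄ ∷ []) = vec≡ (c u₁) (c u₂) (c u₃) (c u₄)
        where
        c = solve 1 (λ u → :0 :* u :+ :0 := :0) refl

    lincomb-unit : ∀ {n} (gs : Vec V n) i → lincomb (unit i) gs ≡ lookup gs i
    lincomb-unit (g ∷ gs) zero = trans (cong ((1# · g) +V_) (lincomb-replicate gs)) (d g)
      where
      d : ∀ u → (1# · u) +V zeroV ≡ u
      d (u₁ ∷ u₂ ∷ u₃ ∷ u₄ ∷ []) = vec≡ (c u₁) (c u₂) (c u₃) (c u₄)
        where
        c = solve 1 (λ u → :1 :* u :+ :0 := u) refl
    lincomb-unit (g ∷ gs) (suc i) = trans (cong ((0# · g) +V_) (lincomb-unit gs i)) (d g (lookup gs i))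
      where
      d : ∀ u v → (0# · u) +V v ≡ v
      d (u₁ ∷ u₂ ∷ u₃ ∷ u₄ ∷ []) (v₁ ∷ v₂ ∷ v₃ ∷ v₄ ∷ []) = vec≡ (c u₁ v₁) (c u₂ v₂) (c u₃ v₃) (c u₄ v₄)
        where
        c = solve 2 (λ u v → :0 :* u :+ v := v) refl

    all-one : ∀ {P : Carrier → Set} {c} → P c → AllVec P (c ∷ [])
    all-one p zero = p

    lincomb-one : ∀ c v → lincomb (c ∷ []) (v ∷ []) ≡ c · v
    lincomb-one c (u₁ ∷ u₂ ∷ u₃ ∷ u₄ ∷ []) = vec≡ (+-identityʳ _) (+-identityʳ _) (+-identityʳ _) (+-identityʳ _)

    SingularVector : V → Set
    SingularVector v = Vhat v × Qhat v ≡ 0# × v ≢ zeroV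

    singular-subspace : ∀ {v} → SingularVector v → Singular (1 , v ∷ [])
    singular-subspace {v} (v∈ , Qv≡0 , _) = (λ { zero → v∈ }) , λ { (c ∷ []) cs∈ → trans (cong Qhat (lincomb-one c v)) (Q-scale c v (cs∈ zero) Qv≡0) }
      where
      Q-scale : ∀ c v → inFq c → Qhat v ≡ 0# → Qhat (c · v) ≡ 0#
      Q-scale c (x₁ ∷ x₂ ∷ x₃ ∷ x₄ ∷ []) c∈ e = trans (cong (λ z → c * x₁ * (c * x₄) + c * x₃ * z) (trans (C.*-homo _ _)
          (cong (_* conj x₃) c∈)))
        (trans (d c x₁ x₄ x₃ (conj x₃)) (*≡0ʳ e))
        where
        d = solve 5 (λ c x₁ x₄ x₃ x₃′ → c :* x₁ :* (c :* x₄) :+ c :* x₃ :* (c :* x₃′) := (c :* c) :* (x₁ :* x₄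
            :+ x₃ :* x₃′)) refl

    -- The image of the span of v is only known as the extension of some spanning family. As φ v is
    -- nonzero, the family has a nonzero member g; it is singular, and pulling it back shows that it
    -- is a multiple of φ v.
    singular-image : ∀ {v} → SingularVector v → ∃[ k ] ∃[ g ] (inK k × k ≢ 0# × SingularVector g × φ v ≡ k · g)
    singular-image {v} sv@(v∈ , _ , v≢0) = from (stabFwd (1 , v ∷ []) (singular-subspace sv))
      where
      Goal : Set
      Goal = ∃[ k ] ∃[ g ] (inK k × k ≢ 0# × SingularVector g × φ v ≡ k · g)
      from : ∃[ S′ ] (Singular S′ × MapsOnto mat (Ext (1 , v ∷ [])) (Ext S′)) → Goal
      from ((n , gs) , (gs∈ , Q≡0) , mapsOnto) = from′ (proj₂ (mapsOnto (φ v)) (v , (1# ∷ [] ,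
          all-one {P = inK} {c = 1#} inK-1 , trans (one-scale v) (sym (lincomb-one 1# v))) , refl))
        where
        from′ : Ext (n , gs) (φ v) → Goal
        from′ (cs , cs∈ , φv≡) = from″ (some-generator cs gs (λ e → φ-≢0 v≢0 (trans φv≡ e)))
          where
          from″ : ∃[ j ] (lookup gs j ≢ zeroV) → Goal
          from″ (j , g≢0) = from‴ (proj₁ (mapsOnto g) (unit j , (λ i → inFq⇒inK (unit-Fq j i)) , sym (lincomb-unit gs j)))
            where
            g : V
            g = lookup gs j
            from‴ : ∃[ u ] (Ext (1 , v ∷ []) u × g ≡ φ u) → Goal
            from‴ (u , (c ∷ [] , c∈ , u≡) , g≡) = c ⁻¹ , g , inK-⁻¹ c≢0 (c∈ zero) , ⁻¹-≢0 c≢0 ,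
              (gs∈ j , trans (cong Qhat (sym (lincomb-unit gs j))) (Q≡0 (unit j) (unit-Fq j)) , g≢0) ,
              sym (trans (cong ((c ⁻¹) ·_) g≡c·φv) (cancel (φ v)))
              where
              g≡c·φv : g ≡ c · φ v
              g≡c·φv = trans g≡ (trans (cong φ (trans u≡ (lincomb-one c v))) (linear-· (act-linear mat) c v))
              c≢0 : c ≢ 0#
              c≢0 c≡0 = g≢0 (trans g≡c·φv (trans (cong (_· φ v) c≡0) (d (φ v))))
                where
                d : ∀ u → 0# · u ≡ zeroV
                d (u₁ ∷ u₂ ∷ u₃ ∷ u₄ ∷ []) = vec≡ (zeroˡ _) (zeroˡ _) (zeroˡ _) (zeroˡ _)
              cancel : ∀ u → (c ⁻¹) · (c · u) ≡ u
              cancel (u₁ ∷ u₂ ∷ u₃ ∷ u₄ ∷ []) = vec≡ (r u₁) (r u₂) (r u₃) (r u₄)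
                where
                d = solve 3 (λ c i u → i :* (c :* u) := u :+ u :* (c :* i :+ :1)) refl
                r : ∀ u → c ⁻¹ * (c * u) ≡ u
                r u = lc₁ (d c (c ⁻¹) u) (⁻¹-inverse c c≢0)

    Rank1 : V → Set
    Rank1 w = ∃[ r ] ∃[ a ] ∃[ b ] (inK r × r ≢ 0# × inK a × inK b × w ≡ r · pure a b)

    -- For α nonzero, αβ = x^{q+1} exhibits the vector as α times the square of (1, x / α).
    -- Otherwise x^{q+1} = 0, and only β times the square of (0, 1) is left.
    singular⇒rank1 : ∀ {g} → SingularVector g → Rank1 g
    singular⇒rank1 ((α , x , β , α∈ , x∈ , β∈ , refl) , Q≡0 , g≢0) = cases (α ≟ 0#)
      where
      cases : Dec (α ≡ 0#) → Rank1 (α ∷ conj x ∷ x ∷ β ∷ [])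
      cases (no α≢0) = α , 1# , x * α ⁻¹ , inFq⇒inK α∈ , α≢0 , inK-1 , inK-* x∈ (inK-⁻¹ α≢0 (inFq⇒inK α∈)) ,
        vec≡ (sym (trans (cong (λ z → α * (1# * z)) C.1-homo) (c₁ α)))
          (sym (trans (cong (λ z → α * (1# * z)) xi′) (lc₁ (c₂ α (conj x) (α ⁻¹)) inv)))
          (sym (trans (cong (λ z → α * (x * α ⁻¹ * z)) C.1-homo) (lc₁ (c₃ α x (α ⁻¹)) inv)))
          (sym (trans (cong (λ z → α * (x * α ⁻¹ * z)) xi′) (lc₂ (c₄ α β x (conj x) (α ⁻¹)) inv Q≡0)))
        where
        inv : α * α ⁻¹ ≡ 1#
        inv = ⁻¹-inverse α α≢0
        xi′ : conj (x * α ⁻¹) ≡ conj x * α ⁻¹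
        xi′ = trans (C.*-homo _ _) (cong (conj x *_) (inFq-⁻¹ α≢0 α∈))
        c₁ = solve 1 (λ α → α :* (:1 :* :1) := α) refl
        c₂ = solve 3 (λ α x i → α :* (:1 :* (x :* i)) := x :+ x :* (α :* i :+ :1)) refl
        c₃ = solve 3 (λ α x i → α :* (x :* i :* :1) := x :+ x :* (α :* i :+ :1)) refl
        c₄ = solve 5 (λ α β x x′ i →
          α :* (x :* i :* (x′ :* i)) := β :+ (x :* x′ :* i :+ β) :* (α :* i :+ :1) :+ i :* (α :* β :+ x :* x′ :+ :0)) refl
      cases (yes α≡0) = β , 0# , 1# , inFq⇒inK β∈ , β≢0 , inK-0 , inK-1 ,
        vec≡ (trans α≡0 (sym (z₁ β (conj 0#)))) (trans (trans (cong conj x≡0) C.0-homo) (sym (z₁ β (conj 1#))))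
          (trans x≡0 (sym (trans (cong (λ z → β * (1# * z)) C.0-homo) (z₂ β)))) (sym (trans (cong (λ z → β *
              (1# * z)) C.1-homo) (z₃ β)))
        where
        z₁ = solve 2 (λ β y → β :* (:0 :* y) := :0) refl
        z₂ = solve 1 (λ β → β :* (:1 :* :0) := :0) refl
        z₃ = solve 1 (λ β → β :* (:1 :* :1) := β) refl
        xx′≡0 : x * conj x ≡ 0#
        xx′≡0 = trans (sym (+-identityˡ _)) (trans (cong (_+ x * conj x) (sym (*≡0ˡ α≡0))) Q≡0)
        x≡0 : x ≡ 0#
        x≡0 = C.norm≡0 xx′≡0
        β≢0 : β ≢ 0#
        β≢0 β≡0 = g≢0 (vec≡ α≡0 (trans (cong conj x≡0) C.0-homo) x≡0 β≡0)

    rank1-image : ∀ {v} → SingularVector v → Rank1 (φ v)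
    rank1-image sv = from (singular-image sv)
      where
      from : ∃[ k ] ∃[ g ] (inK k × k ≢ 0# × SingularVector g × φ _ ≡ k · g) → Rank1 (φ _)
      from (k , g , k∈ , k≢0 , sg , e) = from′ (singular⇒rank1 sg)
        where
        from′ : Rank1 g → Rank1 (φ _)
        from′ (r , a , b , r∈ , r≢0 , a∈ , b∈ , g≡) = k * r , a , b , inK-* k∈ r∈ , *-≢0 k≢0 r≢0 , a∈ , b∈ , trans e (trans
            (cong (k ·_) g≡) (·-assoc k r _))

    ε₁-singular : SingularVector ε₁
    ε₁-singular = (1# , 0# , 0# , C.1-homo , inK-0 , C.0-homo , vec≡ refl (sym C.0-homo) refl refl) ,
      trans (cong (1# * 0# +_) (zeroˡ _)) (trans (+-identityʳ _) (zeroʳ _)) , (λ e → 1≢0 (proj₁ (vec≡⁻¹ e)))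

    ε₄-singular : SingularVector ε₄
    ε₄-singular = (0# , 0# , 1# , C.0-homo , inK-0 , C.1-homo , vec≡ refl (sym C.0-homo) refl refl) ,
      trans (cong (0# * 1# +_) (zeroˡ _)) (trans (+-identityʳ _) (zeroˡ _)) , (λ e → 1≢0 (proj₂ (proj₂ (proj₂ (vec≡⁻¹ e)))))

    ν-singular : ∀ {x} → inK x → SingularVector (ν x)
    ν-singular {x} x∈ = (1# , x , x * conj x , C.1-homo , x∈ , trans (C.*-homo _ _) (trans (cong (conj x *_) (inK⇒conj² x∈))
        (*-comm _ _)) , refl) ,
      trans (cong (_+ x * conj x) (*-identityˡ _)) (+-≡0 refl) , (λ e → 1≢0 (proj₁ (vec≡⁻¹ e)))

    record Decomposition : Set where
      field
        p : Bool
        maps-φ : MapsLines p φ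
        maps-ψ : MapsLines p ψ

    ϱ-inv : M₂ → V → V
    ϱ-inv g u = (M₂.norm g ⁻¹) · ϱ (adj g) u

    norm≢0 : ∀ g → M₂.det g ≢ 0# → M₂.norm g ≢ 0#
    norm≢0 g d = *-≢0 d (C.≢0-homo d)

    ϱ-ϱ-inv : ∀ g → M₂.det g ≢ 0# → ∀ u → ϱ g (ϱ-inv g u) ≡ u
    ϱ-ϱ-inv g d u = trans (linear-· (ϱ-linear g) _ _) (trans (cong ((M₂.norm g ⁻¹) ·_) (ϱ-adj′ g u))
      (trans (·-assoc _ _ u) (trans (cong (_· u) (trans (*-comm _ _) (⁻¹-inverse _ (norm≢0 g d)))) (sym (one-scale u)))))

    ϱ-inv-ϱ : ∀ g → M₂.det g ≢ 0# → ∀ u → ϱ-inv g (ϱ g u) ≡ u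
    ϱ-inv-ϱ g d u = trans (cong ((M₂.norm g ⁻¹) ·_) (ϱ-adj g u))
      (trans (·-assoc _ _ u) (trans (cong (_· u) (trans (*-comm _ _) (⁻¹-inverse _ (norm≢0 g d)))) (sym (one-scale u))))

    maps-ϱ-inv : ∀ g → M₂.det g ≢ 0# → MapsLines false (ϱ-inv g)
    maps-ϱ-inv g d = maps-∘ (maps-scale (inK-⁻¹ (norm≢0 g d) (M₂.norm∈ g)) (⁻¹-≢0 (norm≢0 g d)))
      (maps-ϱ (adj g) (λ e → d (trans (sym (det-adj g)) e)))

    transpose² : ∀ x → transpose (transpose x) ≡ x
    transpose² (_ ∷ _ ∷ _ ∷ _ ∷ []) = refl

    maps-id : MapsLines false (λ x → x)
    maps-id = maps λ b t t∉K → t , t∉K , onto (λ k → k , refl) (λ m → m , refl)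

    -- Commutators involve the inverse matrices as well, so ψ must be known to permute the lines
    -- too. It is identified with the explicit inverse of the factorization of φ.
    sandwich : ∀ {p c} (g d : M₂) → M₂.det g ≢ 0# → M₂.det d ≢ 0# → inK c → c ≢ 0# → (τ τ′ : V → V) → (∀ x → τ (τ′ x) ≡ x) →
      MapsLines p τ → MapsLines p τ′ → (∀ x → φ x ≡ ϱ-inv g (c · ϱ d (τ x))) → Decomposition
    sandwich {p} {c} g d g≢0 d≢0 c∈ c≢0 τ τ′ ττ′ maps-τ maps-τ′ φ≡ = record
      { p = p
      ; maps-φ = maps-≗ (λ x → sym (φ≡ x)) (maps-∘ (maps-ϱ-inv g g≢0) (maps-∘ (maps-scale c∈ c≢0) (maps-∘
          (maps-ϱ d d≢0) maps-τ)))
      ; maps-ψ = maps-≗ ψ≡ (subst (λ p → MapsLines p χ′) (Boolₚ.xor-identityʳ p)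
          (maps-∘ maps-τ′ (maps-∘ (maps-ϱ-inv d d≢0) (maps-∘ (maps-scale (inK-⁻¹ c≢0 c∈) (⁻¹-≢0 c≢0)) (maps-ϱ g g≢0))))) }
      where
      χ′ : V → V
      χ′ y = τ′ (ϱ-inv d ((c ⁻¹) · ϱ g y))
      φχ′ : ∀ y → φ (χ′ y) ≡ y
      φχ′ y = trans (φ≡ (χ′ y)) (trans (cong (λ z → ϱ-inv g (c · ϱ d z)) (ττ′ _)) (trans (cong (λ z → ϱ-inv g (c · z))
          (ϱ-ϱ-inv d d≢0 _))
        (trans (cong (ϱ-inv g) (trans (·-assoc c (c ⁻¹) (ϱ g y)) (trans (cong (_· ϱ g y) (⁻¹-inverse c c≢0)) (sym (one-scale
            (ϱ g y)))))) (ϱ-inv-ϱ g g≢0 y))))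
      ψ≡ : ∀ y → χ′ y ≡ ψ y
      ψ≡ y = trans (sym (leftInv (χ′ y))) (cong ψ (φχ′ y))

    -- With u and w the images of e_0 and e_∞, the map B = ϱ (adj g) ∘ φ, where g = (u w), fixes the points ε₁ and ε₄.
    -- Up to scalars it still takes rank one Hermitian matrices to such.

    decomposition : Decomposition
    decomposition = from (rank1-image ε₁-singular) (rank1-image ε₄-singular)
      where
      from : Rank1 (φ ε₁) → Rank1 (φ ε₄) → Decomposition
      from (r₁ , u₁ , u₂ , r₁∈ , r₁≢0 , u₁∈ , u₂∈ , φε₁≡) (r₄ , w₁ , w₂ , r₄∈ , r₄≢0 , w₁∈ , w₂∈ , φε₄≡) =
        shape (B-entries ε₂ ε₂∈ herm₂₁ herm₂₄) (B-entries ε₃ ε₃∈ herm₃₁ herm₃₄)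
        where
        g : M₂
        g = m₂ u₁∈ w₁∈ u₂∈ w₂∈
        D N a₁ a₄ : Carrier
        D = M₂.det g
        N = M₂.norm g
        ε₁∈ = kvec inK-1 inK-0 inK-0 inK-0
        ε₂∈ = kvec inK-0 inK-1 inK-0 inK-0
        ε₃∈ = kvec inK-0 inK-0 inK-1 inK-0
        ε₄∈ = kvec inK-0 inK-0 inK-0 inK-1
        herm-ε : ∀ x₁ x₂ x₃ x₄ → herm (x₁ ∷ x₂ ∷ x₃ ∷ x₄ ∷ []) ε₁ ≡ x₄ × herm (x₁ ∷ x₂ ∷ x₃ ∷ x₄ ∷ []) ε₄ ≡ x₁
        herm-ε x₁ x₂ x₃ x₄ =
          trans (cong₂ (λ y z → x₁ * z + x₂ * z + x₃ * z + x₄ * y) C.1-homo C.0-homo) (c x₁ x₂ x₃ x₄) ,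
          trans (cong₂ (λ y z → x₁ * y + x₂ * z + x₃ * z + x₄ * z) C.1-homo C.0-homo) (d x₁ x₂ x₃ x₄)
          where
          c = solve 4 (λ x₁ x₂ x₃ x₄ → x₁ :* :0 :+ x₂ :* :0 :+ x₃ :* :0 :+ x₄ :* :1 := x₄) refl
          d = solve 4 (λ x₁ x₂ x₃ x₄ → x₁ :* :1 :+ x₂ :* :0 :+ x₃ :* :0 :+ x₄ :* :0 := x₁) refl
        herm₂₁ : herm ε₂ ε₁ ≡ 0#
        herm₂₁ = proj₁ (herm-ε 0# 1# 0# 0#)
        herm₂₄ : herm ε₂ ε₄ ≡ 0#
        herm₂₄ = proj₂ (herm-ε 0# 1# 0# 0#)
        herm₃₁ : herm ε₃ ε₁ ≡ 0#
        herm₃₁ = proj₁ (herm-ε 0# 0# 1# 0#)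
        herm₃₄ : herm ε₃ ε₄ ≡ 0#
        herm₃₄ = proj₂ (herm-ε 0# 0# 1# 0#)
        -- The Hermitian product of φ ε₁ and φ ε₄ is a multiple of D, and by unitarity it is 1.
        D≢0 : D ≢ 0#
        D≢0 D≡0 = 1≢0 (trans (sym (proj₂ (herm-ε 1# 0# 0# 0#))) (trans (sym (unitary ε₁ ε₄ ε₁∈ ε₄∈)) (trans
            (cong₂ herm φε₁≡ φε₄≡)
          (trans (cong₂ _+_ (cong₂ _+_ (cong₂ _+_ (cj w₂∈) (cj w₂∈)) (cj w₁∈)) (cj w₁∈))
            (trans (e r₁ (conj r₄) u₁ u₂ (conj u₁) (conj u₂) w₁ w₂ (conj w₁) (conj w₂)) (*≡0ʳ D≡0))))))
          where
          cj : ∀ {z a b} → inK b → z * conj (r₄ * (a * conj b)) ≡ z * (conj r₄ * (conj a * b))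
          cj b∈ = cong (_ *_) (trans (C.*-homo _ _) (cong (conj r₄ *_) (trans (C.*-homo _ _) (cong (_ *_) (inK⇒conj² b∈)))))
          e = solve 10 (λ r r′ u₁ u₂ u₁′ u₂′ w₁ w₂ w₁′ w₂′ →
            r :* (u₁ :* u₁′) :* (r′ :* (w₂′ :* w₂)) :+ r :* (u₁ :* u₂′) :* (r′ :* (w₁′ :* w₂)) :+ r :* (u₂ :* u₁′) :* (r′ :*
                (w₂′ :* w₁)) :+ r :* (u₂ :* u₂′) :* (r′ :* (w₁′ :* w₁))
            := (r :* r′ :* (u₁′ :* w₂′ :+ w₁′ :* u₂′)) :* (u₁ :* w₂ :+ w₁ :* u₂)) refl
        D′≢0 : conj D ≢ 0#
        D′≢0 = C.≢0-homo D≢0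
        B : V → V
        B x = ϱ (adj g) (φ x)
        B-linear : Linear B
        B-linear x y u v = trans (cong (ϱ (adj g)) (act-linear mat x y u v)) (ϱ-linear (adj g) x y _ _)
        B-K : ∀ {x} → Kvec x → Kvec (B x)
        B-K {x} x∈ = ϱ-K (adj g) (φ x) (act-K mat x entriesK x∈)
        B-herm : ∀ x y → Kvec x → Kvec y → herm (B x) (B y) ≡ M₂.norm (adj g) * herm x y
        B-herm x y x∈ y∈ = trans (ϱ-herm (adj g) (φ x) (φ y)) (cong (M₂.norm (adj g) *_) (unitary x y x∈ y∈))
        a₁ = r₁ * (D * conj D)
        a₄ = r₄ * (D * conj D)
        a₁∈ : inK a₁
        a₁∈ = inK-* r₁∈ (M₂.norm∈ g)
        a₁≢0 : a₁ ≢ 0#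
        a₁≢0 = *-≢0 r₁≢0 (*-≢0 D≢0 D′≢0)
        a₄≢0 : a₄ ≢ 0#
        a₄≢0 = *-≢0 r₄≢0 (*-≢0 D≢0 D′≢0)
        B-pure : ∀ {v} r a b → φ v ≡ r · pure a b → B v ≡ r · pure (w₂ * a + w₁ * b) (u₂ * a + u₁ * b)
        B-pure r a b e = trans (cong (ϱ (adj g)) e) (trans (linear-· (ϱ-linear (adj g)) r (pure a b)) (cong (r ·_) (ϱ-pure
            (adj g) a b)))
        Bε₁≡ : B ε₁ ≡ a₁ ∷ 0# ∷ 0# ∷ 0# ∷ []
        Bε₁≡ = trans (B-pure r₁ u₁ u₂ φε₁≡) (trans (cong₂ (λ x y → r₁ · pure x y) (c u₁ u₂ w₁ w₂) (d u₁ u₂))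
          (vec≡ refl (trans (cong (λ z → r₁ * (D * z)) C.0-homo) (z₁ r₁ D)) (z₂ r₁ (conj D)) (z₂ r₁ (conj 0#))))
          where
          c = solve 4 (λ u₁ u₂ w₁ w₂ → w₂ :* u₁ :+ w₁ :* u₂ := u₁ :* w₂ :+ w₁ :* u₂) refl
          d = solve 2 (λ u₁ u₂ → u₂ :* u₁ :+ u₁ :* u₂ := :0) refl
          z₁ = solve 2 (λ r D → r :* (D :* :0) := :0) refl
          z₂ = solve 2 (λ r D → r :* (:0 :* D) := :0) refl
        Bε₄≡ : B ε₄ ≡ 0# ∷ 0# ∷ 0# ∷ a₄ ∷ []
        Bε₄≡ = trans (B-pure r₄ w₁ w₂ φε₄≡) (trans (cong₂ (λ x y → r₄ · pure x y) (d w₁ w₂) (c u₁ u₂ w₁ w₂))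
          (vec≡ (z₂ r₄ (conj 0#)) (z₂ r₄ (conj D)) (trans (cong (λ z → r₄ * (D * z)) C.0-homo) (z₁ r₄ D)) refl))
          where
          c = solve 4 (λ u₁ u₂ w₁ w₂ → u₂ :* w₁ :+ u₁ :* w₂ := u₁ :* w₂ :+ w₁ :* u₂) refl
          d = solve 2 (λ w₁ w₂ → w₂ :* w₁ :+ w₁ :* w₂ := :0) refl
          z₁ = solve 2 (λ r D → r :* (D :* :0) := :0) refl
          z₂ = solve 2 (λ r D → r :* (:0 :* D) := :0) refl
        -- `B` preserves the Hermitian form up to a factor and fixes the points ε₁ and ε₄, so it
        -- preserves the vectors orthogonal to both, which are spanned by ε₂ and ε₃.
        B-entries : ∀ x → Kvec x → herm x ε₁ ≡ 0# → herm x ε₄ ≡ 0# → ∃[ p ] ∃[ r ] (inK p × inK r × B x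
            ≡ 0# ∷ p ∷ r ∷ 0# ∷ [])
        B-entries x x∈ e₁ e₄ = entries (B x) (B-K x∈) (orth ε₁ ε₁∈ e₁ Bε₁≡) (orth ε₄ ε₄∈ e₄ Bε₄≡)
          where
          orth : ∀ ε {b} → Kvec ε → herm x ε ≡ 0# → B ε ≡ b → herm (B x) b ≡ 0#
          orth ε ε∈ e refl = trans (B-herm x ε x∈ ε∈) (*≡0ʳ e)
          entries : ∀ y → Kvec y → herm y (a₁ ∷ 0# ∷ 0# ∷ 0# ∷ []) ≡ 0# → herm y (0# ∷ 0# ∷ 0# ∷ a₄ ∷ []) ≡ 0# →
              ∃[ p ] ∃[ r ] (inK p × inK r × y ≡ 0# ∷ p ∷ r ∷ 0# ∷ [])
          entries (y₁ ∷ y₂ ∷ y₃ ∷ y₄ ∷ []) y∈ h₁ h₄ = y₂ , y₃ , y∈ (suc zero) , y∈ (suc (suc zero)) ,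
              vec≡ y₁≡0 refl refl y₄≡0
            where
            c = solve 5 (λ a y₁ y₂ y₃ y₄ → a :* y₄ := y₁ :* :0 :+ y₂ :* :0 :+ y₃ :* :0 :+ y₄ :* a) refl
            d = solve 5 (λ a y₁ y₂ y₃ y₄ → a :* y₁ := y₁ :* a :+ y₂ :* :0 :+ y₃ :* :0 :+ y₄ :* :0) refl
            y₄≡0 : y₄ ≡ 0#
            y₄≡0 = integral (C.≢0-homo a₁≢0) (trans (c (conj a₁) y₁ y₂ y₃ y₄) (trans (cong (λ z → y₁ * z + y₂ * z + y₃ * z
                + y₄ * conj a₁) (sym C.0-homo)) h₁))
            y₁≡0 : y₁ ≡ 0#
            y₁≡0 = integral (C.≢0-homo a₄≢0) (trans (d (conj a₄) y₁ y₂ y₃ y₄) (trans (cong (λ z → y₁ * conj a₄ + y₂ * z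
                + y₃ * z + y₄ * z) (sym C.0-homo)) h₄))
        D₁≢0 : M₂.det (adj g) ≢ 0#
        D₁≢0 e = D≢0 (trans (sym (det-adj g)) e)
        φ≡ : ∀ x → φ x ≡ ϱ-inv (adj g) (B x)
        φ≡ x = sym (ϱ-inv-ϱ (adj g) D₁≢0 (φ x))
        shape : ∃[ p ] ∃[ r ] (inK p × inK r × B ε₂ ≡ 0# ∷ p ∷ r ∷ 0# ∷ []) → ∃[ q ] ∃[ s ] (inK q × inK s × B ε₃
            ≡ 0# ∷ q ∷ s ∷ 0# ∷ []) → Decomposition
        shape (p , r , p∈ , r∈ , Bε₂≡) (q′ , s , q∈ , s∈ , Bε₃≡) = cases (Mono.shape B B≡)
          where
          B≡ : ∀ x₁ x₂ x₃ x₄ → B (x₁ ∷ x₂ ∷ x₃ ∷ x₄ ∷ []) ≡ a₁ * x₁ ∷ p * x₂ + q′ * x₃ ∷ r * x₂ + s * x₃ ∷ a₄ * x₄ ∷ []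
          B≡ = linear-ε B-linear Bε₁≡ Bε₂≡ Bε₃≡ Bε₄≡
          rank1 : ∀ x → inK x → ∃[ R ] ∃[ m ] ∃[ n ] (inK m × a₁ * 1# ∷ p * conj x + q′ * x ∷ r * conj x + s * x ∷ a₄ *
              (x * conj x) ∷ [] ≡ R · pure m n)
          rank1 x x∈ = at (rank1-image (ν-singular x∈))
            where
            at : Rank1 (φ (ν x)) → ∃[ R ] ∃[ m ] ∃[ n ] (inK m × a₁ * 1# ∷ p * conj x + q′ * x ∷ r * conj x + s * x ∷ a₄ *
                (x * conj x) ∷ [] ≡ R · pure m n)
            at (R , a , b , _ , _ , a∈ , b∈ , e) = R , w₂ * a + w₁ * b , u₂ * a + u₁ * b , inK-+ (inK-* w₂∈ a∈)
                (inK-* w₁∈ b∈) ,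
              trans (sym (B≡ 1# (conj x) x (x * conj x))) (B-pure R a b e)
          module Mono = Monomial θ∈K θ∉Fq a₁ p q′ r s a₄ a₁∈ r∈ s∈ a₁≢0 a₄≢0 rank1
          cases : Mono.Diagonal B ⊎ Mono.Twisted-Diagonal B → Decomposition
          cases (inj₁ (n , n∈ , n≢0 , B-diagonal)) = sandwich {false} (adj g) (Mono.diagonal n∈) D₁≢0
              (Mono.diagonal-det n∈ n≢0) Mono.i∈ Mono.i≢0
            (λ x → x) (λ x → x) (λ _ → refl) maps-id maps-id (λ x → trans (φ≡ x) (cong (ϱ-inv (adj g)) (B-diagonal x)))
          cases (inj₂ (n , n∈ , n≢0 , B-diagonal)) = sandwich {true} (adj g) (Mono.diagonal n∈) D₁≢0
              (Mono.diagonal-det n∈ n≢0) Mono.i∈ Mono.i≢0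
            transpose transpose transpose² maps-transpose maps-transpose (λ x → trans (φ≡ x) (cong (ϱ-inv (adj g))
                (B-diagonal x)))

-- Unimodular matrices as elements of the stabilizer

module StabilizerElements {h : ℕ} (F : FiniteFieldQ4 h) where
  open Geometry F
  open FieldTheory F
  open Vectors F
  open Matrices F
  private
    module C = Endo conj-endo

  -- The Kronecker product of g with its conjugate.
  ϱ-mat : M₂ → Mat
  ϱ-mat g =
    (α * conj α ∷ α * conj β ∷ β * conj α ∷ β * conj β ∷ []) ∷
    (α * conj γ ∷ α * conj δ ∷ β * conj γ ∷ β * conj δ ∷ []) ∷
    (γ * conj α ∷ γ * conj β ∷ δ * conj α ∷ δ * conj β ∷ []) ∷
    (γ * conj γ ∷ γ * conj δ ∷ δ * conj γ ∷ δ * conj δ ∷ []) ∷ []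
    where open M₂ g

  act-ϱ-mat : ∀ g x → act (ϱ-mat g) x ≡ ϱ g x
  act-ϱ-mat g (x₁ ∷ x₂ ∷ x₃ ∷ x₄ ∷ []) = vec≡ (c α β (conj α) (conj β) x₁ x₂ x₃ x₄) (c α β (conj γ) (conj δ) x₁ x₂ x₃ x₄)
    (c γ δ (conj α) (conj β) x₁ x₂ x₃ x₄) (c γ δ (conj γ) (conj δ) x₁ x₂ x₃ x₄)
    where
    open M₂ g
    c = solve 8 (λ a b p q x₁ x₂ x₃ x₄ →
      a :* p :* x₁ :+ (a :* q :* x₂ :+ (b :* p :* x₃ :+ (b :* q :* x₄ :+ :0))) := (a :* x₁ :+ b :* x₃) :* p :+ (a :* x₂
          :+ b :* x₄) :* q) refl

  ϱ-mat-K : ∀ g i → Kvec (lookup (ϱ-mat g) i)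
  ϱ-mat-K g = rows
    where
    open M₂ g
    row : ∀ {a b p q} → inK a → inK b → inK p → inK q → Kvec (a * conj p ∷ a * conj q ∷ b * conj p ∷ b * conj q ∷ [])
    row a∈ b∈ p∈ q∈ = kvec (inK-* a∈ (inK-conj p∈)) (inK-* a∈ (inK-conj q∈)) (inK-* b∈ (inK-conj p∈)) (inK-* b∈
        (inK-conj q∈))
    rows : ∀ i → Kvec (lookup (ϱ-mat g) i)
    rows zero = row α∈ β∈ α∈ β∈
    rows (suc zero) = row α∈ β∈ γ∈ δ∈
    rows (suc (suc zero)) = row γ∈ δ∈ α∈ β∈
    rows (suc (suc (suc zero))) = row γ∈ δ∈ γ∈ δ∈

  Vhat-0 : Vhat zeroV
  Vhat-0 = 0# , 0# , 0# , C.0-homo , inK-0 , C.0-homo , vec≡ refl (sym C.0-homo) refl refl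

  Vhat-lin : ∀ {c u v} → inFq c → Vhat u → Vhat v → Vhat ((c · u) +V v)
  Vhat-lin {c} c∈ (α , x , β , α∈ , x∈ , β∈ , refl) (α′ , x′ , β′ , α′∈ , x′∈ , β′∈ , refl) =
    c * α + α′ , c * x + x′ , c * β + β′ , inFq-+ (inFq-* c∈ α∈) α′∈ , inK-+ (inK-* (inFq⇒inK c∈) x∈) x′∈ , inFq-+
        (inFq-* c∈ β∈) β′∈ ,
    vec≡ refl (sym (trans (C.+-homo _ _) (cong (_+ conj x′) (trans (C.*-homo _ _) (cong (_* conj x) c∈))))) refl refl

  Vhat-lincomb : ∀ {n} (cs : Vec Carrier n) (gs : Vec V n) → AllVec inFq cs → AllVec Vhat gs → Vhat (lincomb cs gs)
  Vhat-lincomb [] [] _ _ = Vhat-0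
  Vhat-lincomb (c ∷ cs) (g ∷ gs) cs∈ gs∈ = Vhat-lin (cs∈ zero) (gs∈ zero) (Vhat-lincomb cs gs (cs∈ ∘ suc) (gs∈ ∘ suc))

  lincomb-map : ∀ {φ} → Linear φ → ∀ {n} (cs : Vec Carrier n) (gs : Vec V n) → lincomb cs (Vec.map φ gs) ≡ φ (lincomb cs gs)
  lincomb-map lin [] [] = sym (linear-0 lin)
  lincomb-map {φ} lin (c ∷ cs) (g ∷ gs) = trans (cong₂ _+V_ (sym (linear-· lin c g)) (lincomb-map lin cs gs)) (sym
      (linear-+ lin (c · g) (lincomb cs gs)))

  ϱ-Vhat : ∀ g {v} → Vhat v → Vhat (ϱ g v)
  ϱ-Vhat g {v} v∈ = †⇒Vhat (ϱ-K g v (Vhat⇒K v∈)) (trans (ϱ-† g v) (cong (ϱ g) (Vhat⇒† v∈)))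

  -- `Qhat` reads the conjugate of x₃ in place of x₂, so the two agree on `V̂` only. The determinant
  -- is the polynomial form, which `ϱ` rescales on all of `V`.
  determinant : V → Carrier
  determinant (x₁ ∷ x₂ ∷ x₃ ∷ x₄ ∷ []) = x₁ * x₄ + x₃ * x₂

  Qhat≡determinant : ∀ {v} → Vhat v → Qhat v ≡ determinant v
  Qhat≡determinant (_ , _ , _ , _ , _ , _ , refl) = refl

  determinant-ϱ : ∀ g v → determinant (ϱ g v) ≡ M₂.norm g * determinant v
  determinant-ϱ g (x₁ ∷ x₂ ∷ x₃ ∷ x₄ ∷ []) = trans (c α β γ δ (conj α) (conj β) (conj γ) (conj δ) x₁ x₂ x₃ x₄) (cong (_*
      (x₁ * x₄ + x₃ * x₂)) (sym norm≡))
    where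
    open M₂ g
    c = solve 12 (λ α β γ δ α′ β′ γ′ δ′ x₁ x₂ x₃ x₄ →
      ((α :* x₁ :+ β :* x₃) :* α′ :+ (α :* x₂ :+ β :* x₄) :* β′) :* ((γ :* x₁ :+ δ :* x₃) :* γ′ :+ (γ :* x₂
          :+ δ :* x₄) :* δ′)
      :+ ((γ :* x₁ :+ δ :* x₃) :* α′ :+ (γ :* x₂ :+ δ :* x₄) :* β′) :* ((α :* x₁ :+ β :* x₃) :* γ′ :+ (α :* x₂
          :+ β :* x₄) :* δ′)
      := (α :* δ :+ β :* γ) :* (α′ :* δ′ :+ β′ :* γ′) :* (x₁ :* x₄ :+ x₃ :* x₂)) refl

  module _ (g : M₂) where
    private
      φ : V → V
      φ = act (ϱ-mat g)

    singular-map : ∀ {n} {gs : Vec V n} → Singular (n , gs) → Singular (n , Vec.map φ gs)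
    singular-map {n} {gs} (gs∈ , Q≡0) =
      (λ i → subst Vhat (sym (trans (Vecₚ.lookup-map i φ gs) (act-ϱ-mat g (lookup gs i)))) (ϱ-Vhat g (gs∈ i))) ,
      λ cs cs∈ → let v∈ = Vhat-lincomb cs gs cs∈ gs∈ in
        trans (cong Qhat (trans (lincomb-map (act-linear (ϱ-mat g)) cs gs) (act-ϱ-mat g (lincomb cs gs))))
          (trans (Qhat≡determinant (ϱ-Vhat g v∈)) (trans (determinant-ϱ g (lincomb cs gs)) (*≡0ʳ (trans (sym
              (Qhat≡determinant v∈)) (Q≡0 cs cs∈)))))

    mapsOnto-map : ∀ {n} (gs : Vec V n) → MapsOnto (ϱ-mat g) (Ext (n , gs)) (Ext (n , Vec.map φ gs))
    mapsOnto-map gs w =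
      (λ { (cs , cs∈ , e) → lincomb cs gs , (cs , cs∈ , refl) , trans e (lincomb-map (act-linear (ϱ-mat g)) cs gs) }) ,
      (λ { (u , (cs , cs∈ , e) , w≡) → cs , cs∈ , trans w≡ (trans (cong φ e) (sym (lincomb-map (act-linear (ϱ-mat g)) cs gs))) })

  -- For determinant 1 the factor `norm` is 1 as well, so `ϱ g` is unitary and `adj g` gives its
  -- exact inverse.
  stab : (g : M₂) → M₂.det g ≡ 1# → StabElt
  stab g det≡1 = record
    { mat = ϱ-mat g
    ; inv = ϱ-mat (adj g)
    ; entriesK = ϱ-mat-K g
    ; invEntriesK = ϱ-mat-K (adj g)
    ; leftInv = λ x → trans (act-ϱ-mat (adj g) _) (trans (cong (ϱ (adj g)) (act-ϱ-mat g x)) (trans (ϱ-adj g x) (unscale x)))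
    ; rightInv = right
    ; unitary = λ x y _ _ → trans (cong₂ herm (act-ϱ-mat g x) (act-ϱ-mat g y)) (trans (ϱ-herm g x y) (trans (cong
        (_* herm x y) norm≡1) (*-identityˡ _)))
    ; stabFwd = λ { (n , gs) S → (n , Vec.map (act (ϱ-mat g)) gs) , singular-map g S , mapsOnto-map g gs }
    -- The family is pulled back along `adj g`; mapping it forward again returns the same list of
    -- generators.
    ; stabBwd = λ { (n , gs) S → (n , Vec.map (act (ϱ-mat (adj g))) gs) , singular-map (adj g) S ,
        subst (λ gs′ → MapsOnto (ϱ-mat g) (Ext (n , Vec.map (act (ϱ-mat (adj g))) gs)) (Ext (n , gs′))) (roundtrip gs)
            (mapsOnto-map g _) }
    }
    where
    norm≡1 : M₂.norm g ≡ 1#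
    norm≡1 = trans (cong (λ d → d * conj d) det≡1) (trans (*-identityˡ _) C.1-homo)
    unscale : ∀ x → M₂.norm g · x ≡ x
    unscale x = trans (cong (_· x) norm≡1) (sym (one-scale x))
    right : ∀ x → act (ϱ-mat g) (act (ϱ-mat (adj g)) x) ≡ x
    right x = trans (act-ϱ-mat g _) (trans (cong (ϱ g) (act-ϱ-mat (adj g) x)) (trans (ϱ-adj′ g x) (unscale x)))
    roundtrip : ∀ {n} (gs : Vec V n) → Vec.map (act (ϱ-mat g)) (Vec.map (act (ϱ-mat (adj g))) gs) ≡ gs
    roundtrip gs = trans (sym (Vecₚ.map-∘ _ _ gs)) (trans (Vecₚ.map-cong right gs) (Vecₚ.map-id gs))

-- Orbits of the commutator subgroup and the isomorphism

module Orbits {h : ℕ} (F : FiniteFieldQ4 h) where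
  open Geometry F
  open FieldTheory F
  open Vectors F
  open Matrices F
  open LineMaps F
  open StabilizerElements F
  open Classification F using (twist; isTwist; module Twisted)
  private
    module B = Endo bar-endo
    module C = Endo conj-endo

  onto-stab : ∀ g (e : M₂.det g ≡ 1#) b {t t′} → ¬ inK t → t′ * (M₂.α g + M₂.β g * t) ≡ M₂.γ g + M₂.δ g * t →
    ¬ inK t′ × Onto (act (ϱ-mat g)) b t b t′
  onto-stab g e b t∉K eq = proj₁ o , onto-≗ (λ x → sym (act-ϱ-mat g x)) (proj₂ o)
    where o = onto-ϱ g (λ z → 1≢0 (trans (sym e) z)) b t∉K eq

  diag : ∀ {d i} → inK d → inK i → M₂
  diag d∈ i∈ = m₂ i∈ inK-0 inK-0 d∈

  shear : ∀ {c} → inK c → M₂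
  shear c∈ = m₂ inK-1 inK-0 c∈ inK-1

  swap-matrix : M₂
  swap-matrix = m₂ inK-0 inK-1 inK-1 inK-0

  diag-det : ∀ {d i} (d∈ : inK d) (i∈ : inK i) → d * i ≡ 1# → M₂.det (diag d∈ i∈) ≡ 1#
  diag-det {d} {i} _ _ e = trans (c d i) e
    where
    c = solve 2 (λ d i → i :* d :+ :0 :* :0 := d :* i) refl

  shear-det : ∀ {c} (c∈ : inK c) → M₂.det (shear c∈) ≡ 1#
  shear-det {c} _ = e c
    where
    e = solve 1 (λ c → :1 :* :1 :+ :0 :* c := :1) refl

  swap-det : M₂.det swap-matrix ≡ 1#
  swap-det = trans (+-comm _ _) (trans (cong (1# * 1# +_) (zeroˡ 0#)) (trans (+-identityʳ _) (*-identityˡ 1#)))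

  chain : ∀ {φ₁ φ₂ φ₃ φ₄ b t₀ t₁ t₂ t₃ t₄} → Onto φ₄ b t₃ b t₄ → Onto φ₃ b t₂ b t₃ → Onto φ₂ b t₁ b t₂ → Onto φ₁ b t₀ b t₁ →
    Onto (λ x → φ₄ (φ₃ (φ₂ (φ₁ x)))) b t₀ b t₄
  chain o₄ o₃ o₂ o₁ = onto-∘ o₄ (onto-∘ o₃ (onto-∘ o₂ o₁))

  -- The commutator of t ↦ d² t and t ↦ 1/t is t ↦ d⁻⁴ t.

  scaling : ∀ {d i} → inK d → inK i → d * i ≡ 1# → ∃[ p ] (∀ b {t} → ¬ inK t → Onto (actComm p) b t b (i * i * (i * i * t)))
  scaling {d} {i} d∈ i∈ di≡1 = (stab D D-det , stab swap-matrix swap-det) , image-of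
    where
    D : M₂
    D = diag d∈ i∈
    D-det : M₂.det D ≡ 1#
    D-det = diag-det d∈ i∈ di≡1
    image-of : ∀ b {t} → ¬ inK t → Onto (actComm (stab D D-det , stab swap-matrix swap-det)) b t b (i * i * (i * i * t))
    image-of b {t} t∉K = chain (proj₂ o₄) (proj₂ o₃) (proj₂ o₂) (proj₂ o₁)
      where
      u : Carrier
      u = t ⁻¹
      t≢0 : t ≢ 0#
      t≢0 refl = t∉K inK-0
      tu : t * u ≡ 1#
      tu = ⁻¹-inverse t t≢0
      c₁ = solve 2 (λ t u → u :* (:0 :+ :1 :* t) := :1 :+ :0 :* t :+ :1 :* (t :* u :+ :1)) refl
      o₁ : ¬ inK u × Onto (act (ϱ-mat swap-matrix)) b t b u
      o₁ = onto-stab swap-matrix swap-det b t∉K (lc₁ (c₁ t u) tu)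
      c₂ = solve 3 (λ d i u → d :* d :* u :* (i :+ :0 :* u) := :0 :+ d :* u :+ (d :* u) :* (d :* i :+ :1)) refl
      o₂ : ¬ inK (d * d * u) × Onto (act (ϱ-mat D)) b u b (d * d * u)
      o₂ = onto-stab D D-det b (proj₁ o₁) (lc₁ (c₂ d i u) di≡1)
      c₃ = solve 4 (λ d i t u →
        i :* i :* t :* (:0 :+ :1 :* (d :* d :* u)) := :1 :+ :0 :* (d :* d :* u) :+ (d :* i :+ :1) :* (d :* i :+ :1) :+
            (d :* d :* i :* i) :* (t :* u :+ :1)) refl
      o₃ : ¬ inK (i * i * t) × Onto (act (ϱ-mat (adj swap-matrix))) b (d * d * u) b (i * i * t)
      o₃ = onto-stab (adj swap-matrix) swap-det b (proj₁ o₂) (lc₂ (c₃ d i t u) di≡1 tu)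
      c₄ = solve 3 (λ d i t → i :* i :* t :* (d :+ :0 :* t) := :0 :+ i :* t :+ (i :* t) :* (d :* i :+ :1)) refl
      o₄ : ¬ inK (i * i * (i * i * t)) × Onto (act (ϱ-mat (adj D))) b (i * i * t) b (i * i * (i * i * t))
      o₄ = onto-stab (adj D) (trans (det-adj D) D-det) b (proj₁ o₃) (lc₁ (c₄ d i (i * i * t)) di≡1)

  -- The commutator of t ↦ d² t and t ↦ t + c is t ↦ t + (1 + d⁻²) c.

  translation : ∀ {d i c} → inK d → inK i → inK c → d * i ≡ 1# → ∃[ p ] (∀ b {t} → ¬ inK t → Onto (actComm p) b t b (t + (1#
      + i * i) * c))
  translation {d} {i} {c} d∈ i∈ c∈ di≡1 = (stab D D-det , stab S S-det) , image-of
    where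
    D S : M₂
    D = diag d∈ i∈
    S = shear c∈
    D-det : M₂.det D ≡ 1#
    D-det = diag-det d∈ i∈ di≡1
    S-det : M₂.det S ≡ 1#
    S-det = shear-det c∈
    image-of : ∀ b {t} → ¬ inK t → Onto (actComm (stab D D-det , stab S S-det)) b t b (t + (1# + i * i) * c)
    image-of b {t} t∉K = chain (proj₂ o₄) (proj₂ o₃) (proj₂ o₂) (proj₂ o₁)
      where
      e₁ = solve 2 (λ t c → (t :+ c) :* (:1 :+ :0 :* t) := c :+ :1 :* t) refl
      o₁ : ¬ inK (t + c) × Onto (act (ϱ-mat S)) b t b (t + c)
      o₁ = onto-stab S S-det b t∉K (e₁ t c)
      e₂ = solve 3 (λ d i u → d :* d :* u :* (i :+ :0 :* u) := :0 :+ d :* u :+ (d :* u) :* (d :* i :+ :1)) refl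
      o₂ : ¬ inK (d * d * (t + c)) × Onto (act (ϱ-mat D)) b (t + c) b (d * d * (t + c))
      o₂ = onto-stab D D-det b (proj₁ o₁) (lc₁ (e₂ d i (t + c)) di≡1)
      o₃ : ¬ inK (d * d * (t + c) + c) × Onto (act (ϱ-mat (adj S))) b (d * d * (t + c)) b (d * d * (t + c) + c)
      o₃ = onto-stab (adj S) (trans (det-adj S) S-det) b (proj₁ o₂) (e₁ (d * d * (t + c)) c)
      e₄ = solve 4 (λ d i t c →
        (t :+ (:1 :+ i :* i) :* c) :* (d :+ :0 :* (d :* d :* (t :+ c) :+ c)) := :0 :+ i :* (d :* d :* (t :+ c) :+ c) :+
            (d :* t :+ d :* c :+ i :* c) :* (d :* i :+ :1)) refl
      o₄ : ¬ inK (t + (1# + i * i) * c) × Onto (act (ϱ-mat (adj D))) b (d * d * (t + c) + c) b (t + (1# + i * i) * c)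
      o₄ = onto-stab (adj D) (trans (det-adj D) D-det) b (proj₁ o₃) (lc₁ (e₄ d i t c) di≡1)

  √-K : ∀ {x} → inK x → inK (√ x)
  √-K {x} x∈ = trans (bar≡conj² _) (trans (cong conj (conj-√ x)) (trans (conj-√ (conj x)) (cong √ (inK⇒conj² x∈))))

  -- Every t outside `K` is x + y t₀ with x and y in `K`, so the affine maps over `K` are already
  -- transitive.
  transitive : 1 ≤ h → ∀ {θ} → inK θ → ¬ inFq θ → ∀ b {t₀ t} → ¬ inK t₀ → ¬ inK t → ∃[ gs ] Onto (actΩ gs) b t₀ b t
  transitive 1≤h {θ} θ∈ θ∉Fq b {t₀} {t} t₀∉K t∉K = from (Conjugates.coordinates t₀∉K (bar-bar t))
    where
    θ≢0 : θ ≢ 0#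
    θ≢0 e = θ∉Fq (trans (cong conj e) (trans C.0-homo (sym e)))
    1+θ²≢0 : 1# + θ * θ ≢ 0#
    1+θ²≢0 e = *-≢0 1+θ≢0 1+θ≢0 (trans (sq θ) e)
      where
      1+θ≢0 : 1# + θ ≢ 0#
      1+θ≢0 z = θ∉Fq (trans (cong conj (sym (≡0-+ z))) (trans C.1-homo (≡0-+ z)))
      sq = solve 1 (λ θ → (:1 :+ θ) :* (:1 :+ θ) := :1 :+ θ :* θ) refl
    from : ∃[ x ] ∃[ y ] (inK x × inK y × t ≡ x + y * t₀) → ∃[ gs ] Onto (actΩ gs) b t₀ b t
    from (x , y , x∈ , y∈ , t≡) = combine (scaling (inK-⁻¹ i≢0 i∈) i∈ (trans (*-comm _ _) (⁻¹-inverse i i≢0)))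
        (translation (inK-⁻¹ θ≢0 θ∈) θ∈ c∈ (trans (*-comm _ _) (⁻¹-inverse θ θ≢0)))
      where
      y≢0 : y ≢ 0#
      y≢0 y≡0 = t∉K (subst inK (sym (trans t≡ (trans (cong (x +_) (*≡0ˡ y≡0)) (+-identityʳ x)))) x∈)
      -- The scaling multiplies by i⁴, and every element of `K` is a fourth power because squaring
      -- is bijective.
      i : Carrier
      i = √ (√ y)
      i∈ : inK i
      i∈ = √-K (√-K y∈)
      i⁴≡y : (i * i) * (i * i) ≡ y
      i⁴≡y = trans (cong₂ _*_ (√-square 1≤h _) (√-square 1≤h _)) (√-square 1≤h y)
      i≢0 : i ≢ 0#
      i≢0 e = y≢0 (trans (sym i⁴≡y) (*≡0ˡ (*≡0ˡ e)))
      -- With i = θ the translation moves by (1 + θ²) c; here 1 + θ² = (1 + θ)² is invertible as θ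
      -- is not in `F_q`.
      c : Carrier
      c = x * (1# + θ * θ) ⁻¹
      c∈ : inK c
      c∈ = inK-* x∈ (inK-⁻¹ 1+θ²≢0 (inK-+ inK-1 (inK-* θ∈ θ∈)))
      scaled≡ : i * i * (i * i * t₀) ≡ y * t₀
      scaled≡ = trans (sym (*-assoc (i * i) (i * i) t₀)) (cong (_* t₀) i⁴≡y)
      it₀∉K : ¬ inK (i * i * (i * i * t₀))
      it₀∉K e = t∉K (subst inK (sym (trans t≡ (cong (x +_) (sym scaled≡)))) (inK-+ x∈ e))
      image≡ : i * i * (i * i * t₀) + (1# + θ * θ) * c ≡ t
      image≡ = trans (lc₁ (e (i * i * (i * i * t₀)) x (1# + θ * θ) ((1# + θ * θ) ⁻¹)) (⁻¹-inverse _ 1+θ²≢0)) (trans (cong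
          (x +_) scaled≡) (sym t≡))
        where
        e = solve 4 (λ z x w i → z :+ w :* (x :* i) := x :+ z :+ x :* (w :* i :+ :1)) refl
      combine : ∃[ p ] (∀ b {t} → ¬ inK t → Onto (actComm p) b t b (i * i * (i * i * t))) →
        ∃[ p ] (∀ b {t} → ¬ inK t → Onto (actComm p) b t b (t + (1# + θ * θ) * c)) → ∃[ gs ] Onto (actΩ gs) b t₀ b t
      combine (p , S) (p′ , T) = p′ ∷ p ∷ [] ,
        subst (λ t′ → Onto (λ v → actComm p′ (actComm p v)) b t₀ b t′) image≡ (onto-∘ (T b it₀∉K) (S b t₀∉K))

  actComm-linear : ∀ p → Linear (actComm p)
  actComm-linear (A , A′) x y u v = trans (cong (a ∘ b ∘ c) (act-linear (StabElt.mat A′) x y u v)) (trans (cong (a ∘ b)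
      (act-linear (StabElt.mat A) x y _ _))
    (trans (cong a (act-linear (StabElt.inv A′) x y _ _)) (act-linear (StabElt.inv A) x y _ _)))
    where
    a b c : V → V
    a = act (StabElt.inv A)
    b = act (StabElt.inv A′)
    c = act (StabElt.mat A)

  actΩ-linear : ∀ gs → Linear (actΩ gs)
  actΩ-linear [] x y u v = refl
  actΩ-linear (p ∷ gs) x y u v = trans (cong (actComm p) (actΩ-linear gs x y u v)) (actComm-linear p x y _ _)

  -- Whether the families are exchanged is a homomorphism to a group of order 2, and it is trivial
  -- on commutators.
  xor-commutator : ∀ p p′ → p xor (p′ xor (p xor p′)) ≡ false
  xor-commutator false false = refl
  xor-commutator false true = refl
  xor-commutator true false = refl
  xor-commutator true true = refl

  module _ {θ : Carrier} (θ∈K : inK θ) (θ∉Fq : ¬ inFq θ) where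

    maps-actComm : ∀ p → MapsLines false (actComm p)
    maps-actComm (A , A′) = subst (λ p → MapsLines p (actComm (A , A′))) (xor-commutator D.p D′.p)
      (maps-∘ D.maps-ψ (maps-∘ D′.maps-ψ (maps-∘ D.maps-φ D′.maps-φ)))
      where
      module D = Stabilizer.Decomposition (Stabilizer.decomposition A θ∈K θ∉Fq)
      module D′ = Stabilizer.Decomposition (Stabilizer.decomposition A′ θ∈K θ∉Fq)

    maps-actΩ : ∀ gs → MapsLines false (actΩ gs)
    maps-actΩ [] = maps λ b t t∉K → t , t∉K , onto (λ k → k , refl) (λ m → m , refl)
    maps-actΩ (p ∷ gs) = maps-∘ (maps-actComm p) (maps-actΩ gs)

  module _ (l : HLine) {b : Bool} {t₀ : Carrier} (t₀∉K : ¬ inK t₀) (l≅ : l ≅ Twisted.Line.line b t₀∉K) where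

    image-line : ∀ {Φ} → Linear Φ → ∀ {t} (t∉K : ¬ inK t) → Onto Φ b t₀ b t →
      ∀ w → (OnSpan (Φ (proj₁ (proj₁ l)) , Φ (proj₂ (proj₁ l))) w → OnSpan (Twisted.Line.points b t∉K) w)
          × (OnSpan (Twisted.Line.points b t∉K) w → OnSpan (Φ (proj₁ (proj₁ l)) , Φ (proj₂ (proj₁ l))) w)
    image-line {Φ} lin {t} t∉K o w = to , from
      where
      open Twisted b using (module Line)
      to : OnSpan (Φ (proj₁ (proj₁ l)) , Φ (proj₂ (proj₁ l))) w → OnSpan (Line.points t∉K) w
      to (x , y , x∈ , y∈ , w≡) = at (Line.span⇒T t₀∉K (proj₁ (l≅ _) (x , y , x∈ , y∈ , refl)))
        where
        at : ∃[ k ] ((x · proj₁ (proj₁ l)) +V (y · proj₂ (proj₁ l)) ≡ point b t₀ k) → OnSpan (Line.points t∉K) w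
        at (k , e) = subst (OnSpan (Line.points t∉K)) (sym (trans w≡ (trans (sym (lin x y _ _)) (trans (cong Φ e) (proj₂
            (forth o k)))))) (Line.span-T t∉K _)
      from : OnSpan (Line.points t∉K) w → OnSpan (Φ (proj₁ (proj₁ l)) , Φ (proj₂ (proj₁ l))) w
      from q = at (Line.span⇒T t∉K q)
        where
        at : ∃[ m ] (w ≡ point b t m) → OnSpan (Φ (proj₁ (proj₁ l)) , Φ (proj₂ (proj₁ l))) w
        at (m , w≡) = at′ (proj₂ (l≅ _) (Line.span-T t₀∉K (proj₁ (back o m))))
          where
          at′ : OnSpan (proj₁ l) (point b t₀ (proj₁ (back o m))) → OnSpan (Φ (proj₁ (proj₁ l)) , Φ (proj₂ (proj₁ l))) w
          at′ (x , y , x∈ , y∈ , e) = x , y , x∈ , y∈ , trans w≡ (trans (proj₂ (back o m)) (trans (cong Φ e) (lin x y _ _)))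

  module Isomorphism (1≤h : 1 ≤ h) (l₀ : HLine) {θ : Carrier} (θ∈K : inK θ) (θ∉Fq : ¬ inFq θ)
    (b : Bool) {t₀ : Carrier} (t₀∉K : ¬ inK t₀) (l₀≅ : l₀ ≅ Twisted.Line.line b t₀∉K) where
    open Incidence F (isTwist b) public using (φ; RE⇔RH)

    in-orbit : ∀ t → InOrbit l₀ (φ t)
    in-orbit (t , t∉K) = at (transitive 1≤h θ∈K θ∉Fq b t₀∉K t∉K)
      where
      at : ∃[ gs ] Onto (actΩ gs) b t₀ b t → InOrbit l₀ (φ (t , t∉K))
      at (gs , o) = gs , image-line l₀ t₀∉K l₀≅ (actΩ-linear gs) t∉K o

    same⇒≅ : ∀ s t → sameE s t → φ s ≅ φ t
    same⇒≅ (_ , s∉K) (_ , t∉K) = Twisted.same-line b s∉K t∉K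

    ≅⇒same : ∀ s t → φ s ≅ φ t → sameE s t
    ≅⇒same (_ , s∉K) (_ , t∉K) = Twisted.≅⇒same b s∉K t∉K

    -- A product of commutators takes the line of t₀ to a line of the same family b, and every line
    -- of that family is a value of `φ`.
    surjective : ∀ m → InOrbit l₀ m → ∃[ t ] (φ t ≅ m)
    surjective m (gs , e) = at (image (maps-actΩ θ∈K θ∉Fq gs) b t₀ t₀∉K)
      where
      at : ∃[ t ] (¬ inK t × Onto (actΩ gs) b t₀ b t) → ∃[ t ] (φ t ≅ m)
      at (t , t∉K , o) = (t , t∉K) , λ w →
        (λ p → proj₁ (e w) (proj₂ (image-line l₀ t₀∉K l₀≅ (actΩ-linear gs) t∉K o w) p)) ,
        (λ p → proj₁ (image-line l₀ t₀∉K l₀≅ (actΩ-linear gs) t∉K o w) (proj₂ (e w) p))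

mainTheorem1 : (h : ℕ) → 1 ≤ h → (F : FiniteFieldQ4 h) →
    let open Geometry F in
    (l₀ : HLine) → DisjW l₀ →
    Σ (Ell → HLine) λ φ → ((∀ (t : Ell) → InOrbit l₀ (φ t))
    × (∀ s t → sameE s t → φ s ≅ φ t)
    × (∀ s t → φ s ≅ φ t → sameE s t)
    × (∀ m → InOrbit l₀ m → ∃[ t ] (φ t ≅ m))
    × (∀ (i : Fin 4) s t → (RE i s t → RH i (φ s) (φ t)) × (RH i (φ s) (φ t) → RE i s t)))
mainTheorem1 h 1≤h F l₀ disj = case Classification.DisjointLine.classification F 1≤h l₀ disj of λ
  { ((θ , θ∈K , θ∉Fq) , (b , t₀ , t₀∉K , l₀≅)) →
    let module I = Orbits.Isomorphism F 1≤h l₀ θ∈K θ∉Fq b t₀∉K l₀≅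
    in I.φ , I.in-orbit , I.same⇒≅ , I.≅⇒same , I.surjective , I.RE⇔RH 1≤h θ∈K θ∉Fq }
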